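{- Let $n\ge 3$ and $k\ge s\ge 3$ be integers, and let $G$ be a $2$-connected graph on $n$ vertices containing an edge $e$ with $c_e(G)\le k$. If $N_s(G)=g_s(n,k)$, then $M(G,e)=X_{n,k}$ (up to isomorphism).
   Context: All graphs are finite and simple; equality of graphs means isomorphism. $N_s(G)$ denotes the number of $s$-cliques of $G$. For an edge $e$ of $G$, $c_e(G)$ is the maximum length of a cycle of $G$ containing $e$. Let $\beta=\lfloor (n-2)/(k-2)\rfloor$ and $q=n-2-\beta(k-2)$. Then $X_{n,k}=K_2\vee(\beta K_{k-2}+K_q)$, where $\vee$ denotes the join, $+$ the disjoint union and $\beta K_{k-2}$ the disjoint union of $\beta$ copies of $K_{k-2}$. $g_s(n,k)$ is the number of $s$-cliques of $X_{n,k}$; for $s\ge 3$, $g_s(n,k)=\beta\binom{k}{s}+\binom{q+2}{s}$. For a $2$-connected graph $G$ with an edge $uv$ such that $c_{uv}(G)\le k$, $M(G,uv)$ denotes an edge-maximal graph with respect to $G$ and $uv$: a graph on vertex set $V(G)$ containing $G$ as a spanning subgraph, with $c_{uv}(M(G,uv))\le k$, such that for every non-edge $f$ of $M(G,uv)$ we have $c_{uv}(M(G,uv)+f)>k$. -}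

module Defs where

open import Data.Bool using (Bool; true; false; _∧_; _∨_; not)
open import Data.Nat using (ℕ; zero; suc; _+_; _∸_; _≤_; _<_; _/_; _<?_)
open import Data.Nat.Properties using () renaming (_≟_ to _≟ℕ_)
open import Data.Fin using (Fin; toℕ) renaming (zero to fz; suc to fs)
open import Data.Fin.Properties using (_≟_)
open import Data.List using (List; []; _∷_; _∷ʳ_; length; filterᵇ; allFin; foldr; concatMap)
open import Data.List.Relation.Unary.Linked using (Linked)
open import Data.List.Relation.Unary.Unique.Propositional using (Unique)
open import Data.Product using (Σ; _×_; _,_)
open import Function.Bundles using (_↔_; Inverse)
open import Relation.Binary.PropositionalEquality using (_≡_; _≢_; refl) renaming (sym to sym≡)
open import Relation.Nullary using (Dec; yes; no)
open import Data.Empty using (⊥-elim)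
open import Relation.Nullary.Decidable using (⌊_⌋)

record Graph (n : ℕ) : Set where
  field
    adj   : Fin n → Fin n → Bool
    sym   : ∀ i j → adj i j ≡ adj j i
    irref : ∀ i → adj i i ≡ false
open Graph public

Adj : ∀ {n} → (Fin n → Fin n → Bool) → Fin n → Fin n → Set
Adj a i j = a i j ≡ true

data WalkIn {n} (G : Graph n) (P : Fin n → Set) : Fin n → Fin n → Set where
  here : ∀ {a} → P a → WalkIn G P a a
  step : ∀ {a b c} → P a → Adj (adj G) a b → WalkIn G P b c → WalkIn G P a c

TwoConnected : ∀ {n} → Graph n → Set
TwoConnected {n} G =
  (3 ≤ n)
  × (∀ a b → WalkIn G (λ _ → Fin n) a b)
  × (∀ x a b → a ≢ x → b ≢ x → WalkIn G (λ y → y ≢ x) a b)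

-- A cycle through the edge uv, given as the vertex sequence u, v, ws, (back to u).
-- Its length is 2 + length ws.
CycleThrough : ∀ {n} → (Fin n → Fin n → Bool) → Fin n → Fin n → List (Fin n) → Set
CycleThrough a u v ws =
  Unique (u ∷ v ∷ ws)
  × Linked (Adj a) ((u ∷ v ∷ ws) ∷ʳ u)
  × (1 ≤ length ws)

CircLe : ∀ {n} → (Fin n → Fin n → Bool) → Fin n → Fin n → ℕ → Set
CircLe a u v k = ∀ ws → CycleThrough a u v ws → 2 + length ws ≤ k

CircGt : ∀ {n} → (Fin n → Fin n → Bool) → Fin n → Fin n → ℕ → Set
CircGt a u v k = Σ (List _) λ ws → CycleThrough a u v ws × k < 2 + length ws

addEdge : ∀ {n} → (Fin n → Fin n → Bool) → Fin n → Fin n → Fin n → Fin n → Bool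
addEdge a x y i j = a i j ∨ (⌊ i ≟ x ⌋ ∧ ⌊ j ≟ y ⌋) ∨ (⌊ i ≟ y ⌋ ∧ ⌊ j ≟ x ⌋)

_⊆G_ : ∀ {n} → Graph n → Graph n → Set
G ⊆G M = ∀ i j → Adj (adj G) i j → Adj (adj M) i j

EdgeMaximal : ∀ {n} → Graph n → Fin n → Fin n → ℕ → Graph n → Set
EdgeMaximal G u v k M =
  (G ⊆G M)
  × CircLe (adj M) u v k
  × (∀ x y → x ≢ y → adj M x y ≡ false → CircGt (addEdge (adj M) x y) u v k)

_≅_ : ∀ {n} → Graph n → Graph n → Set
_≅_ {n} G H = Σ (Fin n ↔ Fin n) λ σ →
  ∀ i j → adj H (Inverse.to σ i) (Inverse.to σ j) ≡ adj G i j

extend : ∀ {n} → Bool → (Fin n → Bool) → Fin (suc n) → Bool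
extend b f fz = b
extend b f (fs i) = f i

allSubsets : ∀ n → List (Fin n → Bool)
allSubsets zero = (λ ()) ∷ []
allSubsets (suc n) = concatMap (λ f → extend false f ∷ extend true f ∷ []) (allSubsets n)

card : ∀ {n} → (Fin n → Bool) → ℕ
card {n} S = length (filterᵇ S (allFin n))

allᵇ : ∀ {A : Set} → (A → Bool) → List A → Bool
allᵇ p = foldr (λ x b → p x ∧ b) true

isCliqueᵇ : ∀ {n} → Graph n → (Fin n → Bool) → Bool
isCliqueᵇ {n} G S =
  allᵇ (λ i → allᵇ (λ j → not (S i ∧ S j) ∨ ⌊ i ≟ j ⌋ ∨ adj G i j) (allFin n)) (allFin n)

N : ℕ → ∀ {n} → Graph n → ℕ
N s {n} G = length (filterᵇ (λ S → ⌊ card S ≟ℕ s ⌋ ∧ isCliqueᵇ G S) (allSubsets n))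

-- X_{n,k} = K_2 ∨ (β K_{k-2} + K_q) on Fin n (intended for k ≥ 3, where k-2 = suc (k ∸ 3)).
-- Vertices 0,1 form the K_2; vertex i ≥ 2 lies in block (i-2) / (k-2);
-- blocks 0..β-1 have k-2 vertices, block β has q vertices.
block : ∀ {n} → ℕ → Fin n → ℕ
block k i = (toℕ i ∸ 2) / suc (k ∸ 3)

Xadj : (n k : ℕ) → Fin n → Fin n → Bool
Xadj n k i j = not ⌊ i ≟ j ⌋ ∧
  (⌊ toℕ i <? 2 ⌋ ∨ ⌊ toℕ j <? 2 ⌋ ∨ ⌊ block k i ≟ℕ block k j ⌋)

private
  eqᵇ-sym : ∀ {A : Set} {x y : A} (d₁ : Dec (x ≡ y)) (d₂ : Dec (y ≡ x)) → ⌊ d₁ ⌋ ≡ ⌊ d₂ ⌋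
  eqᵇ-sym (yes p) (yes q) = refl
  eqᵇ-sym (yes p) (no ¬q) = ⊥-elim (¬q (sym≡ p))
  eqᵇ-sym (no ¬p) (yes q) = ⊥-elim (¬p (sym≡ q))
  eqᵇ-sym (no ¬p) (no ¬q) = refl

  ∨-comm : ∀ a b → a ∨ b ≡ b ∨ a
  ∨-comm false false = refl
  ∨-comm false true = refl
  ∨-comm true false = refl
  ∨-comm true true = refl

  ∨-swap : ∀ a b c → a ∨ b ∨ c ≡ b ∨ a ∨ c
  ∨-swap false b c = refl
  ∨-swap true false c = refl
  ∨-swap true true c = refl

Xsym : ∀ n k i j → Xadj n k i j ≡ Xadj n k j i
Xsym n k i j rewrite eqᵇ-sym (i ≟ j) (j ≟ i)
                   | eqᵇ-sym (block k i ≟ℕ block k j) (block k j ≟ℕ block k i)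
                   | ∨-swap ⌊ toℕ i <? 2 ⌋ ⌊ toℕ j <? 2 ⌋ ⌊ block k j ≟ℕ block k i ⌋ = refl

Xirr : ∀ n k i → Xadj n k i i ≡ false
Xirr n k i with i ≟ i
... | yes _ = refl
... | no ¬p = ⊥-elim (¬p refl)

X : (n k : ℕ) → Graph n
X n k = record { adj = Xadj n k ; sym = Xsym n k ; irref = Xirr n k }

g : (s n k : ℕ) → ℕ
g s n k = N s (X n k)

-- Put m = k − 2 and call u, v the terminals of the edge e.  Two operations on a graph keep it 2-connected, keep all
-- cycles through uv of length at most k, and do not decrease the number of s-cliques: Kelmans' operation, moving the
-- edges at a neighbour w of u to u, and, when {u , w} separates a set D from v, reattaching D at u and v.  Each raises
-- deg u + deg v, so in the end both terminals are adjacent to everything.  Kelmans' operation inside the rest, always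
-- towards the larger vertex, then nests the closed neighbourhoods of adjacent vertices: away from the terminals the
-- graph becomes the closure of a rooted forest, and a vertex with d ancestors accounts for C(d + 2, s − 1) cliques.
-- Components now have no path on m + 1 vertices.  If a component with at least m vertices is not an m-clique, let its
-- longest root chain have r vertices; at most m − r vertices off the chain have more than m − r ancestors, as they could
-- be woven into the chain otherwise, and convexity of the weights makes the component strictly worse than cliques of
-- order m.  So a graph with g_s(n,k) cliques ends as ⌊(n−2)/m⌋ such cliques and a rest.  This structure is inherited
-- backwards through every operation, since the alternative is a path from u to v that is too long; hence M has it, and
-- edge-maximality supplies the missing edges of the rest.
module Submission where

open import Defs renaming (sym to adj-sym) hiding (here; step)
open import Data.Bool using (Bool; true; false; _∧_; _∨_; not; T; if_then_else_)
open import Data.Bool.Properties using (T?; ∧-comm; ∨-comm; not-involutive)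
import Data.Bool as Bool
open import Data.Nat using (ℕ; zero; suc; _+_; _*_; _∸_; _≤_; _<_; _⊓_; _/_; _%_; z≤n; s≤s; s≤s⁻¹; NonZero; >-nonZero; _<?_; _≤?_)
open import Data.Nat.Properties using () renaming (_≟_ to _≟ℕ_; <-cmp to <-cmpℕ)
open import Data.Nat.Properties
  hiding (_≟_; _<?_; _≤?_; <-cmp)
open import Data.Nat.DivMod
open import Data.Nat.Divisibility using (∣-refl; n∣m*n)
open import Data.Nat.Combinatorics using (_C_; nCk+nC[k+1]≡[n+1]C[k+1]; k>n⇒nCk≡0; nCk≡nC[n∸k]; nCn≡1)
open import Data.Nat.Tactic.RingSolver using (solve-∀)
open import Data.Fin using (Fin; toℕ; fromℕ<; punchOut) renaming (zero to fz; suc to fs)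
open import Data.Fin.Properties using (_≟_; toℕ-injective; toℕ<n; toℕ-fromℕ<; any?; injective⇒≤; punchOut-injective; <-cmp)
open import Data.List using (List; []; _∷_; _++_; length; filterᵇ; map; allFin; tabulate; reverse; concatMap; downFrom; upTo)
open import Data.List.Properties
open import Data.Nat.ListAction using (sum)
open import Data.Nat.ListAction.Properties using (sum-↭)
open import Data.List.Membership.Propositional using (_∈_; _∉_; find)
open import Data.List.Membership.Propositional.Properties
open import Data.List.Relation.Unary.Any using (here; there)
import Data.List.Relation.Unary.Any as Any
open import Data.List.Relation.Unary.All using (All; []; _∷_)
import Data.List.Relation.Unary.All as All
import Data.List.Relation.Unary.All.Properties as AllP
open import Data.List.Relation.Unary.AllPairs using (AllPairs; []; _∷_)
import Data.List.Relation.Unary.AllPairs as AllPairs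
import Data.List.Relation.Unary.AllPairs.Properties as AllPairsP
open import Data.List.Relation.Unary.Linked using (Linked; []; [-]; _∷_)
open import Data.List.Relation.Unary.Unique.Propositional using (Unique)
import Data.List.Relation.Unary.Unique.Propositional.Properties as UniqueP
open import Data.List.Relation.Binary.Sublist.Propositional using (_⊆_; []; _∷_; _∷ʳ_; ⊆-refl; ⊆-trans)
open import Data.List.Relation.Binary.Sublist.Propositional.Properties using (length-mono-≤)
open import Data.List.Relation.Binary.Permutation.Propositional using (_↭_; ↭-refl; ↭-sym; ↭-trans; ↭-prep; ↭-swap)
import Data.List.Relation.Binary.Permutation.Propositional as Perm
import Data.List.Relation.Binary.Permutation.Propositional.Properties as ↭P
open import Data.Product using (Σ; ∃; ∃₂; _×_; _,_; proj₁; proj₂)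
open import Data.Sum using (_⊎_; inj₁; inj₂; [_,_]′)
import Data.Sum as Sum
open import Data.Empty using (⊥; ⊥-elim)
open import Data.Unit using (tt)
open import Function using (_∘_; id; _↔_; mk↔ₛ′; Inverse)
open import Relation.Binary using (tri<; tri≈; tri>)
open import Relation.Binary.PropositionalEquality hiding ([_])
open import Relation.Nullary using (Dec; yes; no; ¬_)
open import Relation.Nullary.Decidable using (⌊_⌋; _×-dec_; ¬?)

-- An operation cannot be undone, so X_{n,k} itself does not pull back. What does is `Good`: the
-- full blocks are m-cliques joined to both terminals, no edge runs between blocks, and nothing is
-- said about the edges inside the last block or from it to u and v. The operations act on M rather
-- than on G, and the hypothesis enters only through N_s(M) ≥ g_s(n,k). The weights C(d + 2, s - 1)
-- vanish for small d, so they are neither strictly increasing nor strictly convex throughout.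
-- Strictness is taken only at the largest depth m - 1 of a block, where s ≤ k provides it; each
-- strict inequality is arranged so that this depth occurs on its larger side. In a component whose
-- longest chain has depths 0, ..., r, put t = m - 1 - r. Then t other vertices are charged the
-- weight of depth r and all remaining ones that of depth a = min(t, r). Since 2a < m, a full block
-- weighs at least m times the weight of depth a, and the gain from prolonging the chain to depth m
-- - 1 pays for what an incomplete last block falls short of.

private variable
  A B : Set

-- Counting cliques

true≢false : true ≢ false
true≢false ()

∨-true : ∀ b c → b ∨ c ≡ true → b ≡ true ⊎ c ≡ true
∨-true true  c p = inj₁ refl
∨-true false c p = inj₂ p

∨-trueˡ : ∀ {b} c → b ≡ true → b ∨ c ≡ true
∨-trueˡ c refl = refl

∨-trueʳ : ∀ b {c} → c ≡ true → b ∨ c ≡ true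
∨-trueʳ true  p = refl
∨-trueʳ false p = p

∧-true : ∀ b c → b ∧ c ≡ true → b ≡ true × c ≡ true
∧-true true c p = refl , p

∧-intro : ∀ {b c} → b ≡ true → c ≡ true → b ∧ c ≡ true
∧-intro refl refl = refl

bool-≡ : ∀ {b c} → (b ≡ true → c ≡ true) → (c ≡ true → b ≡ true) → b ≡ c
bool-≡ {true}  {true}  f h = refl
bool-≡ {true}  {false} f h = ⊥-elim (true≢false (sym (f refl)))
bool-≡ {false} {true}  f h = h refl
bool-≡ {false} {false} f h = refl

⌊⌋-true : ∀ {P : Set} (d : Dec P) → ⌊ d ⌋ ≡ true → P
⌊⌋-true (yes p) _ = p

⌊⌋-intro : ∀ {P : Set} (d : Dec P) → P → ⌊ d ⌋ ≡ true
⌊⌋-intro (yes p) _ = refl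
⌊⌋-intro (no ¬p) p = ⊥-elim (¬p p)

⌊⌋-false : ∀ {P : Set} (d : Dec P) → ¬ P → ⌊ d ⌋ ≡ false
⌊⌋-false (yes p) ¬p = ⊥-elim (¬p p)
⌊⌋-false (no _)  _  = refl

∈-filterᵇ⁺ : ∀ (p : A → Bool) {x l} → x ∈ l → p x ≡ true → x ∈ filterᵇ p l
∈-filterᵇ⁺ p {l = y ∷ l} (here refl) q rewrite q = here refl
∈-filterᵇ⁺ p {l = y ∷ l} (there m) q with p y
... | true  = there (∈-filterᵇ⁺ p m q)
... | false = ∈-filterᵇ⁺ p m q

∈-filterᵇ⁻ : ∀ (p : A → Bool) {x} l → x ∈ filterᵇ p l → x ∈ l × p x ≡ true
∈-filterᵇ⁻ p (y ∷ l) m with p y in eq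
∈-filterᵇ⁻ p (y ∷ l) (here refl) | true = here refl , eq
∈-filterᵇ⁻ p (y ∷ l) (there m)   | true with ∈-filterᵇ⁻ p l m
... | m′ , q = there m′ , q
∈-filterᵇ⁻ p (y ∷ l) m | false with ∈-filterᵇ⁻ p l m
... | m′ , q = there m′ , q

filterᵇ-cong : ∀ {p q : A → Bool} l → (∀ {x} → x ∈ l → p x ≡ q x) → filterᵇ p l ≡ filterᵇ q l
filterᵇ-cong [] e = refl
filterᵇ-cong {p = p} {q} (x ∷ l) e with p x | q x | e {x} (here refl)
... | true  | .true  | refl = cong (x ∷_) (filterᵇ-cong l (e ∘ there))
... | false | .false | refl = filterᵇ-cong l (e ∘ there)

filterᵇ-∘ : ∀ (p q : A → Bool) l → filterᵇ p (filterᵇ q l) ≡ filterᵇ (λ x → q x ∧ p x) l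
filterᵇ-∘ p q [] = refl
filterᵇ-∘ p q (x ∷ l) with q x
... | false = filterᵇ-∘ p q l
... | true with p x
...   | true  = cong (x ∷_) (filterᵇ-∘ p q l)
...   | false = filterᵇ-∘ p q l

filterᵇ-comm : ∀ (p q : A → Bool) l → filterᵇ p (filterᵇ q l) ≡ filterᵇ q (filterᵇ p l)
filterᵇ-comm p q l = trans (filterᵇ-∘ p q l) (trans (filterᵇ-cong l (λ {x} _ → ∧-comm (q x) (p x))) (sym (filterᵇ-∘ q p l)))

filterᵇ-map : ∀ (p : B → Bool) (h : A → B) l → filterᵇ p (map h l) ≡ map h (filterᵇ (p ∘ h) l)
filterᵇ-map p h [] = refl
filterᵇ-map p h (x ∷ l) with p (h x)
... | true  = cong (h x ∷_) (filterᵇ-map p h l)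
... | false = filterᵇ-map p h l

filterᵇ-⊆ : ∀ {p q : A → Bool} {xs ys} → xs ⊆ ys → (∀ {x} → x ∈ xs → p x ≡ true → q x ≡ true) →
  filterᵇ p xs ⊆ filterᵇ q ys
filterᵇ-⊆ [] h = []
filterᵇ-⊆ {q = q} (y ∷ʳ τ) h with q y
... | true  = y ∷ʳ filterᵇ-⊆ τ h
... | false = filterᵇ-⊆ τ h
filterᵇ-⊆ {p = p} {q} {x ∷ xs} (refl ∷ τ) h with p x | q x | h {x} (here refl)
... | true  | true  | _ = refl ∷ filterᵇ-⊆ τ (h ∘ there)
... | true  | false | e = ⊥-elim (true≢false (sym (e refl)))
... | false | true  | _ = x ∷ʳ filterᵇ-⊆ τ (h ∘ there)
... | false | false | _ = filterᵇ-⊆ τ (h ∘ there)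

+-exchange : ∀ p q r t → (p + q) + (r + t) ≡ (p + r) + (q + t)
+-exchange = solve-∀

+-right-swap : ∀ p q r → (p + q) + r ≡ (p + r) + q
+-right-swap = solve-∀

-- The number of s-cliques with vertices in l, each counted at its first vertex.
K : (A → A → Bool) → ℕ → List A → ℕ
K a zero    l       = 1
K a (suc s) []      = 0
K a (suc s) (x ∷ l) = K a (suc s) l + K a s (filterᵇ (a x) l)

K-mono : ∀ {a b : A → A → Bool} s {xs ys} → xs ⊆ ys →
  (∀ {x y} → x ∈ xs → y ∈ xs → a x y ≡ true → b x y ≡ true) → K a s xs ≤ K b s ys
K-mono zero τ h = ≤-refl
K-mono (suc s) [] h = ≤-refl
K-mono {a = a} {b} (suc s) (y ∷ʳ τ) h = ≤-trans (K-mono (suc s) τ h) (m≤m+n _ _)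
K-mono {a = a} {b} (suc s) {x ∷ xs} (refl ∷ τ) h =
  +-mono-≤ (K-mono (suc s) τ (λ p q → h (there p) (there q)))
    (K-mono s (filterᵇ-⊆ τ (λ m → h (here refl) (there m)))
      (λ p q → h (there (proj₁ (∈-filterᵇ⁻ (a x) xs p))) (there (proj₁ (∈-filterᵇ⁻ (a x) xs q)))))

K-map : ∀ (a : B → B → Bool) (h : A → B) s l → K a s (map h l) ≡ K (λ x y → a (h x) (h y)) s l
K-map a h zero l = refl
K-map a h (suc s) [] = refl
K-map a h (suc s) (x ∷ l) = cong₂ _+_ (K-map a h (suc s) l)
  (trans (cong (K a s) (filterᵇ-map (a (h x)) h l)) (K-map a h s _))

Supermodular : (A → A → Bool) → ℕ → List A → (A → Bool) → (A → Bool) → Set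
Supermodular a s l P Q =
  K a s (filterᵇ P l) + K a s (filterᵇ Q l)
    ≤ K a s (filterᵇ (λ x → P x ∨ Q x) l) + K a s (filterᵇ (λ x → P x ∧ Q x) l)

supermodular-step : ∀ (a : A → A → Bool) s x l (P Q : A → Bool) →
  Supermodular a (suc s) l P Q → Supermodular a s (filterᵇ (a x) l) P Q → Supermodular a (suc s) (x ∷ l) P Q
supermodular-step {A = A} a s x l P Q ih ih₂ = go
  where
  P∨Q : A → Bool
  P∨Q x = P x ∨ Q x
  k : ℕ → (A → Bool) → List A → ℕ
  k s R l = K a s (filterᵇ R l)
  l′ = filterᵇ (a x) l
  grow : ∀ {R} → (∀ {y} → R y ≡ true → P∨Q y ≡ true) →
    K a s (filterᵇ (a x) (filterᵇ R l)) ≤ K a s (filterᵇ (a x) (filterᵇ P∨Q l))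
  grow {R} h = K-mono {a = a} s
    (filterᵇ-⊆ {p = a x} {q = a x} (filterᵇ-⊆ {p = R} {q = P∨Q} (⊆-refl {x = l}) (λ _ → h)) (λ _ e → e)) (λ _ _ e → e)
  go : Supermodular a (suc s) (x ∷ l) P Q
  go with P x | Q x
  ... | false | false = ih
  ... | true | true
    rewrite filterᵇ-comm (a x) P l | filterᵇ-comm (a x) Q l
          | filterᵇ-comm (a x) P∨Q l | filterᵇ-comm (a x) (λ x → P x ∧ Q x) l =
    subst₂ _≤_ (+-exchange (k (suc s) P l) _ (k s P l′) _) (+-exchange (k (suc s) P∨Q l) _ (k s P∨Q l′) _)
      (+-mono-≤ ih ih₂)
  ... | true | false = subst₂ _≤_ (+-right-swap (k (suc s) P l) _ _) (+-right-swap (k (suc s) P∨Q l) _ _)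
    (+-mono-≤ ih (grow (λ {y} → ∨-trueˡ (Q y))))
  ... | false | true = subst₂ _≤_ (+-assoc (k (suc s) P l) _ _) (+-right-swap (k (suc s) P∨Q l) _ _)
    (+-mono-≤ ih (grow (λ {y} → ∨-trueʳ (P y))))

-- A clique inside P or inside Q lies in their union, and a clique inside both lies in the
-- intersection as well. In the Kelmans operation P and Q are two neighbourhoods, which get replaced
-- by their union and intersection.
K-supermodular : ∀ (a : A → A → Bool) s l (P Q : A → Bool) →
  Supermodular a s l P Q
K-supermodular a zero l P Q = ≤-refl
K-supermodular a (suc s) [] P Q = ≤-refl
K-supermodular a (suc s) (x ∷ l) P Q =
  supermodular-step a s x l P Q (K-supermodular a (suc s) l P Q) (K-supermodular a s (filterᵇ (a x) l) P Q)

Submodular : (A → A → Bool) → ℕ → List A → (A → Bool) → (A → Bool) → Set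
Submodular a s l P Q =
  K a s (filterᵇ (λ x → P x ∨ Q x) l) + K a s (filterᵇ (λ x → P x ∧ Q x) l)
    ≤ K a s (filterᵇ P l) + K a s (filterᵇ Q l)

NoCrossing : (A → A → Bool) → List A → (A → Bool) → (A → Bool) → Set
NoCrossing a l P Q =
  ∀ {x y} → x ∈ l → y ∈ l → a x y ≡ true → P x ≡ true → Q x ≡ false → Q y ≡ true → P y ≡ true

submodular-step : ∀ (a : A → A → Bool) s x l (P Q : A → Bool) →
  NoCrossing a (x ∷ l) P Q → NoCrossing a (x ∷ l) Q P →
  Submodular a (suc s) l P Q → Submodular a s (filterᵇ (a x) l) P Q → Submodular a (suc s) (x ∷ l) P Q
submodular-step {A = A} a s x l P Q h₁ h₂ ih ih₂ = go
  where
  in-l : ∀ {y} → y ∈ filterᵇ (a x) l → y ∈ l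
  in-l m = proj₁ (∈-filterᵇ⁻ (a x) l m)
  k : ℕ → (A → Bool) → List A → ℕ
  k s R l = K a s (filterᵇ R l)
  l′ = filterᵇ (a x) l
  P∨Q = λ x → P x ∨ Q x
  go : Submodular a (suc s) (x ∷ l) P Q
  go with P x in px | Q x in qx
  ... | false | false = ih
  ... | true | true
    rewrite filterᵇ-comm (a x) P l | filterᵇ-comm (a x) Q l
          | filterᵇ-comm (a x) (λ x → P x ∨ Q x) l | filterᵇ-comm (a x) (λ x → P x ∧ Q x) l =
    subst₂ _≤_ (+-exchange (k (suc s) P∨Q l) _ (k s P∨Q l′) _) (+-exchange (k (suc s) P l) _ (k s P l′) _)
      (+-mono-≤ ih ih₂)
  ... | true | false
    rewrite filterᵇ-comm (a x) P l | filterᵇ-comm (a x) (λ x → P x ∨ Q x) l =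
    subst₂ _≤_ (+-right-swap (k (suc s) P∨Q l) _ _) (+-right-swap (k (suc s) P l) _ _)
      (+-mono-≤ ih (K-mono {a = a} s (filterᵇ-⊆ {p = λ x → P x ∨ Q x} {q = P} ⊆-refl step) (λ _ _ e → e)))
    where
    step : ∀ {y} → y ∈ filterᵇ (a x) l → P y ∨ Q y ≡ true → P y ≡ true
    step {y} m e with ∨-true (P y) (Q y) e
    ... | inj₁ p = p
    ... | inj₂ q = h₁ (here refl) (there (in-l m)) (proj₂ (∈-filterᵇ⁻ (a x) l m)) px qx q
  ... | false | true
    rewrite filterᵇ-comm (a x) Q l | filterᵇ-comm (a x) (λ x → P x ∨ Q x) l =
    subst₂ _≤_ (+-right-swap (k (suc s) P∨Q l) _ _) (+-assoc (k (suc s) P l) _ _)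
      (+-mono-≤ ih (K-mono {a = a} s (filterᵇ-⊆ {p = λ x → P x ∨ Q x} {q = Q} ⊆-refl step) (λ _ _ e → e)))
    where
    step : ∀ {y} → y ∈ filterᵇ (a x) l → P y ∨ Q y ≡ true → Q y ≡ true
    step {y} m e with ∨-true (P y) (Q y) e
    ... | inj₂ q = q
    ... | inj₁ p = h₂ (here refl) (there (in-l m)) (proj₂ (∈-filterᵇ⁻ (a x) l m)) qx px p

-- With no edge between P minus Q and Q minus P, each clique in the union lies inside P or inside Q,
-- and supermodularity becomes an equality.
K-submodular : ∀ (a : A → A → Bool) s l (P Q : A → Bool) →
  NoCrossing a l P Q → NoCrossing a l Q P → Submodular a s l P Q
K-submodular a zero l P Q h₁ h₂ = ≤-refl
K-submodular a (suc s) [] P Q h₁ h₂ = ≤-refl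
K-submodular a (suc s) (x ∷ l) P Q h₁ h₂ =
  submodular-step a s x l P Q h₁ h₂
    (K-submodular a (suc s) l P Q (λ m m′ → h₁ (there m) (there m′)) (λ m m′ → h₂ (there m) (there m′)))
    (K-submodular a s (filterᵇ (a x) l) P Q
      (λ m m′ → h₁ (there (in-l m)) (there (in-l m′))) (λ m m′ → h₂ (there (in-l m)) (there (in-l m′))))
  where
  in-l : ∀ {y} → y ∈ filterᵇ (a x) l → y ∈ l
  in-l m = proj₁ (∈-filterᵇ⁻ (a x) l m)

filterᵇ-↭ : ∀ (p : A → Bool) {xs ys} → xs ↭ ys → filterᵇ p xs ↭ filterᵇ p ys
filterᵇ-↭ p τ = ↭P.filter-↭ (T? ∘ p) τ

K-swap : ∀ (a : A → A → Bool) → (∀ x y → a x y ≡ a y x) → ∀ s x y xs →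
  K a (suc s) (x ∷ y ∷ xs) ≡ K a (suc s) (y ∷ x ∷ xs)
K-swap a sy s x y xs with a x y in p | a y x in q
... | true  | false = ⊥-elim (true≢false (trans (sym p) (trans (sy x y) q)))
... | false | true  = ⊥-elim (true≢false (trans (sym q) (trans (sy y x) p)))
... | false | false = +-right-swap (K a (suc s) xs) _ _
K-swap a sy zero x y xs | true | true = refl
K-swap a sy (suc s) x y xs | true | true =
  trans (cong (λ z → (k₀ + ky) + (kx + K a s z)) (filterᵇ-comm (a y) (a x) xs)) (+-exchange k₀ ky kx _)
  where
  k₀ = K a (suc (suc s)) xs
  ky = K a (suc s) (filterᵇ (a y) xs)
  kx = K a (suc s) (filterᵇ (a x) xs)

K-↭ : ∀ (a : A → A → Bool) → (∀ x y → a x y ≡ a y x) → ∀ s {xs ys} → xs ↭ ys → K a s xs ≡ K a s ys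
K-↭ a sy zero τ = refl
K-↭ a sy (suc s) Perm.refl = refl
K-↭ a sy (suc s) (Perm.prep x τ) = cong₂ _+_ (K-↭ a sy (suc s) τ) (K-↭ a sy s (filterᵇ-↭ (a x) τ))
K-↭ a sy (suc s) (Perm.trans τ τ′) = trans (K-↭ a sy (suc s) τ) (K-↭ a sy (suc s) τ′)
K-↭ a sy (suc s) {x ∷ y ∷ xs} (Perm.swap x y τ) = trans (K-swap a sy s x y xs)
  (cong₂ _+_ (cong₂ _+_ (K-↭ a sy (suc s) τ) (K-↭ a sy s (filterᵇ-↭ (a x) τ)))
             (K-↭ a sy s (filterᵇ-↭ (a y) (↭-prep x τ))))

C-zero : ∀ n → n C 0 ≡ 1
C-zero n = trans (nCk≡nC[n∸k] {0} {n} z≤n) (nCn≡1 n)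

C-pascal : ∀ n k → suc n C suc k ≡ n C suc k + n C k
C-pascal n k = trans (sym (nCk+nC[k+1]≡[n+1]C[k+1] n k)) (+-comm (n C k) _)

C-mono : ∀ k {m n} → m ≤ n → m C k ≤ n C k
C-mono zero {m} {n} p = ≤-reflexive (trans (C-zero m) (sym (C-zero n)))
C-mono (suc k) {zero} p rewrite k>n⇒nCk≡0 {0} {suc k} (s≤s z≤n) = z≤n
C-mono (suc k) {suc m} {suc n} (s≤s p) rewrite C-pascal m k | C-pascal n k =
  +-mono-≤ (C-mono (suc k) p) (C-mono k p)

length-filterᵇ≤ : ∀ (p : A → Bool) l → length (filterᵇ p l) ≤ length l
length-filterᵇ≤ p l = length-filter (T? ∘ p) l

K≤C : ∀ (a : A → A → Bool) s l → K a s l ≤ length l C s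
K≤C a zero l = ≤-reflexive (sym (C-zero (length l)))
K≤C a (suc s) [] = z≤n
K≤C a (suc s) (x ∷ l) = subst (K a (suc s) (x ∷ l) ≤_) (sym (C-pascal (length l) s))
  (+-mono-≤ (K≤C a (suc s) l) (≤-trans (K≤C a s (filterᵇ (a x) l)) (C-mono s (length-filterᵇ≤ (a x) l))))

K-clique : ∀ (a : A → A → Bool) s l → AllPairs (λ x y → a x y ≡ true) l → K a s l ≡ length l C s
K-clique a zero l cl = sym (C-zero (length l))
K-clique a (suc s) [] cl = sym (k>n⇒nCk≡0 {0} {suc s} (s≤s z≤n))
K-clique a (suc s) (x ∷ l) (px ∷ cl) = trans
  (cong₂ _+_ (K-clique a (suc s) l cl)
    (trans (cong (K a s) (filter-all (T? ∘ a x) (All.map (λ e → subst T (sym e) tt) px))) (K-clique a s l cl)))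
  (sym (C-pascal (length l) s))

count : (A → Bool) → List A → ℕ
count p l = length (filterᵇ p l)

count-pairs : ∀ {S R : Set} (p : R → Bool) (e₀ e₁ : S → R) L →
  count p (concatMap (λ f → e₀ f ∷ e₁ f ∷ []) L) ≡ count (p ∘ e₀) L + count (p ∘ e₁) L
count-pairs p e₀ e₁ [] = refl
count-pairs p e₀ e₁ (f ∷ L) with p (e₀ f)
count-pairs p e₀ e₁ (f ∷ L) | true with p (e₁ f)
... | true  = cong suc (trans (cong suc (count-pairs p e₀ e₁ L)) (sym (+-suc _ _)))
... | false = cong suc (count-pairs p e₀ e₁ L)
count-pairs p e₀ e₁ (f ∷ L) | false with p (e₁ f)
... | true  = trans (cong suc (count-pairs p e₀ e₁ L)) (sym (+-suc _ _))
... | false = count-pairs p e₀ e₁ L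

count-none : ∀ {S : Set} (p : S → Bool) L → (∀ x → p x ≡ true → ⊥) → count p L ≡ 0
count-none p [] h = refl
count-none p (x ∷ L) h with p x in eq
... | true  = ⊥-elim (h x eq)
... | false = count-none p L h

count-all : ∀ {S : Set} (p : S → Bool) L → (∀ x → p x ≡ true) → count p L ≡ length L
count-all p [] h = refl
count-all p (x ∷ L) h rewrite h x = cong suc (count-all p L h)

allFin-suc : ∀ n → allFin (suc n) ≡ fz ∷ map fs (allFin n)
allFin-suc n = cong (fz ∷_) (sym (map-tabulate id fs))

card-extend : ∀ {n} b (f : Fin n → Bool) → card (extend b f) ≡ (if b then 1 else 0) + card f
card-extend {n} b f = trans (cong (λ l → length (filterᵇ (extend b f) l)) (allFin-suc n)) (go b)
  where
  tail-length : ∀ b → length (filterᵇ (extend b f) (map fs (allFin n))) ≡ card f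
  tail-length b = trans (cong length (filterᵇ-map (extend b f) fs (allFin n))) (length-map fs (filterᵇ f (allFin n)))
  go : ∀ b → length (filterᵇ (extend b f) (fz ∷ map fs (allFin n))) ≡ (if b then 1 else 0) + card f
  go true  = cong suc (tail-length true)
  go false = tail-length false

record CliqueIn {n} (a : Fin n → Fin n → Bool) (P : Fin n → Bool) (s : ℕ) (S : Fin n → Bool) : Set where
  constructor cliqueIn
  field
    size   : card S ≡ s
    inside : ∀ i → S i ≡ true → P i ≡ true
    linked : ∀ i j → S i ≡ true → S j ≡ true → i ≢ j → a i j ≡ true

-- The induction asks whether vertex 0 belongs to the clique; if it does, the rest is confined to
-- its neighbours, hence the set P. The test t is given only up to equivalence with `CliqueIn`,
-- because each step replaces it by its composition with `extend`.
count-cliques : ∀ n (a : Fin n → Fin n → Bool) → (∀ i j → a i j ≡ a j i) → ∀ P s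
  (t : (Fin n → Bool) → Bool) →
  (∀ S → t S ≡ true → CliqueIn a P s S) → (∀ S → CliqueIn a P s S → t S ≡ true) →
  count t (allSubsets n) ≡ K a s (filterᵇ P (allFin n))
count-cliques zero a sy P zero t h₁ h₂ =
  count-all t (allSubsets zero) (λ S → h₂ S (cliqueIn refl (λ ()) (λ ())))
count-cliques zero a sy P (suc s) t h₁ h₂ =
  count-none t (allSubsets zero) (λ S e → 0≢1+n (CliqueIn.size (h₁ S e)))
count-cliques (suc n) a sy P s t h₁ h₂ = begin
  count t (allSubsets (suc n))
    ≡⟨ count-pairs t (extend false) (extend true) (allSubsets n) ⟩
  count (t ∘ extend false) (allSubsets n) + count (t ∘ extend true) (allSubsets n)
    ≡⟨ cong (_+ count (t ∘ extend true) (allSubsets n)) without ⟩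
  K a′ s (filterᵇ P′ (allFin n)) + count (t ∘ extend true) (allSubsets n)
    ≡⟨ with₀ s t h₁ h₂ ⟩
  K a s (filterᵇ P (fz ∷ map fs (allFin n)))
    ≡⟨ cong (λ z → K a s (filterᵇ P z)) (sym (allFin-suc n)) ⟩
  K a s (filterᵇ P (allFin (suc n))) ∎
  where
  open ≡-Reasoning
  a′ : Fin n → Fin n → Bool
  a′ i j = a (fs i) (fs j)
  P′ : Fin n → Bool
  P′ = P ∘ fs
  tail : ∀ s (Q : Fin (suc n) → Bool) → K a′ s (filterᵇ (Q ∘ fs) (allFin n)) ≡ K a s (filterᵇ Q (map fs (allFin n)))
  tail s Q = trans (sym (K-map a fs s _)) (cong (K a s) (sym (filterᵇ-map Q fs (allFin n))))
  without : count (t ∘ extend false) (allSubsets n) ≡ K a′ s (filterᵇ P′ (allFin n))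
  without = count-cliques n a′ (λ i j → sy (fs i) (fs j)) P′ s (t ∘ extend false)
    (λ S e → let cliqueIn sz ins lk = h₁ (extend false S) e in
      cliqueIn (trans (sym (card-extend false S)) sz) (λ i → ins (fs i))
        (λ i j p q i≢j → lk (fs i) (fs j) p q (λ { refl → i≢j refl })))
    (λ { S (cliqueIn sz ins lk) → h₂ (extend false S) (cliqueIn (trans (card-extend false S) sz)
      (λ { fz () ; (fs i) → ins i })
      (λ { fz j () ; (fs i) fz p () ; (fs i) (fs j) p q i≢j → lk i j p q (λ { refl → i≢j refl }) })) })
  with₀ : ∀ s t → (∀ S → t S ≡ true → CliqueIn a P s S) → (∀ S → CliqueIn a P s S → t S ≡ true) →
    K a′ s (filterᵇ P′ (allFin n)) + count (t ∘ extend true) (allSubsets n) ≡ K a s (filterᵇ P (fz ∷ map fs (allFin n)))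
  with₀ zero t h₁ h₂ = cong suc (count-none (t ∘ extend true) (allSubsets n)
    (λ S e → 0≢1+n (trans (sym (CliqueIn.size (h₁ (extend true S) e))) (card-extend true S))))
  with₀ (suc s) t h₁ h₂ with P fz in eq
  ... | false = trans (cong₂ _+_ (tail (suc s) P) (count-none (t ∘ extend true) (allSubsets n)
      (λ S e → true≢false (trans (sym (CliqueIn.inside (h₁ (extend true S) e) fz refl)) eq)))) (+-identityʳ _)
  ... | true = cong₂ _+_ (tail (suc s) P) (trans
      (count-cliques n a′ (λ i j → sy (fs i) (fs j)) (λ i → P (fs i) ∧ a fz (fs i)) s (t ∘ extend true)
        (λ S e → let cliqueIn sz ins lk = h₁ (extend true S) e in
          cliqueIn (suc-injective (trans (sym (card-extend true S)) sz))
            (λ i p → ∧-intro (ins (fs i) p) (lk fz (fs i) refl p (λ ())))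
            (λ i j p q i≢j → lk (fs i) (fs j) p q (λ { refl → i≢j refl })))
        (λ { S (cliqueIn sz ins lk) → h₂ (extend true S) (cliqueIn (trans (card-extend true S) (cong suc sz))
          (λ { fz _ → eq ; (fs i) p → proj₁ (∧-true _ _ (ins i p)) })
          (λ { fz fz p q i≢j → ⊥-elim (i≢j refl)
             ; fz (fs j) p q i≢j → proj₂ (∧-true (P (fs j)) _ (ins j q))
             ; (fs i) fz p q i≢j → trans (sy (fs i) fz) (proj₂ (∧-true (P (fs i)) _ (ins i p)))
             ; (fs i) (fs j) p q i≢j → lk i j p q (λ { refl → i≢j refl }) })) }))
      (trans (tail s (λ x → P x ∧ a fz x))
        (cong (K a s) (sym (filterᵇ-∘ (a fz) P (map fs (allFin n)))))))

allᵇ-true : ∀ {A : Set} (p : A → Bool) l → allᵇ p l ≡ true → ∀ {x} → x ∈ l → p x ≡ true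
allᵇ-true p (y ∷ l) e (here refl) = proj₁ (∧-true (p y) _ e)
allᵇ-true p (y ∷ l) e (there m)   = allᵇ-true p l (proj₂ (∧-true (p y) _ e)) m

allᵇ-intro : ∀ {A : Set} (p : A → Bool) l → (∀ {x} → x ∈ l → p x ≡ true) → allᵇ p l ≡ true
allᵇ-intro p [] h = refl
allᵇ-intro p (y ∷ l) h = ∧-intro (h (here refl)) (allᵇ-intro p l (h ∘ there))

N≡K : ∀ s {n} (G : Graph n) → N s G ≡ K (adj G) s (allFin n)
N≡K s {n} G = trans
  (count-cliques n (adj G) (adj-sym G) (λ _ → true) s _ to from)
  (cong (K (adj G) s) (filter-all (T? ∘ λ _ → true) (All.universal (λ _ → tt) (allFin n))))
  where
  entry : (Fin n → Bool) → Fin n → Fin n → Bool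
  entry S i j = not (S i ∧ S j) ∨ ⌊ i ≟ j ⌋ ∨ adj G i j
  to : ∀ S → ⌊ card S ≟ℕ s ⌋ ∧ isCliqueᵇ G S ≡ true → CliqueIn (adj G) (λ _ → true) s S
  to S e with ∧-true ⌊ card S ≟ℕ s ⌋ _ e
  ... | e₁ , e₂ = cliqueIn (⌊⌋-true _ e₁) (λ _ _ → refl) lk
    where
    lk : ∀ i j → S i ≡ true → S j ≡ true → i ≢ j → adj G i j ≡ true
    lk i j p q i≢j with allᵇ-true _ (allFin n) (allᵇ-true _ (allFin n) e₂ (∈-allFin i)) (∈-allFin j)
    ... | r rewrite p | q | ⌊⌋-false (i ≟ j) i≢j = r
  from : ∀ S → CliqueIn (adj G) (λ _ → true) s S → ⌊ card S ≟ℕ s ⌋ ∧ isCliqueᵇ G S ≡ true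
  from S (cliqueIn sz _ lk) = ∧-intro (⌊⌋-intro (card S ≟ℕ s) sz)
    (allᵇ-intro _ (allFin n) (λ {i} _ → allᵇ-intro (entry S i) (allFin n) (λ {j} _ → go i j)))
    where
    go : ∀ i j → entry S i j ≡ true
    go i j with S i in p | S j in q | i ≟ j
    ... | false | _     | _ = refl
    ... | true  | false | _ = refl
    ... | true  | true  | yes _  = refl
    ... | true  | true  | no i≢j = lk i j p q i≢j

-- Sums of convex sequences

S : (ℕ → ℕ) → ℕ → ℕ
S f zero    = 0
S f (suc n) = S f n + f n

S-cong : ∀ {f h} n → (∀ i → i < n → f i ≡ h i) → S f n ≡ S h n
S-cong zero e = refl
S-cong (suc n) e = cong₂ _+_ (S-cong n (λ i p → e i (m≤n⇒m≤1+n p))) (e n ≤-refl)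

S-mono : ∀ {f h} n → (∀ i → i < n → f i ≤ h i) → S f n ≤ S h n
S-mono zero e = z≤n
S-mono (suc n) e = +-mono-≤ (S-mono n (λ i p → e i (m≤n⇒m≤1+n p))) (e n ≤-refl)

S-+ : ∀ f a b → S f (a + b) ≡ S f a + S (λ i → f (a + i)) b
S-+ f a zero rewrite +-identityʳ a = sym (+-identityʳ _)
S-+ f a (suc b) rewrite +-suc a b = trans (cong (_+ f (a + b)) (S-+ f a b)) (+-assoc (S f a) _ _)

S-const : ∀ c n → S (λ _ → c) n ≡ n * c
S-const c zero = refl
S-const c (suc n) = trans (cong (_+ c) (S-const c n)) (+-comm (n * c) c)

S-add : ∀ f h n → S (λ i → f i + h i) n ≡ S f n + S h n
S-add f h zero = refl
S-add f h (suc n) = trans (cong (_+ (f n + h n)) (S-add f h n)) (+-exchange (S f n) _ _ _)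

Mono : (ℕ → ℕ) → Set
Mono f = ∀ i → f i ≤ f (suc i)

Convex : (ℕ → ℕ) → Set
Convex f = ∀ i → f (suc i) + f (suc i) ≤ f i + f (suc (suc i))

mono-≤ : ∀ {f} → Mono f → ∀ {i j} → i ≤ j → f i ≤ f j
mono-≤ {f} mf {i} {j} i≤j = subst (λ z → f i ≤ f z) (m+[n∸m]≡n i≤j) (go (j ∸ i))
  where
  go : ∀ d → f i ≤ f (i + d)
  go zero = ≤-reflexive (cong f (sym (+-identityʳ i)))
  go (suc d) = ≤-trans (go d) (≤-trans (mf (i + d)) (≤-reflexive (cong f (sym (+-suc i d)))))

convex-step : ∀ {f} → Convex f → ∀ x e → f (suc x) + f (x + e) ≤ f x + f (suc (x + e))
convex-step {f} cf x zero rewrite +-identityʳ x = ≤-reflexive (+-comm (f (suc x)) (f x))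
convex-step {f} cf x (suc e) rewrite +-suc x e = +-cancelʳ-≤ (f (x + e) + f (suc (x + e))) _ _
  (subst₂ _≤_ (l₁ (f (suc x)) (f (x + e)) (f (suc (x + e)))) (l₂ (f x) (f (suc (x + e))) (f (x + e)) _)
    (+-mono-≤ (convex-step {f} cf x e) (cf (x + e))))
  where
  l₁ : ∀ p q r → (p + q) + (r + r) ≡ (p + r) + (q + r)
  l₁ = solve-∀
  l₂ : ∀ p q r t → (p + q) + (r + t) ≡ (p + t) + (r + q)
  l₂ = solve-∀

convex-shift : ∀ {f} → Convex f → ∀ {x y} d → x ≤ y → f (x + d) + f y ≤ f x + f (y + d)
convex-shift {f} cf {x} {y} zero x≤y rewrite +-identityʳ x | +-identityʳ y = ≤-refl
convex-shift {f} cf {x} {y} (suc d) x≤y rewrite +-suc x d | +-suc y d =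
  +-cancelʳ-≤ (f (x + d) + f (y + d)) _ _
    (subst₂ _≤_ (l₁ (f (x + d)) (f y) (f (suc (x + d))) _) (l₂ (f x) (f (y + d)) (f (x + d)) _)
      (+-mono-≤ (convex-shift {f} cf d x≤y) one))
  where
  one : f (suc (x + d)) + f (y + d) ≤ f (x + d) + f (suc (y + d))
  one = subst (λ z → f (suc (x + d)) + f z ≤ f (x + d) + f (suc z)) (m+[n∸m]≡n (+-monoˡ-≤ d x≤y))
    (convex-step {f} cf (x + d) _)
  l₁ : ∀ p q r t → (p + q) + (r + t) ≡ (r + q) + (p + t)
  l₁ = solve-∀
  l₂ : ∀ p q r t → (p + q) + (r + t) ≡ (p + t) + (r + q)
  l₂ = solve-∀

-- The terms at equal distance on both sides of c are paired: f(c - i) + f(c + i) ≥ 2 f(c). The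
-- terms below b remain unpaired and occur on both sides.
convex-centre : ∀ {f} → Convex f → ∀ c j b → b + j ≡ c →
  j * (f c + f c) + S f b ≤ S (λ i → f (suc (c + i))) j + S f c
convex-centre cf c zero b e rewrite +-identityʳ b | e = ≤-refl
convex-centre {f} cf c (suc j) b e = +-cancelʳ-≤ (f b) _ _
  (subst₂ _≤_ (l₁ (j * (f c + f c)) (S f b) (f b) _) (l₂ (S (λ i → f (suc (c + i))) j) (S f c) _ _)
    (+-mono-≤ (convex-centre {f} cf c j (suc b) (trans (sym (+-suc b j)) e)) mid))
  where
  mid : f c + f c ≤ f b + f (suc (c + j))
  mid = subst₂ (λ y z → f y + f c ≤ f b + f z) e (+-suc c j) (convex-shift {f} cf (suc j) (subst (b ≤_) e (m≤m+n b (suc j))))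
  l₁ : ∀ p q r t → (p + (q + r)) + t ≡ ((t + p) + q) + r
  l₁ = solve-∀
  l₂ : ∀ p q r t → (p + q) + (r + t) ≡ ((p + t) + q) + r
  l₂ = solve-∀

-- In other words, the sum of f(r + 1 + j) - f(r) over j < t is at least the sum of f(a) - f(i) over
-- i < a. As a ≤ r, increments from r dominate those from a; for j < a the increment f(a + 1 + j) -
-- f(a) is matched with i = a - 1 - j around the centre a. The terms with j ≥ a are nonnegative by
-- monotonicity.
convex-spread : ∀ {f} → Mono f → Convex f → ∀ r t a → a ≤ t → a ≤ r →
  t * f r + a * f a ≤ S (λ j → f (suc (r + j))) t + S f a
convex-spread {f} mf cf r t a a≤t a≤r = +-cancelʳ-≤ (S (λ j → f (suc (a + j))) a + a * f a) _ _ (begin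
  (t * f r + a * f a) + (U + a * f a)
    ≡⟨ cong (λ z → (z * f r + a * f a) + (U + a * f a)) (sym (m+[n∸m]≡n a≤t)) ⟩
  ((a + e) * f r + a * f a) + (U + a * f a)
    ≡⟨ l₁ a e (f r) (f a) U ⟩
  ((U + a * f r) + (a * (f a + f a) + 0)) + e * f r
    ≤⟨ +-mono-≤ (+-mono-≤ shifted (convex-centre {f} cf a a 0 refl)) rest ⟩
  ((a * f a + V) + (U + S f a)) + W
    ≡⟨ l₂ (a * f a) V U (S f a) W ⟩
  ((V + W) + S f a) + (U + a * f a)
    ≡⟨ cong (λ z → (z + S f a) + (U + a * f a))
        (trans (sym (S-+ (λ j → f (suc (r + j))) a e)) (cong (S _) (m+[n∸m]≡n a≤t))) ⟩
  (S (λ j → f (suc (r + j))) t + S f a) + (U + a * f a) ∎)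
  where
  open ≤-Reasoning
  e = t ∸ a
  U = S (λ j → f (suc (a + j))) a
  V = S (λ j → f (suc (r + j))) a
  W = S (λ j → f (suc (r + (a + j)))) e
  l₁ : ∀ a e x y u → ((a + e) * x + a * y) + (u + a * y) ≡ ((u + a * x) + (a * (y + y) + 0)) + e * x
  l₁ = solve-∀
  l₂ : ∀ x v u s w → ((x + v) + (u + s)) + w ≡ ((v + w) + s) + (u + x)
  l₂ = solve-∀
  shifted : U + a * f r ≤ a * f a + V
  shifted = subst₂ _≤_
    (trans (S-add _ _ a) (cong (U +_) (S-const (f r) a)))
    (trans (S-add _ _ a) (cong (_+ V) (S-const (f a) a)))
    (S-mono {λ j → f (suc (a + j)) + f r} {λ j → f a + f (suc (r + j))} a
      (λ j _ → subst₂ (λ y z → f y + f r ≤ f a + f z) (+-suc a j) (+-suc r j) (convex-shift {f} cf (suc j) a≤r)))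
  rest : e * f r ≤ W
  rest = subst (_≤ W) (S-const (f r) e)
    (S-mono e (λ j _ → mono-≤ {f} mf (≤-trans (m≤m+n r (a + j)) (n≤1+n _))))

-- F f m′ n is the sum of f over the depths in ⌊n / m⌋ cliques of order m = suc m′ and one clique of order n % m.
F : (ℕ → ℕ) → ℕ → ℕ → ℕ
F f m′ = S (λ i → f (i % suc m′))

module Periodic (f : ℕ → ℕ) (m′ : ℕ) where
  m = suc m′

  F-small : ∀ {n} → n ≤ m → F f m′ n ≡ S f n
  F-small {n} n≤m = S-cong n (λ i i<n → cong f (m<n⇒m%n≡m (<-≤-trans i<n n≤m)))

  F-period : ∀ n → F f m′ (m + n) ≡ S f m + F f m′ n
  F-period n = trans (S-+ _ m n) (cong₂ _+_ (F-small ≤-refl) (S-cong n (λ i _ → cong f ([m+n]%m≡n%m i))))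
    where
    [m+n]%m≡n%m : ∀ i → (m + i) % m ≡ i % m
    [m+n]%m≡n%m i = trans (cong (_% m) (+-comm m i)) ([m+n]%n≡m%n i m)

  F-blocks : ∀ q r → r ≤ m → F f m′ (q * m + r) ≡ q * S f m + S f r
  F-blocks zero r r≤m = F-small r≤m
  F-blocks (suc q) r r≤m = trans (cong (F f m′) (+-assoc m (q * m) r))
    (trans (F-period (q * m + r)) (trans (cong (S f m +_) (F-blocks q r r≤m)) (sym (+-assoc (S f m) _ _))))

  divMod-≡ : ∀ n → (n / m) * m + n % m ≡ n
  divMod-≡ n = trans (+-comm _ (n % m)) (sym (m≡m%n+[m/n]*n n m))

  F-divMod : ∀ n → F f m′ n ≡ (n / m) * S f m + S f (n % m)
  F-divMod n = trans (cong (F f m′) (sym (divMod-≡ n))) (F-blocks (n / m) (n % m) (<⇒≤ (m%n<n n m)))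

  module _ (mf : Mono f) where

    S-super : ∀ a b → S f a + S f b ≤ S f (a + b)
    S-super a b = subst (S f a + S f b ≤_) (sym (S-+ f a b))
      (+-monoʳ-≤ (S f a) (S-mono b (λ i _ → mono-≤ {f} mf (m≤n+m i a))))

    module _ (top : ∀ i → i < m′ → f i < f m′) where

      -- The last d = m - a depths of the second block, from c on, move on top of the first block
      -- and become a, ..., m′. As c < a none of them decreases, and the one that arrives at m′
      -- grows strictly by `top`.
      S-overflow : ∀ a b c → a < m → b < m → a + b ≡ m + c → S f a + S f b < S f m + S f c
      S-overflow a b c a<m b<m e = subst₂ _<_ lhs rhs (go d refl)
        where
        d = m ∸ a
        a+d≡m : a + d ≡ m
        a+d≡m = m+[n∸m]≡n (<⇒≤ a<m)
        b≡c+d : b ≡ c + d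
        b≡c+d = +-cancelˡ-≡ a b (c + d) (trans e (trans (cong (_+ c) (sym a+d≡m)) (trans (+-assoc a d c) (cong (a +_) (+-comm d c)))))
        c<a : c < a
        c<a = +-cancelʳ-< d c a (subst₂ _<_ b≡c+d (sym a+d≡m) b<m)
        lhs : S f a + S f c + S (λ i → f (c + i)) d ≡ S f a + S f b
        lhs = trans (+-assoc (S f a) _ _) (cong (S f a +_) (trans (sym (S-+ f c d)) (cong (S f) (sym b≡c+d))))
        rhs : S f a + S f c + S (λ i → f (a + i)) d ≡ S f m + S f c
        rhs = trans (+-right-swap (S f a) (S f c) _) (cong (_+ S f c) (trans (sym (S-+ f a d)) (cong (S f) a+d≡m)))
        go : ∀ k → k ≡ d → S f a + S f c + S (λ i → f (c + i)) k < S f a + S f c + S (λ i → f (a + i)) k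
        go zero k≡d = ⊥-elim (<-irrefl (trans (sym (+-identityʳ a)) (trans (cong (a +_) k≡d) a+d≡m)) a<m)
        go (suc k) k≡d = +-monoʳ-< (S f a + S f c)
          (+-mono-≤-< (S-mono k (λ i _ → mono-≤ {f} mf (+-monoˡ-≤ i (<⇒≤ c<a))))
            (subst (λ z → f (c + k) < f z) (sym a+k≡m′) (top (c + k) (subst (c + k <_) a+k≡m′ (+-monoˡ-< k c<a)))))
          where
          a+k≡m′ : a + k ≡ m′
          a+k≡m′ = suc-injective (trans (sym (+-suc a k)) (trans (cong (a +_) k≡d) a+d≡m))

      -- Only the two remainders matter. Either they are stacked within one block, or they fill one
      -- more block and leave the remainder c; in the latter case the gain is strict, which is what
      -- controls the number of full blocks when equality holds.
      F-super′ : ∀ a b → F f m′ a + F f m′ b ≤ F f m′ (a + b) × (m ≤ a % m + b % m → F f m′ a + F f m′ b < F f m′ (a + b))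
      F-super′ a b with a % m + b % m <? m
      ... | yes p = subst₂ _≤_ (sym eq) (sym whole) (+-monoʳ-≤ ((a / m + b / m) * S f m) (S-super (a % m) (b % m)))
                  , λ q → ⊥-elim (<⇒≱ p q)
        where
        eq : F f m′ a + F f m′ b ≡ (a / m + b / m) * S f m + (S f (a % m) + S f (b % m))
        eq = trans (cong₂ _+_ (F-divMod a) (F-divMod b)) (lem (a / m) (b / m) (S f m) _ _)
          where lem : ∀ x y z u v → (x * z + u) + (y * z + v) ≡ (x + y) * z + (u + v)
                lem = solve-∀
        whole : F f m′ (a + b) ≡ (a / m + b / m) * S f m + S f (a % m + b % m)
        whole = trans (cong (F f m′) (trans (cong₂ _+_ (sym (divMod-≡ a)) (sym (divMod-≡ b))) (lem (a / m) (b / m) m (a % m) (b % m))))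
          (F-blocks (a / m + b / m) (a % m + b % m) (<⇒≤ p))
          where lem : ∀ x y z u v → (x * z + u) + (y * z + v) ≡ (x + y) * z + (u + v)
                lem = solve-∀
      ... | no p = <⇒≤ strict , λ _ → strict
        where
        c = a % m + b % m ∸ m
        m+c≡ : m + c ≡ a % m + b % m
        m+c≡ = m+[n∸m]≡n (≮⇒≥ p)
        lem : ∀ x y z u v → (x * z + u) + (y * z + v) ≡ (x + y) * z + (u + v)
        lem = solve-∀
        eq : F f m′ a + F f m′ b ≡ (a / m + b / m) * S f m + (S f (a % m) + S f (b % m))
        eq = trans (cong₂ _+_ (F-divMod a) (F-divMod b)) (lem (a / m) (b / m) (S f m) _ _)
        c≤m : c ≤ m
        c≤m = +-cancelˡ-≤ m c m (subst (_≤ m + m) (sym m+c≡) (+-mono-≤ (<⇒≤ (m%n<n a m)) (<⇒≤ (m%n<n b m))))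
        whole : F f m′ (a + b) ≡ (a / m + b / m) * S f m + (S f m + S f c)
        whole = trans (cong (F f m′) (trans (cong₂ _+_ (sym (divMod-≡ a)) (sym (divMod-≡ b)))
            (trans (lem (a / m) (b / m) m (a % m) (b % m)) (trans (cong ((a / m + b / m) * m +_) (sym m+c≡)) (lem₂ (a / m + b / m) m c)))))
          (trans (F-blocks (suc (a / m + b / m)) c c≤m) (lem₃ (a / m + b / m) (S f m) (S f c)))
          where lem₂ : ∀ x z u → x * z + (z + u) ≡ suc x * z + u
                lem₂ = solve-∀
                lem₃ : ∀ x z u → suc x * z + u ≡ x * z + (z + u)
                lem₃ = solve-∀
        strict : F f m′ a + F f m′ b < F f m′ (a + b)
        strict = subst₂ _<_ (sym eq) (sym whole) (+-monoʳ-< ((a / m + b / m) * S f m)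
          (S-overflow (a % m) (b % m) c (m%n<n a m) (m%n<n b m) (sym m+c≡)))

      F-super : ∀ a b → F f m′ a + F f m′ b ≤ F f m′ (a + b)
      F-super a b = proj₁ (F-super′ a b)

      F-super-strict : ∀ a b → m ≤ a % m + b % m → F f m′ a + F f m′ b < F f m′ (a + b)
      F-super-strict a b = proj₂ (F-super′ a b)

      module _ (cf : Convex f) (ctop : ∀ i → suc (suc i) ≡ m′ → f (suc i) + f (suc i) < f i + f (suc (suc i))) where

        -- Lowering f by one from m′ on keeps it monotone and convex, which turns a weak inequality
        -- involving f m′ into a strict one.
        private
          lowered : ∀ i → Dec (i < m′) → ℕ
          lowered i (yes _) = f i
          lowered i (no _)  = f i ∸ 1

          f̃ : ℕ → ℕ
          f̃ i = lowered i (i <? m′)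

          f̃-low : ∀ {i} → i < m′ → f̃ i ≡ f i
          f̃-low {i} p with i <? m′
          ... | yes _ = refl
          ... | no ¬p = ⊥-elim (¬p p)

          f̃-high : ∀ {i} → ¬ i < m′ → f̃ i ≡ f i ∸ 1
          f̃-high {i} ¬p with i <? m′
          ... | yes p = ⊥-elim (¬p p)
          ... | no _  = refl

          f̃≤f : ∀ i → f̃ i ≤ f i
          f̃≤f i with i <? m′
          ... | yes _ = ≤-refl
          ... | no _  = m∸n≤m (f i) 1

        module _ (0<m′ : 0 < m′) where
          private
            f-pos : ∀ {i} → m′ ≤ i → 1 ≤ f i
            f-pos p = ≤-trans (s≤s z≤n) (<-≤-trans (top 0 0<m′) (mono-≤ {f} mf p))

            f̃-mono : Mono f̃
            f̃-mono i with suc i <? m′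
            ... | yes p = subst₂ _≤_ (sym (f̃-low {i} (<-trans (n<1+n i) p))) refl (mf i)
            ... | no ¬p with i <? m′
            ...   | no _  = ∸-monoˡ-≤ 1 (mf i)
            ...   | yes q with ≤-antisym q (≮⇒≥ ¬p)
            ...     | refl = <⇒≤pred′ (top i q)
              where
              <⇒≤pred′ : ∀ {x y} → x < y → x ≤ y ∸ 1
              <⇒≤pred′ (s≤s p) = p

            2pred : ∀ {x y z} → 1 ≤ x → 1 ≤ z → x + x ≤ y + z → (x ∸ 1) + (x ∸ 1) ≤ y + (z ∸ 1)
            2pred {suc x} {y} {suc z} _ _ p = ≤-trans (+-monoʳ-≤ x (n≤1+n x)) (s≤s⁻¹ (subst (suc x + suc x ≤_) (+-suc y z) p))

            2pred₂ : ∀ {x y z} → 1 ≤ x → 1 ≤ y → 1 ≤ z → x + x ≤ y + z → (x ∸ 1) + (x ∸ 1) ≤ (y ∸ 1) + (z ∸ 1)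
            2pred₂ {suc x} {suc y} {suc z} _ _ _ p = s≤s⁻¹ (subst₂ _≤_ (+-suc x x) (+-suc y z) (s≤s⁻¹ p))

            f̃-convex : Convex f̃
            f̃-convex i with suc (suc i) <? m′
            ... | yes p rewrite f̃-low {suc i} (<-trans (n<1+n _) p) | f̃-low {i} (<-trans (n<1+n i) (<-trans (n<1+n _) p)) = cf i
            ... | no ¬p with suc i <? m′
            ...   | yes q rewrite f̃-low {i} (<-trans (n<1+n i) q) =
                subst (f (suc i) + f (suc i) ≤_) (+-∸-assoc (f i) {f (suc (suc i))} {1} (f-pos (≮⇒≥ ¬p)))
                  (<⇒≤∸1 (ctop i (≤-antisym q (≮⇒≥ ¬p))))
              where
              <⇒≤∸1 : ∀ {x y} → x < y → x ≤ y ∸ 1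
              <⇒≤∸1 (s≤s p) = p
            ...   | no ¬q with i <? m′
            ...     | yes r = 2pred (f-pos (≮⇒≥ ¬q)) (f-pos (≮⇒≥ ¬p)) (cf i)
            ...     | no ¬r = 2pred₂ (f-pos (≮⇒≥ ¬q)) (f-pos (≮⇒≥ ¬r)) (f-pos (≮⇒≥ ¬p)) (cf i)

          -- `convex-spread` is applied to the lowered sequence. Since r and a lie below `m′`, the
          -- left side does not change, whereas the last term on the right has index r + suc t₀ = m′
          -- and has dropped by one.
          spread-strict : ∀ r t₀ a → r + suc t₀ ≡ m′ → a ≤ suc t₀ → a ≤ r →
            suc t₀ * f r + a * f a < S (λ j → f (suc (r + j))) (suc t₀) + S f a
          spread-strict r t₀ a e a≤t a≤r = ≤-<-trans
            (subst₂ _≤_ (cong₂ (λ y z → suc t₀ * y + a * z) (f̃-low r<m′) (f̃-low (≤-<-trans a≤r r<m′)))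
              (cong (S (λ j → f̃ (suc (r + j))) (suc t₀) +_) (S-cong a (λ i i<a → f̃-low (<-trans i<a (≤-<-trans a≤r r<m′)))))
              (convex-spread f̃-mono f̃-convex r (suc t₀) a a≤t a≤r))
            (+-monoˡ-< (S f a) (+-mono-≤-< (S-mono t₀ (λ j _ → f̃≤f _))
              (subst (λ z → f̃ z < f z) (sym last≡) (subst (_< f m′) (sym (f̃-high (<-irrefl refl))) (pred< (f-pos ≤-refl))))))
            where
            r<m′ : r < m′
            r<m′ = subst (suc r ≤_) (trans (sym (+-suc r t₀)) e) (s≤s (m≤m+n r t₀))
            last≡ : suc (r + t₀) ≡ m′
            last≡ = trans (sym (+-suc r t₀)) e
            pred< : ∀ {x} → 1 ≤ x → x ∸ 1 < x
            pred< {suc x} _ = ≤-refl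

        -- The index a is at or below the middle of 0, ..., m - 1. The first 2a + 1 terms are paired
        -- around a, and the others are at least f(a) by monotonicity.
        m*f≤S : ∀ a → a + a < m → m * f a ≤ S f m
        m*f≤S a 2a<m = subst (λ z → z * f a ≤ S f z) (m+[n∸m]≡n 2a<m) (begin
          (suc (a + a) + e) * f a ≡⟨ l₁ a e (f a) ⟩
          ((a * (f a + f a) + 0) + f a) + e * f a
            ≤⟨ +-mono-≤ (+-monoˡ-≤ (f a) (convex-centre {f} cf a a 0 refl)) rest ⟩
          ((S (λ i → f (suc (a + i))) a + S f a) + f a) + S (λ i → f (suc (a + a) + i)) e
            ≡⟨ cong (_+ S (λ i → f (suc (a + a) + i)) e) (sym half) ⟩
          S f (suc (a + a)) + S (λ i → f (suc (a + a) + i)) e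
            ≡⟨ sym (S-+ f (suc (a + a)) e) ⟩
          S f (suc (a + a) + e) ∎)
          where
          open ≤-Reasoning
          e = m ∸ suc (a + a)
          l₁ : ∀ a e y → (suc (a + a) + e) * y ≡ ((a * (y + y) + 0) + y) + e * y
          l₁ = solve-∀
          l₂ : ∀ x y z → x + y + z ≡ z + x + y
          l₂ = solve-∀
          rest : e * f a ≤ S (λ i → f (suc (a + a) + i)) e
          rest = subst (_≤ S (λ i → f (suc (a + a) + i)) e) (S-const (f a) e)
            (S-mono e (λ i _ → mono-≤ {f} mf (≤-trans (m≤m+n a a) (≤-trans (n≤1+n _) (m≤m+n _ i)))))
          half : S f (suc (a + a)) ≡ (S (λ i → f (suc (a + i))) a + S f a) + f a
          half = trans (S-+ f (suc a) a) (l₂ (S f a) (f a) _)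

        -- Full blocks average at least f(a), so only the remainder can fall short of f(a) per
        -- vertex. Its shortfall is greatest when it consists of the depths 0, ..., a - 1, and then
        -- equals a f(a) - S f a.
        F-≥-linear : ∀ a → a + a < m → ∀ q → S f a + q * f a ≤ F f m′ q + a * f a
        F-≥-linear a 2a<m q = begin
          S f a + q * f a                                      ≡⟨ cong (λ z → S f a + z * f a) (sym (divMod-≡ q)) ⟩
          S f a + ((q / m) * m + q % m) * f a                  ≡⟨ l₁ (S f a) (q / m) m (q % m) (f a) ⟩
          (q / m) * (m * f a) + (S f a + (q % m) * f a)        ≤⟨ +-mono-≤ (*-monoʳ-≤ (q / m) (m*f≤S a 2a<m)) (small (q % m)) ⟩
          (q / m) * S f m + (S f (q % m) + a * f a)            ≡⟨ sym (+-assoc ((q / m) * S f m) _ _) ⟩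
          ((q / m) * S f m + S f (q % m)) + a * f a            ≡⟨ cong (_+ a * f a) (sym (F-divMod q)) ⟩
          F f m′ q + a * f a ∎
          where
          open ≤-Reasoning
          l₁ : ∀ x y z u v → x + (y * z + u) * v ≡ y * (z * v) + (x + u * v)
          l₁ = solve-∀
          small : ∀ r → S f a + r * f a ≤ S f r + a * f a
          small r with ≤-total r a
          ... | inj₁ r≤a = subst₂ (λ y z → y + r * f a ≤ S f r + z * f a)
                 (trans (sym (S-+ f r (a ∸ r))) (cong (S f) (m+[n∸m]≡n r≤a))) (m+[n∸m]≡n r≤a)
                 (subst₂ _≤_ (sym (+-assoc (S f r) _ _)) (cong (S f r +_) (l₃ r (a ∸ r) (f a)))
                   (+-monoʳ-≤ (S f r) (+-monoˡ-≤ (r * f a)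
                     (≤-trans (S-mono {h = λ _ → f a} (a ∸ r) (λ i i<e → mono-≤ {f} mf (<⇒≤ (subst (r + i <_) (m+[n∸m]≡n r≤a) (+-monoʳ-< r i<e)))))
                       (≤-reflexive (S-const (f a) (a ∸ r)))))))
            where l₃ : ∀ r e y → e * y + r * y ≡ (r + e) * y
                  l₃ = solve-∀
          ... | inj₂ a≤r = subst₂ (λ y z → S f a + z * f a ≤ y + a * f a)
                 (trans (sym (S-+ f a (r ∸ a))) (cong (S f) (m+[n∸m]≡n a≤r))) (m+[n∸m]≡n a≤r)
                 (subst₂ _≤_ (cong (S f a +_) (l₃ a (r ∸ a) (f a))) (sym (+-assoc (S f a) _ _))
                   (+-monoʳ-≤ (S f a) (+-monoˡ-≤ (a * f a)
                     (≤-trans (≤-reflexive (sym (S-const (f a) (r ∸ a))))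
                       (S-mono {λ _ → f a} (r ∸ a) (λ i _ → mono-≤ {f} mf (m≤m+n a i)))))))
            where l₃ : ∀ r e y → e * y + r * y ≡ (r + e) * y
                  l₃ = solve-∀

        -- A component of order m + q whose longest root chain has suc r vertices, with at most t = m − suc r
        -- vertices off the chain deeper than t.
        component-bound : ∀ r t₀ q → r + suc t₀ ≡ m′ →
          S f (suc r) + suc t₀ * f r + q * f (suc t₀ ⊓ r) < F f m′ (m + q)
        component-bound r t₀ q e = subst (S f (suc r) + suc t₀ * f r + q * f a <_) (sym (F-period q))
          -- The difference a f(a) - S f a is gained in `spread-strict` and lost in `F-≥-linear`, so
          -- adding the two inequalities cancels it.
          (+-cancelʳ-< (S f a + a * f a) _ _ (subst₂ _<_
            (l₁ (S f (suc r)) (suc t₀ * f r) (q * f a) (S f a) (a * f a))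
            (trans (l₂ (S f (suc r)) _ (S f a) (F f m′ q) (a * f a)) (cong (λ z → (z + F f m′ q) + (S f a + a * f a)) whole))
            (+-monoʳ-< (S f (suc r)) (+-mono-<-≤ (spread-strict 0<m′ r t₀ a e (m⊓n≤m (suc t₀) r) (m⊓n≤n (suc t₀) r)) (F-≥-linear a 2a<m q)))))
          where
          a = suc t₀ ⊓ r
          0<m′ : 0 < m′
          0<m′ = subst (0 <_) (trans (sym (+-suc r t₀)) e) (s≤s z≤n)
          2a<m : a + a < m
          2a<m = s≤s (subst (a + a ≤_) (trans (+-comm (suc t₀) r) e) (+-mono-≤ (m⊓n≤m (suc t₀) r) (m⊓n≤n (suc t₀) r)))
          whole : S f (suc r) + S (λ j → f (suc (r + j))) (suc t₀) ≡ S f m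
          whole = trans (sym (S-+ f (suc r) (suc t₀))) (cong (S f ∘ suc) e)
          l₁ : ∀ x y z u v → x + ((y + v) + (u + z)) ≡ (x + y + z) + (u + v)
          l₁ = solve-∀
          l₂ : ∀ x y u p v → x + ((y + u) + (p + v)) ≡ (x + y + p) + (u + v)
          l₂ = solve-∀

-- Monotonicity and convexity of the clique weights

C-pos : ∀ {k n} → k ≤ n → 1 ≤ n C k
C-pos {zero} {n} p = ≤-reflexive (sym (C-zero n))
C-pos {suc k} {suc n} (s≤s p) = subst (1 ≤_) (sym (C-pascal n k)) (≤-trans (C-pos p) (m≤n+m _ _))

-- The number of s-cliques whose last vertex has depth i below the two dominating vertices, for s = 3 + σ.
cliqueWeight : ℕ → ℕ → ℕ
cliqueWeight σ i = suc (suc i) C suc (suc σ)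

module _ (σ : ℕ) where
  private
    w = cliqueWeight σ

    w-suc : ∀ i → w (suc i) ≡ w i + suc (suc i) C suc σ
    w-suc i = C-pascal (suc (suc i)) (suc σ)

    -- Pascal's rule twice: the second difference is itself a binomial coefficient, hence
    -- nonnegative, and positive once σ ≤ i + 2.
    w-suc² : ∀ i → w i + w (suc (suc i)) ≡ w (suc i) + w (suc i) + suc (suc i) C σ
    w-suc² i = begin
      w i + w (suc (suc i))                                                  ≡⟨ cong (w i +_) (w-suc (suc i)) ⟩
      w i + (w (suc i) + suc (suc (suc i)) C suc σ)                          ≡⟨ cong (λ z → w i + (w (suc i) + z)) (C-pascal (suc (suc i)) σ) ⟩
      w i + (w (suc i) + (suc (suc i) C suc σ + suc (suc i) C σ))            ≡⟨ l (w i) (w (suc i)) (suc (suc i) C suc σ) (suc (suc i) C σ) ⟩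
      (w i + suc (suc i) C suc σ) + w (suc i) + suc (suc i) C σ              ≡⟨ cong (λ z → z + w (suc i) + suc (suc i) C σ) (sym (w-suc i)) ⟩
      w (suc i) + w (suc i) + suc (suc i) C σ ∎
      where
      open ≡-Reasoning
      l : ∀ x y z u → x + (y + (z + u)) ≡ (x + z) + y + u
      l = solve-∀

  weight-mono : Mono w
  weight-mono i = subst (w i ≤_) (sym (w-suc i)) (m≤m+n _ _)

  weight-convex : Convex w
  weight-convex i = subst (w (suc i) + w (suc i) ≤_) (sym (w-suc² i)) (m≤m+n _ _)

  -- The last increment is C(m′ + 1, σ + 1), positive because of σ ≤ m′, which is s ≤ k. Lower down,
  -- consecutive weights may both be zero.
  weight-top : ∀ {m′} → σ ≤ m′ → ∀ i → i < m′ → w i < w m′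
  weight-top {suc m′} p i (s≤s q) = ≤-<-trans (mono-≤ {w} weight-mono q)
    (subst (w m′ <_) (sym (w-suc m′)) (m<m+n (w m′) (C-pos (s≤s p))))

  weight-convex-top : ∀ {m′} → σ ≤ m′ → ∀ i → suc (suc i) ≡ m′ → w (suc i) + w (suc i) < w i + w (suc (suc i))
  weight-convex-top p i refl = subst (w (suc i) + w (suc i) <_) (sym (w-suc² i)) (m<m+n _ (C-pos p))

-- Paths between the terminals

mem? : ∀ {n} (y : Fin n) l → Dec (y ∈ l)
mem? y l = Any.any? (y ≟_) l

Unique-resp-↭ : {xs ys : List A} → xs ↭ ys → Unique xs → Unique ys
Unique-resp-↭ Perm.refl u = u
Unique-resp-↭ (Perm.prep x τ) (px ∷ u) = ↭P.All-resp-↭ τ px ∷ Unique-resp-↭ τ u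
Unique-resp-↭ (Perm.swap x y τ) ((x≢y ∷ px) ∷ py ∷ u) =
  ((x≢y ∘ sym) ∷ ↭P.All-resp-↭ τ py) ∷ ↭P.All-resp-↭ τ px ∷ Unique-resp-↭ τ u
Unique-resp-↭ (Perm.trans τ τ′) u = Unique-resp-↭ τ′ (Unique-resp-↭ τ u)

∉⇒All≢ : ∀ {x : A} {l} → x ∉ l → All (x ≢_) l
∉⇒All≢ x∉l = All.tabulate (λ { m refl → x∉l m })

All≢⇒∉ : ∀ {x : A} {l} → All (x ≢_) l → x ∉ l
All≢⇒∉ px m = All.lookup px m refl

Unique-++⁻ : ∀ (xs : List A) {ys} → Unique (xs ++ ys) → Unique xs × Unique ys
Unique-++⁻ [] u = [] , u
Unique-++⁻ (x ∷ xs) (px ∷ u) with Unique-++⁻ xs u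
... | u₁ , u₂ = AllP.++⁻ˡ xs px ∷ u₁ , u₂

middle : ∀ (α : List A) {x γ} → α ++ x ∷ γ ↭ x ∷ α ++ γ
middle α {x} {γ} = ↭P.shift x α γ

exchange-middle : ∀ (α q : List A) {γ x y} → α ++ y ∷ (q ++ x ∷ γ) ↭ α ++ x ∷ (q ++ y ∷ γ)
exchange-middle α q {γ} {x} {y} = ↭P.++⁺ˡ α
  (↭-trans (↭-prep y (middle q)) (↭-trans (↭-swap y x ↭-refl) (↭-prep x (↭-sym (middle q)))))

module _ {n} (G : Graph n) where

  infixr 5 _∷_
  -- A walk from x to y whose successive interior vertices form the list.
  data Chain : Fin n → List (Fin n) → Fin n → Set where
    edge : ∀ {x y} → Adj (adj G) x y → Chain x [] y
    _∷_  : ∀ {x z p y} → Adj (adj G) x z → Chain z p y → Chain x (z ∷ p) y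

  -- Cycles through uv are treated as paths between u and v. The edge uv itself counts as a path
  -- with empty interior, so for adjacent u and v the condition includes 2 ≤ k.
  Bounded : Fin n → Fin n → ℕ → Set
  Bounded u v k = ∀ p → Chain u p v → Unique (u ∷ v ∷ p) → 2 + length p ≤ k

  data To (P : Fin n → Set) (v : Fin n) : Fin n → Set where
    stop : To P v v
    go   : ∀ {a b} → P a → Adj (adj G) a b → To P v b → To P v a

  -- Reaching either terminal is enough: u and v are adjacent, so this says that deleting x does not
  -- cut a off, and it keeps its meaning when x is itself a terminal.
  data Esc (u v x : Fin n) : Fin n → Set where
    stop : ∀ {t} → t ≢ x → t ≡ u ⊎ t ≡ v → Esc u v x t
    go   : ∀ {a b} → a ≢ x → Adj (adj G) a b → Esc u v x b → Esc u v x a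

  -- With u and v adjacent this is 2-connectedness.
  Linkage : Fin n → Fin n → Set
  Linkage u v = ∀ x a → a ≢ x → Esc u v x a

module _ {n} {G : Graph n} where

  Adj-sym : ∀ {i j} → Adj (adj G) i j → Adj (adj G) j i
  Adj-sym {i} {j} e = trans (adj-sym G j i) e

  Adj-≢ : ∀ {i j} → Adj (adj G) i j → i ≢ j
  Adj-≢ {i} e refl = true≢false (trans (sym e) (irref G i))

  chain-++ : ∀ {x p y q z} → Chain G x p y → Chain G y q z → Chain G x (p ++ y ∷ q) z
  chain-++ (edge e) d = e ∷ d
  chain-++ (e ∷ c)  d = e ∷ chain-++ c d

  chain-split : ∀ {x} p {y q z} → Chain G x (p ++ y ∷ q) z → Chain G x p y × Chain G y q z
  chain-split []      (e ∷ c) = edge e , c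
  chain-split (x ∷ p) (e ∷ c) with chain-split p c
  ... | c₁ , c₂ = e ∷ c₁ , c₂

  chain-reverse : ∀ {x p y} → Chain G x p y → Chain G y (reverse p) x
  chain-reverse (edge e) = edge (Adj-sym e)
  chain-reverse {p = z ∷ p} (e ∷ c) = subst (λ l → Chain G _ l _) (sym (unfold-reverse z p))
    (chain-++ (chain-reverse c) (edge (Adj-sym e)))

  chain-reverse⁻ : ∀ {x p y} → Chain G y (reverse p) x → Chain G x p y
  chain-reverse⁻ {p = p} c = subst (λ l → Chain G _ l _) (reverse-involutive p) (chain-reverse c)

  Bounded-sym : ∀ {u v k} → Bounded G u v k → Bounded G v u k
  Bounded-sym {u} {v} {k} bd p c uq = subst (λ l → 2 + l ≤ k) (length-reverse p)
    (bd (reverse p) (chain-reverse c) (Unique-resp-↭ (↭-trans (↭-swap v u (↭-sym (↭P.↭-reverse p))) ↭-refl) uq))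

  Esc-sym : ∀ {u v x a} → Esc G u v x a → Esc G v u x a
  Esc-sym (stop t≢x t) = stop t≢x (Sum.swap t)
  Esc-sym (go a≢x e r) = go a≢x e (Esc-sym r)

  Esc-≢ : ∀ {u v x a} → Esc G u v x a → a ≢ x
  Esc-≢ (stop p _)  = p
  Esc-≢ (go p _ _) = p

  Linkage-sym : ∀ {u v} → Linkage G u v → Linkage G v u
  Linkage-sym lk x a a≢x = Esc-sym (lk x a a≢x)

  To-simple : ∀ {P : Fin n → Set} {v y} → To G P v y → y ≢ v →
    ∃ λ p → Chain G y p v × Unique (y ∷ v ∷ p) × All P (y ∷ p)
  To-simple stop y≢v = ⊥-elim (y≢v refl)
  To-simple {P} {v} (go {a} {b} pa e r) a≢v with b ≟ v
  ... | yes refl = [] , edge e , (a≢v ∷ []) ∷ [] ∷ [] , pa ∷ []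
  ... | no b≢v with To-simple r b≢v
  ...   | p , c , (b≢v′ ∷ b∉) ∷ v∉ ∷ up , pb ∷ pp with a ≟ b
  ...     | yes refl = p , c , (b≢v′ ∷ b∉) ∷ v∉ ∷ up , pb ∷ pp
  ...     | no a≢b with mem? a p
  ...       | no a∉p = b ∷ p , e ∷ c
                     , (a≢v ∷ a≢b ∷ ∉⇒All≢ a∉p) ∷ ((b≢v ∘ sym) ∷ v∉) ∷ b∉ ∷ up , pa ∷ pb ∷ pp
  ...       | yes a∈p with ∈-∃++ a∈p
  ...         | α , γ , refl with Unique-++⁻ α up
  ...           | _ , a∉γ ∷ uγ = γ , proj₂ (chain-split α c)
                               , (a≢v ∷ a∉γ) ∷ All.tail (AllP.++⁻ʳ α v∉) ∷ uγ , AllP.++⁻ʳ α pp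

chain-map : ∀ {n} {G H : Graph n} {x p y} → Chain H x p y →
  (∀ {a b} → a ∈ x ∷ y ∷ p → b ∈ x ∷ y ∷ p → Adj (adj H) a b → Adj (adj G) a b) → Chain G x p y
chain-map (edge e) h = edge (h (here refl) (there (here refl)) e)
chain-map (e ∷ c)  h = h (here refl) (there (there (here refl))) e ∷ chain-map c (λ m m′ → h (widen m) (widen m′))
  where
  widen : ∀ {a x z y : Fin _} {p} → a ∈ z ∷ y ∷ p → a ∈ x ∷ y ∷ z ∷ p
  widen (here e)         = there (there (here e))
  widen (there (here e)) = there (here e)
  widen (there (there m)) = there (there (there m))

clique-chain : ∀ {n} {G : Graph n} {x y} l → Adj (adj G) x y →
  (∀ {a} → a ∈ l → Adj (adj G) x a) → (∀ {a} → a ∈ l → Adj (adj G) a y) →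
  (∀ {a b} → a ∈ l → b ∈ l → a ≢ b → Adj (adj G) a b) → Unique l → Chain G x l y
clique-chain [] xy xl ly ll u = edge xy
clique-chain (a ∷ l) xy xl ly ll (a∉l ∷ u) = xl (here refl) ∷
  clique-chain l (ly (here refl)) (λ m → ll (here refl) (there m) (All.lookup a∉l m)) (ly ∘ there)
    (λ m m′ → ll (there m) (there m′)) u

chain-linked : ∀ {n} {G : Graph n} {x y l} → Chain G x l y → Linked (Adj (adj G)) (x ∷ (l ++ y ∷ []))
chain-linked (edge e) = e ∷ [-]
chain-linked (e ∷ c)  = e ∷ chain-linked c

-- A cycle is listed as u, v, ws and then returns to u, so the corresponding path from u to v runs
-- through ws backwards.
Bounded⁺ : ∀ {n} {G : Graph n} {u v k} → 2 ≤ k → Adj (adj G) u v → CircLe (adj G) u v k → Bounded G u v k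
Bounded⁺ 2≤k uv le [] c uq = 2≤k
Bounded⁺ {G = G} {u} {v} {k} 2≤k uv le p@(_ ∷ _) c uq = subst (λ l → 2 + l ≤ k) (length-reverse p)
  (le (reverse p)
    ( Unique-resp-↭ (↭-prep u (↭-prep v (↭-sym (↭P.↭-reverse p)))) uq
    , uv ∷ chain-linked (chain-reverse c)
    , subst (1 ≤_) (sym (length-reverse p)) (s≤s z≤n)))

Linkage⁺ : ∀ {n} {G : Graph n} {u v} → u ≢ v → TwoConnected G → Linkage G u v
Linkage⁺ {n} {G} {u} {v} u≢v (_ , _ , conn) x a a≢x with u ≟ x
... | no u≢x = walk (conn x a u a≢x u≢x)
  where
  walk : ∀ {a} → WalkIn G (λ y → y ≢ x) a u → Esc G u v x a
  walk (WalkIn.here p) = stop p (inj₁ refl)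
  walk (WalkIn.step p e w) = go p e (walk w)
... | yes refl = walk (conn x a v a≢x (u≢v ∘ sym))
  where
  walk : ∀ {a} → WalkIn G (λ y → y ≢ x) a v → Esc G u v x a
  walk (WalkIn.here p) = stop p (inj₂ refl)
  walk (WalkIn.step p e w) = go p e (walk w)

count-< : ∀ (p q : A → Bool) l {x} → (∀ y → p y ≡ true → q y ≡ true) → x ∈ l → p x ≡ false → q x ≡ true →
  count p l < count q l
count-≤ : ∀ (p q : A → Bool) l → (∀ y → p y ≡ true → q y ≡ true) → count p l ≤ count q l
count-≤ p q [] h = z≤n
count-≤ p q (y ∷ l) h with p y | q y | h y
... | true  | true  | _ = s≤s (count-≤ p q l h)
... | true  | false | e = ⊥-elim (true≢false (sym (e refl)))
... | false | true  | _ = m≤n⇒m≤1+n (count-≤ p q l h)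
... | false | false | _ = count-≤ p q l h
count-< p q (x ∷ l) h (here refl) px qx rewrite px | qx = s≤s (count-≤ p q l h)
count-< p q (y ∷ l) h (there m) px qx with p y | q y | h y
... | true  | true  | _ = s≤s (count-< p q l h m px qx)
... | true  | false | e = ⊥-elim (true≢false (sym (e refl)))
... | false | true  | _ = m≤n⇒m≤1+n (count-< p q l h m px qx)
... | false | false | _ = count-< p q l h m px qx

not-true : ∀ {b} → not b ≡ true → b ≡ false
not-true {false} _ = refl

≢true : ∀ {b} → ¬ b ≡ true → b ≡ false
≢true {true}  h = ⊥-elim (h refl)
≢true {false} h = refl

Bool-dec : ∀ b → b ≡ true ⊎ b ≡ false
Bool-dec true  = inj₁ refl
Bool-dec false = inj₂ refl

-- Reachability inside a set of vertices

record Closure {n} (G : Graph n) (P : Fin n → Set) (v : Fin n) : Set where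
  field
    R      : Fin n → Bool
    source : R v ≡ true
    reach  : ∀ y → R y ≡ true → To G P v y
    closed : ∀ {y z} → R y ≡ true → Adj (adj G) z y → P z → R z ≡ true

-- Saturation from {v}: a vertex satisfying P with a neighbour in R is added while there is one. The
-- number of vertices outside R bounds the number of rounds.
closure : ∀ {n} (G : Graph n) {P : Fin n → Set} → (∀ z → Dec (P z)) → ∀ v → Closure G P v
closure {n} G {P} P? v = grow (suc (count (not ∘ start) (allFin n))) start (⌊⌋-intro (v ≟ v) refl)
    (λ y e → subst (To G P v) (sym (⌊⌋-true (y ≟ v) e)) stop) ≤-refl
  where
  open Closure
  start : Fin n → Bool
  start y = ⌊ y ≟ v ⌋
  grow : ∀ fuel (R : Fin n → Bool) → R v ≡ true → (∀ y → R y ≡ true → To G P v y) →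
    count (not ∘ R) (allFin n) < fuel → Closure G P v
  grow zero R s r ()
  grow (suc fuel) R s r (s≤s lt)
    with any? (λ z → any? (λ y → (R y Bool.≟ true) ×-dec (adj G z y Bool.≟ true) ×-dec P? z ×-dec (R z Bool.≟ false)))
  ... | no none = record { R = R ; source = s ; reach = r ; closed = cl }
    where
    cl : ∀ {y z} → R y ≡ true → Adj (adj G) z y → P z → R z ≡ true
    cl {y} {z} ry zy pz with R z in eq
    ... | true  = refl
    ... | false = ⊥-elim (none (z , y , ry , zy , pz , eq))
  ... | yes (z , y , ry , zy , pz , rz) = grow fuel R′ (∨-trueˡ _ s) r′
      (<-≤-trans (count-< (not ∘ R′) (not ∘ R) (allFin n) shrink (∈-allFin z) gone (cong not rz)) lt)
    where
    R′ : Fin n → Bool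
    R′ x = R x ∨ ⌊ x ≟ z ⌋
    r′ : ∀ x → R′ x ≡ true → To G P v x
    r′ x e with ∨-true (R x) _ e
    ... | inj₁ rx = r x rx
    ... | inj₂ x≡z = subst (To G P v) (sym (⌊⌋-true (x ≟ z) x≡z)) (go pz zy (r y ry))
    shrink : ∀ x → not (R′ x) ≡ true → not (R x) ≡ true
    shrink x e with R x
    ... | true  = e
    ... | false = refl
    gone : not (R′ z) ≡ false
    gone = cong not (∨-trueʳ (R z) (⌊⌋-intro (z ≟ z) refl))

-- The Kelmans operation

record IsShift {n} (G H : Graph n) (x w : Fin n) : Set where
  field
    x~w : Adj (adj G) x w
    far : ∀ {a b} → a ≢ x → a ≢ w → b ≢ x → b ≢ w → adj H a b ≡ adj G a b
    at-x : ∀ {a} → a ≢ x → a ≢ w → adj H x a ≡ adj G x a ∨ adj G w a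
    at-w : ∀ {a} → a ≢ x → a ≢ w → adj H w a ≡ adj G x a ∧ adj G w a
    keep : Adj (adj H) x w

module Kelmans {n} (G : Graph n) (x w : Fin n) (x~w : Adj (adj G) x w) where
  private
    data Place (i : Fin n) : Set where
      atx : i ≡ x → Place i
      atw : i ≡ w → Place i
      off : i ≢ x → i ≢ w → Place i

    place : ∀ i → Place i
    place i with i ≟ x | i ≟ w
    ... | yes p | _     = atx p
    ... | no  _ | yes q = atw q
    ... | no  p | no  q = off p q

    x≢w : x ≢ w
    x≢w = Adj-≢ {G = G} x~w

    entry : ∀ {i j} → Place i → Place j → Bool
    entry (atx _) (atx _) = false
    entry (atx _) (atw _) = true
    entry {i} {j} (atx _) (off _ _) = adj G x j ∨ adj G w j
    entry (atw _) (atx _) = true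
    entry (atw _) (atw _) = false
    entry {i} {j} (atw _) (off _ _) = adj G x j ∧ adj G w j
    entry {i} {j} (off _ _) (atx _) = adj G x i ∨ adj G w i
    entry {i} {j} (off _ _) (atw _) = adj G x i ∧ adj G w i
    entry {i} {j} (off _ _) (off _ _) = adj G i j

    entry-sym : ∀ {i j} (p : Place i) (q : Place j) → entry p q ≡ entry q p
    entry-sym (atx _) (atx _) = refl
    entry-sym (atx _) (atw _) = refl
    entry-sym (atx _) (off _ _) = refl
    entry-sym (atw _) (atx _) = refl
    entry-sym (atw _) (atw _) = refl
    entry-sym (atw _) (off _ _) = refl
    entry-sym (off _ _) (atx _) = refl
    entry-sym (off _ _) (atw _) = refl
    entry-sym {i} {j} (off _ _) (off _ _) = adj-sym G i j

    entry-irref : ∀ {i} (p : Place i) → entry p p ≡ false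
    entry-irref (atx _) = refl
    entry-irref (atw _) = refl
    entry-irref {i} (off _ _) = irref G i

  shifted : Graph n
  shifted = record
    { adj   = λ i j → entry (place i) (place j)
    ; sym   = λ i j → entry-sym (place i) (place j)
    ; irref = λ i → entry-irref (place i) }

  isShift : IsShift G shifted x w
  isShift = record { x~w = x~w ; far = far ; at-x = at-x ; at-w = at-w ; keep = keep }
    where
    far : ∀ {a b} → a ≢ x → a ≢ w → b ≢ x → b ≢ w → adj shifted a b ≡ adj G a b
    far {a} {b} ax aw bx bw with place a | place b
    ... | atx p   | _       = ⊥-elim (ax p)
    ... | atw p   | _       = ⊥-elim (aw p)
    ... | off _ _ | atx p   = ⊥-elim (bx p)
    ... | off _ _ | atw p   = ⊥-elim (bw p)
    ... | off _ _ | off _ _ = refl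
    at-x : ∀ {a} → a ≢ x → a ≢ w → adj shifted x a ≡ adj G x a ∨ adj G w a
    at-x {a} ax aw with place x | place a
    ... | _       | atx p   = ⊥-elim (ax p)
    ... | _       | atw p   = ⊥-elim (aw p)
    ... | atw p   | off _ _ = ⊥-elim (x≢w p)
    ... | off p _ | off _ _ = ⊥-elim (p refl)
    ... | atx _   | off _ _ = refl
    at-w : ∀ {a} → a ≢ x → a ≢ w → adj shifted w a ≡ adj G x a ∧ adj G w a
    at-w {a} ax aw with place w | place a
    ... | _       | atx p   = ⊥-elim (ax p)
    ... | _       | atw p   = ⊥-elim (aw p)
    ... | atx p   | off _ _ = ⊥-elim (x≢w (sym p))
    ... | off _ p | off _ _ = ⊥-elim (p refl)
    ... | atw _   | off _ _ = refl
    keep : Adj (adj shifted) x w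
    keep with place x | place w
    ... | atx _   | atw _   = refl
    ... | atw p   | _       = ⊥-elim (x≢w p)
    ... | off p _ | _       = ⊥-elim (p refl)
    ... | atx _   | atx p   = ⊥-elim (x≢w (sym p))
    ... | atx _   | off _ p = ⊥-elim (p refl)

enumerate₂ : ∀ {n} {x w : Fin n} → x ≢ w → ∃ λ l → allFin n ↭ x ∷ w ∷ l × x ∉ l × w ∉ l
enumerate₂ {n} {x} {w} x≢w with ∈-∃++ (∈-allFin x)
... | α , γ , eq with w∈ | UniqueP.allFin⁺ n
  where
  τ : allFin n ↭ x ∷ α ++ γ
  τ = ↭-trans (Perm.↭-reflexive eq) (middle α)
  w∈ : w ∈ α ++ γ
  w∈ with ↭P.∈-resp-↭ τ (∈-allFin w)
  ... | here w≡x = ⊥-elim (x≢w (sym w≡x))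
  ... | there m  = m
... | w∈ | un with ∈-∃++ w∈
...   | α′ , γ′ , eq′ = α′ ++ γ′ , τ , (λ m → All≢⇒∉ (AllPairs.head un′) (there m)) , All≢⇒∉ (AllPairs.head (AllPairs.tail un′))
  where
  τ : allFin n ↭ x ∷ w ∷ α′ ++ γ′
  τ = ↭-trans (↭-trans (Perm.↭-reflexive eq) (middle α)) (↭-prep x (↭-trans (Perm.↭-reflexive eq′) (middle α′)))
  un′ : Unique (x ∷ w ∷ α′ ++ γ′)
  un′ = Unique-resp-↭ τ un

-- The four summands are the cliques with neither of x and w, with both, with x alone and with w
-- alone.
K-first-two : ∀ (a : A → A → Bool) s x w l → a x w ≡ true →
  K a (suc (suc s)) (x ∷ w ∷ l) ≡
    (K a (suc (suc s)) l + K a s (filterᵇ (λ y → a x y ∧ a w y) l)) +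
    (K a (suc s) (filterᵇ (a x) l) + K a (suc s) (filterᵇ (a w) l))
K-first-two a s x w l xw rewrite xw =
  trans (lem (K a (suc (suc s)) l) (K a (suc s) (filterᵇ (a w) l)) (K a (suc s) (filterᵇ (a x) l)) (K a s (filterᵇ (a w) (filterᵇ (a x) l))))
    (cong (λ z → (K a (suc (suc s)) l + K a s z) + (K a (suc s) (filterᵇ (a x) l) + K a (suc s) (filterᵇ (a w) l)))
      (filterᵇ-∘ (a w) (a x) l))
  where lem : ∀ p q r t → (p + q) + (r + t) ≡ (p + t) + (r + q)
        lem = solve-∀

N-≤ : ∀ {n} {G H : Graph n} s {l} → allFin n ↭ l → K (adj G) s l ≤ K (adj H) s l → N s G ≤ N s H
N-≤ {G = G} {H} s τ le = subst₂ _≤_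
  (sym (trans (N≡K s G) (K-↭ (adj G) (adj-sym G) s τ))) (sym (trans (N≡K s H) (K-↭ (adj H) (adj-sym H) s τ))) le

N-mono : ∀ {n} {G H : Graph n} s → G ⊆G H → N s G ≤ N s H
N-mono {n} {G} {H} s h = N-≤ {G = G} {H} s ↭-refl (K-mono s ⊆-refl (λ {i} {j} _ _ → h i j))

module _ {n} {G H : Graph n} {x w : Fin n} (sh : IsShift G H x w) where
  open IsShift sh

  shift-N : ∀ s → N (suc (suc s)) G ≤ N (suc (suc s)) H
  shift-N s with enumerate₂ (Adj-≢ {G = G} x~w)
  ... | l , τ , x∉l , w∉l = N-≤ {G = G} {H} (suc (suc s)) τ (subst₂ _≤_
    (sym (K-first-two aG s x w l x~w)) (sym (K-first-two aH s x w l keep))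
    (+-mono-≤ (+-mono-≤ (same (suc (suc s)) (⊆-refl {x = l}) {λ m → m}) common)
      (≤-trans (K-supermodular aG (suc s) l (aG x) (aG w)) (+-mono-≤ union inter))))
    where
    aG = adj G
    aH = adj H
    off : ∀ {y} → y ∈ l → y ≢ x × y ≢ w
    off m = (λ { refl → x∉l m }) , (λ { refl → w∉l m })
    same : ∀ s {xs ys} → xs ⊆ ys → {xs⊆l : ∀ {y} → y ∈ xs → y ∈ l} → K aG s xs ≤ K aH s ys
    same s τ {xs⊆l} = K-mono s τ (λ m m′ e → trans (far (proj₁ (off (xs⊆l m))) (proj₂ (off (xs⊆l m))) (proj₁ (off (xs⊆l m′))) (proj₂ (off (xs⊆l m′)))) e)
    union : K aG (suc s) (filterᵇ (λ y → aG x y ∨ aG w y) l) ≤ K aH (suc s) (filterᵇ (aH x) l)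
    union = same (suc s) (filterᵇ-⊆ {p = λ y → aG x y ∨ aG w y} {q = aH x} (⊆-refl {x = l})
        (λ m e → trans (at-x (proj₁ (off m)) (proj₂ (off m))) e))
      {λ m → proj₁ (∈-filterᵇ⁻ _ l m)}
    inter : K aG (suc s) (filterᵇ (λ y → aG x y ∧ aG w y) l) ≤ K aH (suc s) (filterᵇ (aH w) l)
    inter = same (suc s) (filterᵇ-⊆ {p = λ y → aG x y ∧ aG w y} {q = aH w} (⊆-refl {x = l})
        (λ m e → trans (at-w (proj₁ (off m)) (proj₂ (off m))) e))
      {λ m → proj₁ (∈-filterᵇ⁻ _ l m)}
    common : K aG s (filterᵇ (λ y → aG x y ∧ aG w y) l) ≤ K aH s (filterᵇ (λ y → aH x y ∧ aH w y) l)
    common = same s (filterᵇ-⊆ {p = λ y → aG x y ∧ aG w y} {q = λ y → aH x y ∧ aH w y} (⊆-refl {x = l})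
        (λ {y} m e → ∧-intro (trans (at-x (proj₁ (off m)) (proj₂ (off m))) (∨-trueˡ _ (proj₁ (∧-true (aG x y) _ e))))
                             (trans (at-w (proj₁ (off m)) (proj₂ (off m))) e)))
      {λ m → proj₁ (∈-filterᵇ⁻ _ l m)}

  private
    from-x : ∀ {a} → a ≢ x → a ≢ w → Adj (adj H) x a → Adj (adj G) x a ⊎ Adj (adj G) w a
    from-x ax aw e = ∨-true _ _ (trans (sym (at-x ax aw)) e)

    from-w : ∀ {a} → a ≢ x → a ≢ w → Adj (adj H) w a → Adj (adj G) x a × Adj (adj G) w a
    from-w ax aw e = ∧-true _ _ (trans (sym (at-w ax aw)) e)

    Off : Fin n → Set
    Off a = a ≢ x × a ≢ w

    far-chain : ∀ {a q b} → Off a → All Off q → Off b → Chain H a q b → Chain G a q b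
    far-chain oa oq ob c = chain-map c (λ m m′ e → let (p , q) = get m ; (p′ , q′) = get m′ in trans (sym (far p q p′ q′)) e)
      where
      get : ∀ {z} → z ∈ _ ∷ _ ∷ _ → Off z
      get (here refl)         = oa
      get (there (here refl)) = ob
      get (there (there m))   = All.lookup oq m

    start-x : ∀ {q b} → All Off q → Off b → Chain H x q b → Chain G x q b ⊎ Chain G w q b
    start-x oq (bx , bw) (edge e) = Sum.map edge edge (from-x bx bw e)
    start-x ((zx , zw) ∷ oq) ob (e ∷ c) = Sum.map (_∷ c′) (_∷ c′) (from-x zx zw e)
      where c′ = far-chain (zx , zw) oq ob c

    start-w : ∀ {q b} → All Off q → Off b → Chain H w q b → Chain G x q b × Chain G w q b
    start-w oq (bx , bw) (edge e) with from-w bx bw e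
    ... | p , q = edge p , edge q
    start-w ((zx , zw) ∷ oq) ob (e ∷ c) with from-w zx zw e
    ... | p , q = p ∷ c′ , q ∷ c′
      where c′ = far-chain (zx , zw) oq ob c

    end-x : ∀ {q b} → All Off q → Off b → Chain H b q x → Chain G b q x ⊎ Chain G b q w
    end-x {q} oq ob c = Sum.map chain-reverse⁻ chain-reverse⁻
      (start-x (↭P.All-resp-↭ (↭-sym (↭P.↭-reverse q)) oq) ob (chain-reverse c))

    -- Between x and w the interior can be traversed in either direction.
    between : ∀ {q} → All Off q → Chain H x q w → ∃ λ q′ → q′ ↭ q × Chain G x q′ w
    between [] (edge e) = [] , ↭-refl , edge x~w
    between {z ∷ q} (oz ∷ oq) (e ∷ c) with start-w (↭P.All-resp-↭ (↭-sym (↭P.↭-reverse q)) oq) oz (chain-reverse c)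
    ... | cx , cw with from-x (proj₁ oz) (proj₂ oz) e
    ...   | inj₁ xz = z ∷ q , ↭-refl , xz ∷ chain-reverse⁻ cw
    ...   | inj₂ wz = reverse q ++ z ∷ [] , ↭-trans (↭-sym (↭P.∷↭∷ʳ z (reverse q))) (↭-prep z (↭P.↭-reverse q)) , chain-++ cx (edge (Adj-sym {G = G} wz))

  record Longer (u v : Fin n) (p : List (Fin n)) : Set where
    constructor longer
    field
      {path} : List (Fin n)
      chain  : Chain G u path v
      simple : Unique (u ∷ v ∷ path)
      length≤ : length p ≤ length path

  private
    unique-↭ : ∀ {u v : Fin n} {p p′} → p′ ↭ p → Unique (u ∷ v ∷ p) → Unique (u ∷ v ∷ p′)
    unique-↭ τ = Unique-resp-↭ (↭-prep _ (↭-prep _ (↭-sym τ)))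

    permuted : ∀ {u v p p′} → Chain G u p′ v → p′ ↭ p → Unique (u ∷ v ∷ p) → Longer u v p
    permuted c τ un = longer c (unique-↭ τ un) (≤-reflexive (sym (↭P.↭-length τ)))

    inserted : ∀ {u v p p′} → w ≢ u → w ≢ v → w ∉ p → Chain G u p′ v → p′ ↭ w ∷ p → Unique (u ∷ v ∷ p) → Longer u v p
    inserted wu wv w∉p c τ ((u≢v ∷ pu) ∷ pv ∷ up) =
      longer c (unique-↭ τ ((u≢v ∷ (wu ∘ sym) ∷ pu) ∷ ((wv ∘ sym) ∷ pv) ∷ ∉⇒All≢ w∉p ∷ up))
        (≤-trans (n≤1+n _) (≤-reflexive (sym (↭P.↭-length τ))))

    outside : ∀ {y} (α : List (Fin n)) {γ} → Unique (α ++ y ∷ γ) → y ∉ α ++ γ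
    outside α un = All≢⇒∉ (AllPairs.head (Unique-resp-↭ (middle α) un))

    ∉-++ : ∀ {y} (α : List (Fin n)) {γ} → y ∉ α ++ γ → y ∉ α × y ∉ γ
    ∉-++ α h = (h ∘ ∈-++⁺ˡ) , (h ∘ ∈-++⁺ʳ α)

    offs : ∀ {l} → x ∉ l → w ∉ l → All Off l
    offs xl wl = All.tabulate (λ m → (λ { refl → xl m }) , (λ { refl → wl m }))

    -- An H-neighbour of w other than x is a G-neighbour of both, so the part behind w may follow x
    -- or w. If the part before x can only be attached to w, then x and w exchange places and the
    -- middle is traversed backwards.
    both-on : ∀ {u v} α γ₁ γ₂ → Off u → Off v → Chain H u (α ++ x ∷ (γ₁ ++ w ∷ γ₂)) v →
      Unique (u ∷ v ∷ (α ++ x ∷ (γ₁ ++ w ∷ γ₂))) → Longer u v (α ++ x ∷ (γ₁ ++ w ∷ γ₂))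
    both-on {u} {v} α γ₁ γ₂ ou ov c un@(_ ∷ _ ∷ un′)
      with ∉-++ α (outside α un′) | outside γ₁ (AllPairs.tail (proj₂ (Unique-++⁻ α un′)))
         | outside (α ++ x ∷ γ₁) (subst Unique (sym (++-assoc α (x ∷ γ₁) (w ∷ γ₂))) un′)
    ... | x∉α , x∉γ | w∉γ | w∉ with ∉-++ γ₁ w∉γ | ∉-++ γ₁ x∉γ | ∉-++ α (proj₁ (∉-++ (α ++ x ∷ γ₁) w∉))
    ...   | w∉γ₁ , w∉γ₂ | x∉γ₁ , x∉wγ₂ | w∉α , _ with chain-split α c
    ...     | c₁ , c₂ with chain-split γ₁ c₂
    ...       | c₂ , c₃ with between (offs x∉γ₁ w∉γ₁) c₂ | start-w (offs (x∉wγ₂ ∘ there) w∉γ₂) ov c₃ | end-x (offs x∉α w∉α) ou c₁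
    ...         | q′ , τ , cm | cx , cw | inj₁ cl = permuted (chain-++ cl (chain-++ cm cw))
        (↭P.++⁺ˡ α (↭-prep x (↭P.++⁺ʳ (w ∷ γ₂) τ))) un
    ...         | q′ , τ , cm | cx , cw | inj₂ cl = permuted (chain-++ cl (chain-++ (chain-reverse cm) cx))
        (↭-trans (exchange-middle α (reverse q′)) (↭P.++⁺ˡ α (↭-prep x (↭P.++⁺ʳ (w ∷ γ₂) (↭-trans (↭P.↭-reverse q′) τ))))) un

    flip-longer : ∀ {u v p p′} → p′ ↭ p → Longer v u p′ → Longer u v p
    flip-longer τ (longer {q} c un le) = longer (chain-reverse c)
      (Unique-resp-↭ (↭-swap _ _ (↭-sym (↭P.↭-reverse q))) un)
      (subst₂ _≤_ (↭P.↭-length τ) (sym (length-reverse q)) le)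

    -- Each of the two sides is attached in G to x or to w. If they differ, w is inserted beside x
    -- and the path becomes longer; if both are attached to w, then w takes the place of x.
    only-x : ∀ {u v} α γ → Off u → Off v → w ∉ α ++ x ∷ γ → Chain H u (α ++ x ∷ γ) v →
      Unique (u ∷ v ∷ (α ++ x ∷ γ)) → Longer u v (α ++ x ∷ γ)
    only-x {u} {v} α γ ou ov w∉ c un@(pu ∷ pv ∷ un′) with ∉-++ α (outside α un′) | ∉-++ α w∉ | chain-split α c
    ... | x∉α , x∉γ | w∉α , w∉xγ | c₁ , c₂
      with end-x (offs x∉α w∉α) ou c₁ | start-x (offs x∉γ (w∉xγ ∘ there)) ov c₂
    ...   | inj₁ a | inj₁ b = permuted (chain-++ a b) ↭-refl un
    ...   | inj₁ a | inj₂ b = inserted (proj₂ ou ∘ sym) (proj₂ ov ∘ sym) w∉ (chain-++ a (x~w ∷ b))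
        (↭-trans (↭P.++⁺ˡ α (↭-swap x w ↭-refl)) (middle α)) un
    ...   | inj₂ a | inj₁ b = inserted (proj₂ ou ∘ sym) (proj₂ ov ∘ sym) w∉ (chain-++ a (Adj-sym {G = G} x~w ∷ b)) (middle α) un
    ...   | inj₂ a | inj₂ b with Unique-resp-↭ (↭-prep u (↭-prep v (middle α {x} {γ}))) un
    ...     | (u≢v ∷ _ ∷ pu′) ∷ (_ ∷ pv′) ∷ _ ∷ un″ = longer (chain-++ a b)
        (unique-↭ (middle α) ((u≢v ∷ proj₂ ou ∷ pu′) ∷ (proj₂ ov ∷ pv′) ∷ ∉⇒All≢ w∉αγ ∷ un″))
        (≤-reflexive (trans (length-++ α) (sym (length-++ α))))
      where
      w∉αγ : w ∉ α ++ γ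
      w∉αγ m with ∈-++⁻ α m
      ... | inj₁ m′ = w∉α m′
      ... | inj₂ m′ = w∉xγ (there m′)

    from-end : ∀ {v p} → w ≢ v → x ≢ v → Chain H x p v → Unique (x ∷ v ∷ p) → Longer x v p
    from-end {v} {p} wv xv c un@((_ ∷ px) ∷ pv ∷ up) with mem? w p
    ... | no w∉p with start-x (offs (All≢⇒∉ px) w∉p) (xv ∘ sym , wv ∘ sym) c
    ...   | inj₁ d = permuted d ↭-refl un
    ...   | inj₂ d = inserted (Adj-≢ {G = G} x~w ∘ sym) wv w∉p (x~w ∷ d) ↭-refl un
    from-end {v} {p} wv xv c un@((_ ∷ px) ∷ pv ∷ up) | yes w∈p with ∈-∃++ w∈p
    ... | α , γ , refl with ∉-++ α (outside α up) | ∉-++ α (All≢⇒∉ px) | chain-split α c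
    ...   | w∉α , w∉γ | x∉α , x∉wγ | c₁ , c₂ with between (offs x∉α w∉α) c₁ | start-w (offs (x∉wγ ∘ there) w∉γ) (xv ∘ sym , wv ∘ sym) c₂
    ...     | q′ , τ , cm | _ , cw = permuted (chain-++ cm cw) (↭P.++⁺ʳ (w ∷ γ) τ) un

  shift-longer : ∀ {u v p} → w ≢ u → w ≢ v → x ≢ v → Chain H u p v → Unique (u ∷ v ∷ p) → Longer u v p
  shift-longer {u} {v} {p} wu wv xv c un with x ≟ u
  ... | yes refl = from-end wv xv c un
  ... | no x≢u with mem? x p
  ...   | no x∉p = permuted (chain-map c edge-in) ↭-refl un
    where
    out : ∀ {z} → z ∈ u ∷ v ∷ p → z ≢ x
    out (here refl) refl         = x≢u refl
    out (there (here refl)) refl = xv refl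
    out (there (there m)) refl   = x∉p m
    edge-in : ∀ {a b} → a ∈ u ∷ v ∷ p → b ∈ u ∷ v ∷ p → Adj (adj H) a b → Adj (adj G) a b
    edge-in {a} {b} ma mb e with a ≟ w | b ≟ w
    ... | yes refl | yes refl = ⊥-elim (Adj-≢ {G = H} e refl)
    ... | yes refl | no b≢w   = proj₂ (from-w (out mb) b≢w e)
    ... | no a≢w   | yes refl = Adj-sym {G = G} (proj₂ (from-w (out ma) a≢w (Adj-sym {G = H} e)))
    ... | no a≢w   | no b≢w   = trans (sym (far (out ma) a≢w (out mb) b≢w)) e
  ...   | yes x∈p with ∈-∃++ x∈p
  ...     | α , γ , refl with mem? w α
  ...       | yes w∈α with ∈-∃++ w∈α
  -- Here w precedes x; the reversed path, from v to u, has x before w again.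
  ...         | α₁ , α₂ , refl = flip-longer (↭-trans (Perm.↭-reflexive (sym rev)) (↭P.↭-reverse _))
      (both-on (reverse γ) (reverse α₂) (reverse α₁) ov ou
        (subst (λ l → Chain H v l u) rev (chain-reverse c))
        (Unique-resp-↭ (↭-swap u v (↭-trans (↭-sym (↭P.↭-reverse _)) (Perm.↭-reflexive rev))) un))
    where
    ou : Off u
    ou = x≢u ∘ sym , wu ∘ sym
    ov : Off v
    ov = xv ∘ sym , wv ∘ sym
    rev : reverse ((α₁ ++ w ∷ α₂) ++ x ∷ γ) ≡ reverse γ ++ x ∷ (reverse α₂ ++ w ∷ reverse α₁)
    rev = trans (reverse-++ (α₁ ++ w ∷ α₂) (x ∷ γ)) (trans (cong₂ _++_ (unfold-reverse x γ) (trans (reverse-++ α₁ (w ∷ α₂)) (trans (cong (_++ reverse α₁) (unfold-reverse w α₂)) (++-assoc (reverse α₂) _ _)))) (++-assoc (reverse γ) _ _))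
  shift-longer {u} {v} {p} wu wv xv c un | no x≢u | yes x∈p | α , γ , refl | no w∉α with mem? w γ
  ... | no w∉γ = only-x α γ (x≢u ∘ sym , wu ∘ sym) (xv ∘ sym , wv ∘ sym) w∉ c un
    where
    w∉ : w ∉ α ++ x ∷ γ
    w∉ m with ∈-++⁻ α m
    ... | inj₁ m′ = w∉α m′
    ... | inj₂ (here w≡x) = Adj-≢ {G = G} x~w (sym w≡x)
    ... | inj₂ (there m′) = w∉γ m′
  ... | yes w∈γ with ∈-∃++ w∈γ
  ...   | γ₁ , γ₂ , refl = both-on α γ₁ γ₂ (x≢u ∘ sym , wu ∘ sym) (xv ∘ sym , wv ∘ sym) c un

  shift-Bounded : ∀ {u v k} → w ≢ u → w ≢ v → x ≢ v → Bounded G u v k → Bounded H u v k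
  shift-Bounded wu wv xv bd p c un with shift-longer wu wv xv c un
  ... | longer {q} d uq le = ≤-trans (+-monoʳ-≤ 2 le) (bd q d uq)

-- Pulling back the extremal structure

Inner : ∀ {n} → Fin n → Fin n → Fin n → Set
Inner u v x = x ≢ u × x ≢ v

innerᵇ : ∀ {n} → Fin n → Fin n → Fin n → Bool
innerᵇ u v x = not ⌊ x ≟ u ⌋ ∧ not ⌊ x ≟ v ⌋

innerᵇ⁺ : ∀ {n} {u v x : Fin n} → Inner u v x → innerᵇ u v x ≡ true
innerᵇ⁺ {u = u} {v} {x} (p , q) rewrite ⌊⌋-false (x ≟ u) p | ⌊⌋-false (x ≟ v) q = refl

innerᵇ⁻ : ∀ {n} {u v x : Fin n} → innerᵇ u v x ≡ true → Inner u v x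
innerᵇ⁻ {u = u} {v} {x} e with x ≟ u | x ≟ v
... | no p | no q = p , q

-- The shape of X_{n,k} up to the edges inside the small block, which carries the label β.
record Good {n} (G : Graph n) (u v : Fin n) (m β : ℕ) : Set where
  field
    label   : Fin n → ℕ
    label≤  : ∀ x → label x ≤ β
    nocross : ∀ {x y} → Inner u v x → Inner u v y → Adj (adj G) x y → label x ≡ label y
    clique  : ∀ {x y} → Inner u v x → Inner u v y → x ≢ y → label x ≡ label y → label x < β → Adj (adj G) x y
    joined  : ∀ {x} → Inner u v x → label x < β → Adj (adj G) u x × Adj (adj G) v x
    size    : ∀ i → i < β → count (λ x → innerᵇ u v x ∧ ⌊ label x ≟ℕ i ⌋) (allFin n) ≡ m

Good-sym : ∀ {n} {G : Graph n} {u v m β} → Good G u v m β → Good G v u m β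
Good-sym {n} {u = u} {v} good = record
  { label = label ; label≤ = label≤
  ; nocross = λ (p , q) (p′ , q′) → nocross (q , p) (q′ , p′)
  ; clique = λ (p , q) (p′ , q′) → clique (q , p) (q′ , p′)
  ; joined = λ (p , q) lt → let (e , e′) = joined (q , p) lt in e′ , e
  ; size = λ i lt → trans (cong length (filterᵇ-cong (allFin n)
      (λ {x} _ → cong (_∧ ⌊ label x ≟ℕ i ⌋) (∧-comm (not ⌊ x ≟ v ⌋) _)))) (size i lt) }
  where open Good good

module GoodClasses {n} {H : Graph n} {u v : Fin n} {m β} (good : Good H u v m β) where
  open Good good

  record ClassRest (x : Fin n) : Set where
    field
      rest   : List (Fin n)
      simple : Unique rest
      new    : x ∉ rest
      length≡ : suc (length rest) ≡ m
      inner  : ∀ {a} → a ∈ rest → Inner u v a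
      same   : ∀ {a} → a ∈ rest → label a ≡ label x

    other : ∀ {a} → a ∈ rest → a ≢ x
    other m refl = new m

  class-rest : ∀ {x} → Inner u v x → label x < β → ClassRest x
  class-rest {x} ix lt with ∈-∃++ (∈-filterᵇ⁺ in-class (∈-allFin x) (∧-intro (innerᵇ⁺ ix) (⌊⌋-intro (label x ≟ℕ label x) refl)))
    where in-class = λ y → innerᵇ u v y ∧ ⌊ label y ≟ℕ label x ⌋
  ... | α , γ , eq = record
    { rest = α ++ γ
    ; simple = AllPairs.tail un
    ; new = All≢⇒∉ (AllPairs.head un)
    ; length≡ = trans (sym (↭P.↭-length τ)) (size (label x) lt)
    ; inner = λ m → innerᵇ⁻ (proj₁ (back m))
    ; same = λ {a} m → ⌊⌋-true (label a ≟ℕ label x) (proj₂ (back m)) }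
    where
    in-class : Fin n → Bool
    in-class y = innerᵇ u v y ∧ ⌊ label y ≟ℕ label x ⌋
    τ : filterᵇ in-class (allFin n) ↭ x ∷ α ++ γ
    τ = ↭-trans (Perm.↭-reflexive eq) (middle α)
    un : Unique (x ∷ α ++ γ)
    un = Unique-resp-↭ τ (UniqueP.filter⁺ (T? ∘ in-class) (UniqueP.allFin⁺ n))
    back : ∀ {a} → a ∈ α ++ γ → innerᵇ u v a ≡ true × ⌊ label a ≟ℕ label x ⌋ ≡ true
    back {a} m = ∧-true (innerᵇ u v a) _ (proj₂ (∈-filterᵇ⁻ in-class (allFin n) (↭P.∈-resp-↭ (↭-sym τ) (there m))))

deg : ∀ {n} → Graph n → Fin n → ℕ
deg {n} G x = count (adj G x) (allFin n)

record Improves {n} (G : Graph n) (u v : Fin n) (m β : ℕ) : Set where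
  field
    {graph} : Graph n
    base    : Adj (adj graph) u v
    linkage : Linkage graph u v
    bounded : Bounded graph u v (2 + m)
    cliques : ∀ s → N (2 + s) G ≤ N (2 + s) graph
    degrees : deg G u + deg G v < deg graph u + deg graph v
    good    : Good graph u v m β → Good G u v m β

To-P : ∀ {n} {G : Graph n} {P : Fin n → Set} {v a} → P v → To G P v a → P a
To-P pv stop = pv
To-P pv (go pa _ _) = pa

-- The Kelmans operation moving edges from w to u, possibly with the edge wv added when w would become pendant.
record ShiftLike {n} (G H : Graph n) (u v w : Fin n) : Set where
  field
    far   : ∀ {a b} → a ≢ u → a ≢ w → b ≢ u → b ≢ w → adj H a b ≡ adj G a b
    at-u  : ∀ {a} → a ≢ u → a ≢ w → adj H u a ≡ adj G u a ∨ adj G w a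
    at-w  : ∀ {a} → a ≢ u → a ≢ w → a ≢ v → adj H w a ≡ adj G u a ∧ adj G w a
    wv    : Adj (adj G) w v → Adj (adj H) w v
    keep  : Adj (adj H) u w
    exit  : ∃ λ y → y ≢ u × y ≢ w × Adj (adj H) w y

module ShiftStep {n} {G H : Graph n} {u v w z : Fin n} {m : ℕ}
  (sl : ShiftLike G H u v w) (uv : Adj (adj G) u v) (uw : Adj (adj G) u w) (w≢v : w ≢ v)
  (wz : Adj (adj G) w z) (z≢u : z ≢ u) (¬uz : ¬ Adj (adj G) u z)
  (conn : ∀ y → y ≢ u → y ≢ w → To G (λ a → a ≢ u × a ≢ w) v y)
  where
  open ShiftLike sl
  private
    u≢v = Adj-≢ {G = G} uv
    u≢w = Adj-≢ {G = G} uw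
    pv : v ≢ u × v ≢ w
    pv = (u≢v ∘ sym) , (w≢v ∘ sym)

    to-H : ∀ {a} → To G (λ a → a ≢ u × a ≢ w) v a → To H (λ a → a ≢ u × a ≢ w) v a
    to-H stop = stop
    to-H (go (au , aw) e r) with To-P pv r
    ... | bu , bw = go (au , aw) (trans (far au aw bu bw) e) (to-H r)

    esc-u : ∀ {a} → To H (λ a → a ≢ u × a ≢ w) v a → Esc H u v u a
    esc-u stop = stop (u≢v ∘ sym) (inj₂ refl)
    esc-u (go (au , aw) e r) = go au e (esc-u r)

    esc-w : ∀ {a} → To H (λ a → a ≢ u × a ≢ w) v a → Esc H u v w a
    esc-w stop = stop (w≢v ∘ sym) (inj₂ refl)
    esc-w (go (au , aw) e r) = go aw e (esc-w r)

  -- The delicate case is the deletion of u: apart from v, w has kept only neighbours that it shared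
  -- with u, and `exit` is what still attaches it.
  linkage′ : Linkage G u v → Linkage H u v
  linkage′ lk x a a≢x with x ≟ u
  linkage′ lk x a a≢x | yes refl with a ≟ w | exit
  ... | no a≢w | _ = esc-u (to-H (conn a a≢x a≢w))
  ... | yes refl | y , yu , yw , wy = go a≢x wy (esc-u (to-H (conn y yu yw)))
  linkage′ lk x a a≢x | no x≢u with x ≟ w
  linkage′ lk x a a≢x | no x≢u | yes refl with a ≟ u
  ... | yes refl = stop a≢x (inj₁ refl)
  ... | no a≢u = esc-w (to-H (conn a a≢u a≢x))
  linkage′ lk x a a≢x | no x≢u | no x≢w = lift (lk x a a≢x)
    where
    to-u : ∀ {a} → a ≢ x → Adj (adj H) u a → Esc H u v x a
    to-u a≢x e = go a≢x (Adj-sym {G = H} e) (stop (x≢u ∘ sym) (inj₁ refl))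
    lift : ∀ {a} → Esc G u v x a → Esc H u v x a
    lift (stop t≢x t) = stop t≢x t
    lift (go {a} {b} a≢x e r) with a ≟ u | a ≟ w | b ≟ u | b ≟ w
    ... | yes refl | _ | _ | _ = stop a≢x (inj₁ refl)
    ... | no _  | yes refl | _ | _ = to-u a≢x keep
    ... | no au | no aw | yes refl | _ = to-u a≢x (trans (at-u au aw) (∨-trueˡ _ (Adj-sym {G = G} e)))
    ... | no au | no aw | no _ | yes refl = to-u a≢x (trans (at-u au aw) (∨-trueʳ (adj G u a) (Adj-sym {G = G} e)))
    ... | no au | no aw | no bu | no bw = go a≢x (trans (far au aw bu bw) e) (lift r)

  edge′ : Adj (adj H) u v
  edge′ = trans (at-u (proj₁ pv) (proj₂ pv)) (∨-trueˡ _ uv)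

  degrees′ : deg G u + deg G v < deg H u + deg H v
  degrees′ = +-mono-<-≤
    (count-< (adj G u) (adj H u) (allFin n) grow-u (∈-allFin z) (≢true ¬uz)
      (trans (at-u z≢u (Adj-≢ {G = G} wz ∘ sym)) (∨-trueʳ (adj G u z) wz)))
    (count-≤ (adj G v) (adj H v) (allFin n) grow-v)
    where
    grow-u : ∀ y → adj G u y ≡ true → adj H u y ≡ true
    grow-u y e with y ≟ w
    ... | yes refl = keep
    ... | no y≢w = trans (at-u (Adj-≢ {G = G} e ∘ sym) y≢w) (∨-trueˡ _ e)
    grow-v : ∀ y → adj G v y ≡ true → adj H v y ≡ true
    grow-v y e with y ≟ u | y ≟ w
    ... | yes refl | _ = Adj-sym {G = H} edge′
    ... | no _ | yes refl = Adj-sym {G = H} (wv (Adj-sym {G = G} e))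
    ... | no y≢u | no y≢w = trans (far (proj₁ pv) (proj₂ pv) y≢u y≢w) e

  module Back {β} (bd : Bounded G u v (2 + m)) (good : Good H u v m β) where
    open Good good
    open GoodClasses good

    private
      iw : Inner u v w
      iw = (u≢w ∘ sym) , w≢v

      common : ∀ {a} → Inner u v a → a ≢ w → Adj (adj H) w a → Adj (adj G) u a × Adj (adj G) w a
      common (au , av) aw e = ∧-true _ _ (trans (sym (at-w au aw av)) e)

      far⁻ : ∀ {a b} → a ≢ u → a ≢ w → b ≢ u → b ≢ w → Adj (adj H) a b → Adj (adj G) a b
      far⁻ au aw bu bw e = trans (sym (far au aw bu bw)) e

      far⁺ : ∀ {a b} → a ≢ u → a ≢ w → b ≢ u → b ≢ w → Adj (adj G) a b → Adj (adj H) a b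
      far⁺ au aw bu bw e = trans (far au aw bu bw) e

      chain-label : ∀ {y p} → Chain G y p v → y ≢ u → y ≢ w → y ≢ v → All (λ a → a ≢ u × a ≢ w) p → All (_≢ v) p →
        All (λ a → label a ≡ label y) p
      chain-label (edge _) _ _ _ [] [] = []
      chain-label (e ∷ c) yu yw yv ((au , aw) ∷ ps) (av ∷ vs) = l ∷ All.map (λ q → trans q l) (chain-label c au aw av ps vs)
        where l = sym (nocross (yu , yv) (au , av) (far⁺ yu yw au aw e))

      too-long : ∀ {l} → Chain G u l v → Unique (u ∷ v ∷ l) → suc m ≤ length l → ⊥
      too-long {l} c un le = <⇒≱ (s≤s (s≤s le)) (bd l c un)

      -- Such an edge of G gives a path from u to v with more than m interior vertices. If the class
      -- of w is full, the path runs through all of it, ending at w, and then by y to v, staying in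
      -- the class of y. Otherwise the class of y is full, and the path is u, w, then that whole
      -- class from y on, then v.
      no-escape : ∀ {y} → Inner u v y → Adj (adj G) w y → label w ≢ label y → ⊥
      no-escape {y} iy@(yu , yv) wy ne with label w <? β
      ... | yes lt with To-simple (conn y yu (Adj-≢ {G = G} wy ∘ sym)) yv
      ...   | p , c , (y≢v ∷ y∉p) ∷ v∉p ∷ up , py ∷ pp =
          too-long (chain-++ (clique-chain A.rest uw
              (λ m → proj₁ (cm m)) (λ m → Adj-sym {G = G} (proj₂ (cm m))) inside A.simple) (wy ∷ c))
            ((u≢v ∷ AllP.++⁺ (All.tabulate (λ m e → proj₁ (A.inner m) (sym e))) (u≢w ∷ (yu ∘ sym) ∷ All.map (λ q e → proj₁ q (sym e)) pp))
             ∷ AllP.++⁺ (All.tabulate (λ m e → proj₂ (A.inner m) (sym e))) ((w≢v ∘ sym) ∷ (y≢v ∘ sym) ∷ v∉p)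
             ∷ UniqueP.++⁺ A.simple (((Adj-≢ {G = G} wy) ∷ All.map (λ q e → proj₂ q (sym e)) pp) ∷ y∉p ∷ up)
                 (λ (m , m′) → apart m m′))
            (≤-trans (s≤s (≤-reflexive (sym A.length≡))) (≤-trans (s≤s (s≤s (m≤m+n (length A.rest) (length p)))) (≤-reflexive len)))
        where
        module A = ClassRest (class-rest iw lt)
        cm : ∀ {a} → a ∈ A.rest → Adj (adj G) u a × Adj (adj G) w a
        cm m = common (A.inner m) (A.other m) (clique iw (A.inner m) (A.other m ∘ sym) (sym (A.same m)) lt)
        inside : ∀ {a b} → a ∈ A.rest → b ∈ A.rest → a ≢ b → Adj (adj G) a b
        inside m m′ a≢b = far⁻ (proj₁ (A.inner m)) (A.other m) (proj₁ (A.inner m′)) (A.other m′)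
          (clique (A.inner m) (A.inner m′) a≢b (trans (A.same m) (sym (A.same m′))) (subst (_< β) (sym (A.same m)) lt))
        vs : All (_≢ v) p
        vs = All.map (_∘ sym) v∉p
        apart : ∀ {a} → a ∈ A.rest → a ∈ w ∷ y ∷ p → ⊥
        apart m (here refl) = A.new m
        apart m (there (here refl)) = ne (sym (A.same m))
        apart m (there (there m′)) = ne (trans (sym (A.same m))
          (All.lookup (chain-label c yu (Adj-≢ {G = G} wy ∘ sym) yv pp vs) m′))
        len : suc (suc (length A.rest + length p)) ≡ length (A.rest ++ w ∷ y ∷ p)
        len = sym (trans (length-++ A.rest) (trans (+-suc _ _) (cong suc (+-suc _ _))))
      no-escape {y} iy@(yu , yv) wy ne | no ¬lt with label y <? β
      ... | no ¬lt′ = ne (trans (≤-antisym (label≤ w) (≮⇒≥ ¬lt)) (sym (≤-antisym (label≤ y) (≮⇒≥ ¬lt′))))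
      ... | yes lt = too-long (uw ∷ wy ∷ clique-chain A.rest (to-v iy y≢w lt)
              (λ m → inside iy y≢w (A.inner m) (nw m) (A.other m ∘ sym) (sym (A.same m)) lt)
              (λ m → to-v (A.inner m) (nw m) (lt′ m))
              (λ m m′ ab → inside (A.inner m) (nw m) (A.inner m′) (nw m′) ab (trans (A.same m) (sym (A.same m′))) (lt′ m)) A.simple)
            ((u≢v ∷ u≢w ∷ (yu ∘ sym) ∷ All.tabulate (λ m e → proj₁ (A.inner m) (sym e)))
             ∷ ((w≢v ∘ sym) ∷ (yv ∘ sym) ∷ All.tabulate (λ m e → proj₂ (A.inner m) (sym e)))
             ∷ ((y≢w ∘ sym) ∷ All.tabulate (λ m e → nw m (sym e))) ∷ ∉⇒All≢ A.new ∷ A.simple)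
            (s≤s (≤-reflexive (sym A.length≡)))
        where
        module A = ClassRest (class-rest iy lt)
        y≢w : y ≢ w
        y≢w = Adj-≢ {G = G} wy ∘ sym
        nw : ∀ {a} → a ∈ A.rest → a ≢ w
        nw m refl = ne (A.same m)
        lt′ : ∀ {a} → a ∈ A.rest → label a < β
        lt′ m = subst (_< β) (sym (A.same m)) lt
        to-v : ∀ {a} → Inner u v a → a ≢ w → label a < β → Adj (adj G) a v
        to-v ia aw l = far⁻ (proj₁ ia) aw (proj₁ pv) (proj₂ pv) (Adj-sym {G = H} (proj₂ (joined ia l)))
        inside : ∀ {a b} → Inner u v a → a ≢ w → Inner u v b → b ≢ w → a ≢ b → label a ≡ label b → label a < β → Adj (adj G) a b
        inside ia aw ib bw ab l l< = far⁻ (proj₁ ia) aw (proj₁ ib) bw (clique ia ib ab l l<)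

      near-w : ∀ {y} → Inner u v y → Adj (adj G) w y → label w ≡ label y
      near-w {y} iy wy with label w ≟ℕ label y
      ... | yes e = e
      ... | no ne = ⊥-elim (no-escape iy wy ne)

      z≢w : z ≢ w
      z≢w = Adj-≢ {G = G} wz ∘ sym

      iz : Inner u v z
      iz = z≢u , λ { refl → ¬uz uv }

    good-back : Good G u v m β
    good-back = record
      { label = label ; label≤ = label≤ ; size = size
      ; nocross = nocross′
      ; clique = clique′
      ; joined = λ ix lt → to-u ix lt , Adj-sym {G = G} (to-v ix lt) }
      where
      nocross′ : ∀ {x y} → Inner u v x → Inner u v y → Adj (adj G) x y → label x ≡ label y
      nocross′ {x} {y} ix iy e with x ≟ w | y ≟ w
      ... | yes refl | _ = near-w iy e
      ... | no _ | yes refl = sym (near-w ix (Adj-sym {G = G} e))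
      ... | no xw | no yw = nocross ix iy (far⁺ (proj₁ ix) xw (proj₁ iy) yw e)
      clique′ : ∀ {x y} → Inner u v x → Inner u v y → x ≢ y → label x ≡ label y → label x < β → Adj (adj G) x y
      clique′ {x} {y} ix iy ne l lt with x ≟ w | y ≟ w
      ... | yes refl | _ = proj₂ (common iy (ne ∘ sym) (clique ix iy ne l lt))
      ... | no xw | yes refl = Adj-sym {G = G} (proj₂ (common ix xw (Adj-sym {G = H} (clique ix iy ne l lt))))
      ... | no xw | no yw = far⁻ (proj₁ ix) xw (proj₁ iy) yw (clique ix iy ne l lt)
      to-u : ∀ {x} → Inner u v x → label x < β → Adj (adj G) u x
      to-u {x} ix lt with x ≟ w
      ... | yes refl = uw
      ... | no xw with ∨-true _ _ (trans (sym (at-u (proj₁ ix) xw)) (proj₁ (joined ix lt)))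
      ...   | inj₁ e = e
      ...   | inj₂ wx = proj₁ (common ix xw (clique iw ix (xw ∘ sym) (near-w ix wx) (subst (_< β) (sym (near-w ix wx)) lt)))
      to-v : ∀ {x} → Inner u v x → label x < β → Adj (adj G) x v
      to-v {x} ix lt with x ≟ w
      ... | no xw = far⁻ (proj₁ ix) xw (proj₁ pv) (proj₂ pv) (Adj-sym {G = H} (proj₂ (joined ix lt)))
      -- In a full class w would be H-adjacent to z, which has the same label; then z would be a
      -- common neighbour of u and w in G, contrary to the choice of z.
      ... | yes refl = ⊥-elim (¬uz (proj₁ (common iz z≢w (clique iw iz (z≢w ∘ sym) (near-w iz wz) lt))))

addEdge-off : ∀ {n} (a : Fin n → Fin n → Bool) {x y i j} → ¬ (i ≡ x × j ≡ y) → ¬ (i ≡ y × j ≡ x) →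
  addEdge a x y i j ≡ a i j
addEdge-off a {x} {y} {i} {j} p q with a i j
... | true = refl
... | false with i ≟ x | j ≟ y | i ≟ y | j ≟ x
...   | yes e | yes e′ | _ | _ = ⊥-elim (p (e , e′))
...   | yes _ | no _ | yes e | yes e′ = ⊥-elim (q (e , e′))
...   | no _ | _ | yes e | yes e′ = ⊥-elim (q (e , e′))
...   | yes _ | no _ | yes _ | no _ = refl
...   | yes _ | no _ | no _ | _ = refl
...   | no _ | _ | yes _ | no _ = refl
...   | no _ | _ | no _ | _ = refl

addEdge-on : ∀ {n} (a : Fin n → Fin n → Bool) x y → addEdge a x y x y ≡ true
addEdge-on a x y = ∨-trueʳ (a x y) (∨-trueˡ _ (∧-intro (⌊⌋-intro (x ≟ x) refl) (⌊⌋-intro (y ≟ y) refl)))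

addEdge-sym : ∀ {n} (a : Fin n → Fin n → Bool) → (∀ i j → a i j ≡ a j i) → ∀ x y i j → addEdge a x y i j ≡ addEdge a x y j i
addEdge-sym a sy x y i j = cong₂ _∨_ (sy i j)
  (trans (∨-comm (⌊ i ≟ x ⌋ ∧ ⌊ j ≟ y ⌋) _) (cong₂ _∨_ (∧-comm ⌊ i ≟ y ⌋ _) (∧-comm ⌊ i ≟ x ⌋ _)))

plusEdge : ∀ {n} (G : Graph n) (x y : Fin n) → x ≢ y → Graph n
plusEdge G x y x≢y = record
  { adj = addEdge (adj G) x y
  ; sym = addEdge-sym (adj G) (adj-sym G) x y
  ; irref = λ i → trans (addEdge-off (adj G) (λ (p , q) → x≢y (trans (sym p) q)) (λ (p , q) → x≢y (trans (sym q) p))) (irref G i) }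

module _ {n} {G : Graph n} {u v w z : Fin n} {m β : ℕ} (1≤m : 1 ≤ m)
  (uv : Adj (adj G) u v) (uw : Adj (adj G) u w) (w≢v : w ≢ v)
  (wz : Adj (adj G) w z) (z≢u : z ≢ u) (¬uz : ¬ Adj (adj G) u z)
  (conn : ∀ y → y ≢ u → y ≢ w → To G (λ a → a ≢ u × a ≢ w) v y)
  (lk : Linkage G u v) (bd : Bounded G u v (2 + m))
  where
  private
    u≢v = Adj-≢ {G = G} uv
    u≢w = Adj-≢ {G = G} uw
    T′ = Kelmans.shifted G u w uw
    is = Kelmans.isShift G u w uw
    open IsShift is
    bdT : Bounded T′ u v (2 + m)
    bdT = shift-Bounded is (u≢w ∘ sym) w≢v u≢v bd

  -- Without a common neighbour of u and w the Kelmans operation leaves w pendant at u and destroys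
  -- 2-connectedness. The edge wv repairs this; the only path it adds is u, w, v, whose single
  -- interior vertex is allowed by 1 ≤ m.
  shift-improves : Improves G u v m β
  shift-improves with any? (λ a → ¬? (a ≟ u) ×-dec ¬? (a ≟ w) ×-dec (adj G u a Bool.≟ true) ×-dec (adj G w a Bool.≟ true))
  ... | yes (a , au , aw , ua , wa) = record
    { graph = T′ ; base = edge′ ; linkage = linkage′ lk ; bounded = bdT ; cliques = shift-N is
    ; degrees = degrees′ ; good = λ good → Back.good-back bd good }
    where
    like : ShiftLike G T′ u v w
    like = record
      { far = far ; at-u = at-x ; at-w = λ p q _ → at-w p q ; keep = keep
      ; wv = λ e → trans (at-w (u≢v ∘ sym) (w≢v ∘ sym)) (∧-intro uv e)
      ; exit = a , au , aw , trans (at-w au aw) (∧-intro ua wa) }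
    open ShiftStep {m = m} like uv uw w≢v wz z≢u ¬uz conn
  ... | no none = record
    { graph = H ; base = edge′ ; linkage = linkage′ lk ; bounded = bdH
    ; cliques = λ s → ≤-trans (shift-N is s) (N-mono {G = T′} {H} (2 + s) (λ i j e → ∨-trueˡ _ e))
    ; degrees = degrees′ ; good = λ good → Back.good-back bd good }
    where
    H = plusEdge T′ w v w≢v
    off-w : ∀ {a b} → a ≢ w → b ≢ w → adj H a b ≡ adj T′ a b
    off-w aw bw = addEdge-off (adj T′) (λ (p , _) → aw p) (λ (_ , q) → bw q)
    off-v : ∀ {a} → a ≢ v → adj H w a ≡ adj T′ w a
    off-v av = addEdge-off (adj T′) (λ (_ , q) → av q) (λ (p , _) → w≢v p)
    only-v : ∀ {a} → a ≢ u → a ≢ v → ¬ Adj (adj H) w a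
    only-v {a} au av e with ∧-true (adj G u a) _ (trans (sym (at-w au (Adj-≢ {G = H} e ∘ sym))) (trans (sym (off-v av)) e))
    ... | ua , wa = none (a , au , (Adj-≢ {G = H} e ∘ sym) , ua , wa)
    like : ShiftLike G H u v w
    like = record
      { far = λ au aw bu bw → trans (off-w aw bw) (far au aw bu bw)
      ; at-u = λ au aw → trans (off-w u≢w aw) (at-x au aw)
      ; at-w = λ au aw av → trans (off-v av) (at-w au aw)
      ; keep = ∨-trueˡ _ keep
      ; wv = λ _ → addEdge-on (adj T′) w v
      ; exit = v , (u≢v ∘ sym) , (w≢v ∘ sym) , addEdge-on (adj T′) w v }
    open ShiftStep {H = H} {m = m} like uv uw w≢v wz z≢u ¬uz conn
    no-step : ∀ {q b} → Chain H w q b → All (λ a → a ≢ u × a ≢ v) q → q ≡ []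
    no-step (edge _) _ = refl
    no-step (e ∷ _) ((au , av) ∷ _) = ⊥-elim (only-v au av e)
    bdH : Bounded H u v (2 + m)
    bdH p c un@((_ ∷ pu) ∷ pv ∷ up) with mem? w p
    ... | no w∉p = bdT p (chain-map c (λ m m′ e → trans (sym (off-w (nw m) (nw m′))) e)) un
      where
      nw : ∀ {a} → a ∈ u ∷ v ∷ p → a ≢ w
      nw (here refl) = u≢w
      nw (there (here refl)) = w≢v ∘ sym
      nw (there (there m)) refl = w∉p m
    bdH p c un@((_ ∷ pu) ∷ pv ∷ up) | yes w∈p with ∈-∃++ w∈p
    ... | α , γ , refl with chain-split α c
    ...   | c₁ , c₂ = ≤-trans (≤-reflexive (cong (2 +_) (trans (length-++ α)
              (cong₂ (λ x y → x + suc y) (trans (sym (length-reverse α)) (cong length α≡)) (cong length γ≡)))))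
            (s≤s (s≤s 1≤m))
      where
      inner : All (λ a → a ≢ u × a ≢ v) (α ++ w ∷ γ)
      inner = All.zip (All.map (_∘ sym) pu , All.map (_∘ sym) pv)
      α≡ : reverse α ≡ []
      α≡ = no-step (chain-reverse c₁) (↭P.All-resp-↭ (↭-sym (↭P.↭-reverse α)) (AllP.++⁻ˡ α inner))
      γ≡ : γ ≡ []
      γ≡ = no-step c₂ (All.tail (AllP.++⁻ʳ α inner))

≡-or-≢ : ∀ {n} (x y : Fin n) → x ≡ y ⊎ x ≢ y
≡-or-≢ x y with x ≟ y
... | yes e = inj₁ e
... | no ne = inj₂ ne

-- If D is attached to the rest of the graph at u and w only, then D may be attached at u and v instead.
module Flip {n} (G : Graph n) (u v w : Fin n) (uv : Adj (adj G) u v) (uw : Adj (adj G) u w) (w≢v : w ≢ v)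
  (D : Fin n → Bool) (Du : D u ≡ false) (Dv : D v ≡ false) (Dw : D w ≡ false)
  (closed : ∀ {y z} → D y ≡ true → Adj (adj G) y z → z ≢ u → z ≢ w → D z ≡ true)
  where
  private
    u≢v = Adj-≢ {G = G} uv
    u≢w = Adj-≢ {G = G} uw

    D≢ : ∀ {a b} → D a ≡ true → D b ≡ false → a ≢ b
    D≢ p q refl = true≢false (trans (sym p) q)

    v-D : ∀ {a} → D a ≡ true → adj G v a ≡ false
    v-D da = ≢true (λ e → D≢ (closed da (Adj-sym {G = G} e) (u≢v ∘ sym) (w≢v ∘ sym)) Dv refl)

    data Place (i : Fin n) : Set where
      atv : i ≡ v → Place i
      atw : i ≡ w → Place i
      inD : D i ≡ true → Place i
      off : i ≢ v → i ≢ w → D i ≡ false → Place i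

    place : ∀ i → Place i
    place i with i ≟ v | i ≟ w | Bool-dec (D i)
    ... | yes p | _     | _      = atv p
    ... | no  _ | yes q | _      = atw q
    ... | no  _ | no  _ | inj₁ d = inD d
    ... | no  p | no  q | inj₂ d = off p q d

    entry : ∀ {i j} → Place i → Place j → Bool
    entry {i} {j} (atv _) (inD _) = adj G w j
    entry {i} {j} (atw _) (inD _) = false
    entry {i} {j} (inD _) (atv _) = adj G w i
    entry {i} {j} (inD _) (atw _) = false
    entry {i} {j} _ _ = adj G i j

    entry-sym : ∀ {i j} (p : Place i) (q : Place j) → entry p q ≡ entry q p
    entry-sym {i} {j} (atv _) (atv _) = adj-sym G i j
    entry-sym {i} {j} (atv _) (atw _) = adj-sym G i j
    entry-sym (atv _) (inD _) = refl
    entry-sym {i} {j} (atv _) (off _ _ _) = adj-sym G i j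
    entry-sym {i} {j} (atw _) (atv _) = adj-sym G i j
    entry-sym {i} {j} (atw _) (atw _) = adj-sym G i j
    entry-sym (atw _) (inD _) = refl
    entry-sym {i} {j} (atw _) (off _ _ _) = adj-sym G i j
    entry-sym (inD _) (atv _) = refl
    entry-sym (inD _) (atw _) = refl
    entry-sym {i} {j} (inD _) (inD _) = adj-sym G i j
    entry-sym {i} {j} (inD _) (off _ _ _) = adj-sym G i j
    entry-sym {i} {j} (off _ _ _) (atv _) = adj-sym G i j
    entry-sym {i} {j} (off _ _ _) (atw _) = adj-sym G i j
    entry-sym {i} {j} (off _ _ _) (inD _) = adj-sym G i j
    entry-sym {i} {j} (off _ _ _) (off _ _ _) = adj-sym G i j

    entry-irref : ∀ {i} (p : Place i) → entry p p ≡ false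
    entry-irref {i} (atv _) = irref G i
    entry-irref {i} (atw _) = irref G i
    entry-irref {i} (inD _) = irref G i
    entry-irref {i} (off _ _ _) = irref G i

  abstract
    flipped : Graph n
    flipped = record
      { adj   = λ i j → entry (place i) (place j)
      ; sym   = λ i j → entry-sym (place i) (place j)
      ; irref = λ i → entry-irref (place i) }

  private
    H = flipped

    abstract

      far : ∀ {a b} → a ≢ v → a ≢ w → b ≢ v → b ≢ w → adj H a b ≡ adj G a b
      far {a} {b} av aw bv bw with place a | place b
      ... | atv p | _ = ⊥-elim (av p)
      ... | atw p | _ = ⊥-elim (aw p)
      ... | inD _ | atv p = ⊥-elim (bv p)
      ... | inD _ | atw p = ⊥-elim (bw p)
      ... | inD _ | inD _ = refl
      ... | inD _ | off _ _ _ = refl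
      ... | off _ _ _ | atv p = ⊥-elim (bv p)
      ... | off _ _ _ | atw p = ⊥-elim (bw p)
      ... | off _ _ _ | inD _ = refl
      ... | off _ _ _ | off _ _ _ = refl

      same : ∀ {a b} → D a ≡ false → D b ≡ false → adj H a b ≡ adj G a b
      same {a} {b} da db with place a | place b
      ... | inD d | _ = ⊥-elim (D≢ d da refl)
      ... | atv _ | inD d = ⊥-elim (D≢ d db refl)
      ... | atw _ | inD d = ⊥-elim (D≢ d db refl)
      ... | off _ _ _ | inD d = ⊥-elim (D≢ d db refl)
      ... | atv _ | atv _ = refl
      ... | atv _ | atw _ = refl
      ... | atv _ | off _ _ _ = refl
      ... | atw _ | atv _ = refl
      ... | atw _ | atw _ = refl
      ... | atw _ | off _ _ _ = refl
      ... | off _ _ _ | atv _ = refl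
      ... | off _ _ _ | atw _ = refl
      ... | off _ _ _ | off _ _ _ = refl

      at-v : ∀ {a} → D a ≡ true → adj H v a ≡ adj G w a
      at-v {a} da with place v | place a
      ... | atv _ | inD _ = refl
      ... | atv _ | atv p = ⊥-elim (D≢ da Dv p)
      ... | atv _ | atw p = ⊥-elim (D≢ da Dw p)
      ... | atv _ | off _ _ d = ⊥-elim (D≢ da d refl)
      ... | atw p | _ = ⊥-elim (w≢v (sym p))
      ... | inD d | _ = ⊥-elim (D≢ d Dv refl)
      ... | off p _ _ | _ = ⊥-elim (p refl)

      at-w : ∀ {a} → D a ≡ true → adj H w a ≡ false
      at-w {a} da with place w | place a
      ... | atw _ | inD _ = refl
      ... | atw _ | atv p = ⊥-elim (D≢ da Dv p)
      ... | atw _ | atw p = ⊥-elim (D≢ da Dw p)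
      ... | atw _ | off _ _ d = ⊥-elim (D≢ da d refl)
      ... | atv p | _ = ⊥-elim (w≢v p)
      ... | inD d | _ = ⊥-elim (D≢ d Dw refl)
      ... | off _ p _ | _ = ⊥-elim (p refl)

      no-v : ∀ {a b} → a ≢ v → b ≢ v → Adj (adj H) a b → Adj (adj G) a b
      no-v {a} {b} av bv e with place a | place b
      ... | atv p | _ = ⊥-elim (av p)
      ... | atw _ | atv p = ⊥-elim (bv p)
      ... | atw _ | atw _ = e
      ... | atw _ | off _ _ _ = e
      ... | inD _ | atv p = ⊥-elim (bv p)
      ... | inD _ | inD _ = e
      ... | inD _ | off _ _ _ = e
      ... | off _ _ _ | atv p = ⊥-elim (bv p)
      ... | off _ _ _ | atw _ = e
      ... | off _ _ _ | inD _ = e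
      ... | off _ _ _ | off _ _ _ = e

    far-D : ∀ {a b} → D a ≡ true → b ≢ v → b ≢ w → adj H a b ≡ adj G a b
    far-D da = far (D≢ da Dv) (D≢ da Dw)

    P : Fin n → Set
    P a = a ≢ u × a ≢ w

    Pv : P v
    Pv = (u≢v ∘ sym) , (w≢v ∘ sym)

    To-outside : ∀ {a} → To G P v a → D a ≡ false
    To-outside stop = Dv
    To-outside (go {a} {b} pa e r) = ≢true (λ da → D≢ (closed da e (proj₁ (To-P Pv r)) (proj₂ (To-P Pv r))) (To-outside r) refl)

  module _ {y₀} (Dy₀ : D y₀ ≡ true) (conn : ∀ y → D y ≡ false → y ≢ u → y ≢ w → To G P v y) (lk : Linkage G u v) where
    private
      -- A walk that avoids u can leave D only through w, so on its way to v it has to leave D and w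
      -- by an edge at w.
      find-exit : ∀ {a} → Esc G u v u a → a ≡ w ⊎ D a ≡ true → ∃ λ b → D b ≡ false × b ≢ u × Adj (adj G) w b
      find-exit (stop t≢u (inj₁ t≡u)) _ = ⊥-elim (t≢u t≡u)
      find-exit (stop _ (inj₂ refl)) (inj₁ v≡w) = ⊥-elim (w≢v (sym v≡w))
      find-exit (stop _ (inj₂ refl)) (inj₂ d) = ⊥-elim (D≢ d Dv refl)
      find-exit (go {a} {b} _ e r) (inj₁ refl) with Bool-dec (D b)
      ... | inj₁ db = find-exit r (inj₂ db)
      ... | inj₂ db = b , db , Esc-≢ r , e
      find-exit (go {a} {b} _ e r) (inj₂ da) with b ≟ w
      ... | yes b≡w = find-exit r (inj₁ b≡w)
      ... | no b≢w  = find-exit r (inj₂ (closed da e (Esc-≢ r) b≢w))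

      find-entry : ∀ {a} → Esc G u v u a → D a ≡ true → ∃ λ d → D d ≡ true × Adj (adj G) w d
      find-entry (stop t≢u (inj₁ t≡u)) _ = ⊥-elim (t≢u t≡u)
      find-entry (stop _ (inj₂ refl)) d = ⊥-elim (D≢ d Dv refl)
      find-entry (go {a} {b} _ e r) da with b ≟ w
      ... | yes refl = a , da , Adj-sym {G = G} e
      ... | no b≢w  = find-entry r (closed da e (Esc-≢ r) b≢w)

      out : ∃ λ b → D b ≡ false × b ≢ u × Adj (adj G) w b
      out = find-exit (lk u w (u≢w ∘ sym)) (inj₁ refl)

      into : ∃ λ d → D d ≡ true × Adj (adj G) w d
      into = find-entry (lk u y₀ (D≢ Dy₀ Du)) Dy₀

      H-u : ∀ {a} → D a ≡ true → Adj (adj G) a u → Adj (adj H) a u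
      H-u da e = trans (far-D da u≢v u≢w) e

      H-uv : Adj (adj H) u v
      H-uv = trans (same Du Dv) uv

      outside-esc : ∀ {x a} → x ≡ u ⊎ x ≡ w → To G P v a → Esc H u v x a
      outside-esc x stop = stop ([ (λ { refl → u≢v ∘ sym }) , (λ { refl → w≢v ∘ sym }) ]′ x) (inj₂ refl)
      outside-esc x t@(go (au , aw) e r) = go ([ (λ { refl → au }) , (λ { refl → aw }) ]′ x)
        (trans (same (To-outside t) (To-outside r)) e) (outside-esc x r)

      -- A walk in G that avoids w can leave D only at u. The edges it uses up to there are
      -- untouched, and none of its vertices is x.
      D-to-u : ∀ {x a} → D x ≡ false → x ≢ u → D a ≡ true → Esc G u v w a → Esc H u v x a
      D-to-u dx xu da (stop _ (inj₁ refl)) = ⊥-elim (D≢ da Du refl)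
      D-to-u dx xu da (stop _ (inj₂ refl)) = ⊥-elim (D≢ da Dv refl)
      D-to-u dx xu da (go {a} {b} _ e r) with b ≟ u
      ... | yes refl = go (D≢ da dx) (H-u da e) (stop (xu ∘ sym) (inj₁ refl))
      ... | no bu = go (D≢ da dx) (trans (far-D da (D≢ db Dv) (D≢ db Dw)) e) (D-to-u dx xu db r)
        where db = closed da e bu (Esc-≢ r)

      D-out : ∀ {x a} → x ≢ v → D a ≡ true → Esc G u v x a → Esc H u v x a
      D-out xv da (stop _ (inj₁ refl)) = ⊥-elim (D≢ da Du refl)
      D-out xv da (stop _ (inj₂ refl)) = ⊥-elim (D≢ da Dv refl)
      D-out xv da (go {a} {b} ax e r) with b ≟ u | b ≟ w
      ... | yes refl | _ = go ax (H-u da e) (stop (Esc-≢ r) (inj₁ refl))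
      ... | no _ | yes refl = go ax (Adj-sym {G = H} (trans (at-v da) (Adj-sym {G = G} e))) (stop (xv ∘ sym) (inj₂ refl))
      ... | no bu | no bw = go ax (trans (far-D da (D≢ db Dv) bw) e) (D-out xv db r)
        where db = closed da e bu bw

      outside-any : ∀ {x a} → x ≢ u → D a ≡ false → Esc G u v x a → Esc H u v x a
      outside-any xu da (stop p t) = stop p t
      outside-any xu da (go {a} {b} ax e r) with a ≟ u | a ≟ w
      ... | yes refl | _ = stop ax (inj₁ refl)
      ... | no _ | yes refl = go ax (trans (same Dw Du) (Adj-sym {G = G} uw)) (stop (xu ∘ sym) (inj₁ refl))
      ... | no au | no aw = go ax (trans (same da db) e) (outside-any xu db r)
        where
        db : D b ≡ false
        db = ≢true (λ d → D≢ (closed d (Adj-sym {G = G} e) au aw) da refl)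

      linkageH : Linkage H u v
      linkageH x a ax with Bool-dec (D a) | Bool-dec (D x) | x ≟ u | x ≟ w
      ... | inj₁ da | _       | yes refl | _ = D-out u≢v da (lk u a ax)
      ... | inj₁ da | inj₁ dx | no _ | _ = D-out (D≢ dx Dv) da (lk x a ax)
      ... | inj₁ da | inj₂ dx | no xu | _ = D-to-u dx xu da (lk w a (D≢ da Dw))
      ... | inj₂ da | _ | no xu | no xw = outside-any xu da (lk x a ax)
      ... | inj₂ da | _ | no xu | yes refl with a ≟ u
      ...   | yes refl = stop ax (inj₁ refl)
      ...   | no au = outside-esc (inj₂ refl) (conn a da au ax)
      linkageH x a ax | inj₂ da | _ | yes refl | _ with a ≟ w
      ...   | no aw = outside-esc (inj₁ refl) (conn a da ax aw)
      ...   | yes refl with out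
      ...     | b , db , bu , wb = go ax (trans (same Dw db) wb)
                  (outside-esc (inj₁ refl) (conn b db bu (Adj-≢ {G = G} wb ∘ sym)))

      Free : Fin n → Set
      Free a = D a ≡ false × a ≢ u × a ≢ v × a ≢ w

      -- This is the detour that G must take where H steps from v directly into D; it makes the
      -- G-path longer than the H-path.
      v-to-w : ∃ λ q → Chain G v q w × Unique q × All Free q
      v-to-w with out
      ... | b , db , bu , wb with b ≟ v
      ...   | yes refl = [] , edge (Adj-sym {G = G} wb) , [] , []
      ...   | no bv with To-simple {P = λ a → P a × D a ≡ false} (enrich (conn b db bu (Adj-≢ {G = G} wb ∘ sym))) bv
        where
        enrich : ∀ {a} → To G P v a → To G (λ a → P a × D a ≡ false) v a
        enrich stop = stop
        enrich t@(go pa e r) = go (pa , To-outside t) e (enrich r)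
      ...     | p , c , (_ ∷ b∉p) ∷ v∉p ∷ up , pb ∷ pp = reverse (b ∷ p)
                , chain-reverse (wb ∷ c) , Unique-resp-↭ (↭-sym (↭P.↭-reverse (b ∷ p))) (b∉p ∷ up)
                , ↭P.All-resp-↭ (↭-sym (↭P.↭-reverse (b ∷ p)))
                    (All.zipWith (λ (((a₁ , a₂) , d) , nv) → d , a₁ , (nv ∘ sym) , a₂) (pb ∷ pp , (bv ∘ sym) ∷ v∉p))

    module _ {m : ℕ} (bd′ : Bounded G u v (2 + m)) where
      private
        bd = Bounded-sym bd′

        through : ∀ {q b p} → Chain G v q w → Unique q → All Free q →
          Adj (adj G) w b → Chain G b p u → All (λ a → D a ≡ true) (b ∷ p) → Unique (b ∷ p) → length q + suc (suc (length p)) ≤ m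
        through {q} {b} {p} c uq fq wb d dp up = s≤s⁻¹ (s≤s⁻¹ (subst (λ l → 2 + l ≤ 2 + m) (length-++ q)
          (bd (q ++ w ∷ b ∷ p) (chain-++ c (wb ∷ d))
            (((u≢v ∘ sym) ∷ AllP.++⁺ (All.map (λ (_ , _ , f , _) → f ∘ sym) fq) ((w≢v ∘ sym) ∷ All.map (λ d e → D≢ d Dv (sym e)) dp))
             ∷ AllP.++⁺ (All.map (λ (_ , f , _ , _) → f ∘ sym) fq) (u≢w ∷ All.map (λ d e → D≢ d Du (sym e)) dp)
             ∷ UniqueP.++⁺ uq (All.map (λ d e → D≢ d Dw (sym e)) dp ∷ up) (λ (m₁ , m₂) → apart m₁ m₂)))))
          where
          apart : ∀ {a} → a ∈ q → a ∈ w ∷ b ∷ p → ⊥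
          apart m₁ (here refl) = proj₂ (proj₂ (proj₂ (All.lookup fq m₁))) refl
          apart m₁ (there m₂) = D≢ (All.lookup dp m₂) (proj₁ (All.lookup fq m₁)) refl

        all-D : ∀ {b p} → Chain H b p u → D b ≡ true → u ∉ p → v ∉ p → All (λ a → D a ≡ true) p
        all-D (edge _) db up vp = []
        all-D {b} (_∷_ {z = z} e c) db up vp = dz ∷ all-D c dz (up ∘ there) (vp ∘ there)
          where
          dz : D z ≡ true
          dz = closed db (no-v (D≢ db Dv) (λ { refl → vp (here refl) }) e) (λ { refl → up (here refl) })
            (λ { refl → true≢false (trans (sym (Adj-sym {G = H} e)) (at-w db)) })

        no-v-chain : ∀ {b p} → b ≢ v → v ∉ p → Chain H b p u → Chain G b p u
        no-v-chain {b} {p} bv vp c = chain-map c (λ m₁ m₂ → no-v (nv m₁) (nv m₂))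
          where
          nv : ∀ {a} → a ∈ b ∷ u ∷ p → a ≢ v
          nv (here refl) = bv
          nv (there (here refl)) = u≢v
          nv (there (there m)) refl = vp m

        -- The path is read from v, since every new edge is at v. If its first interior vertex lies
        -- outside D, it is a path of G. Otherwise it stays in D until u, as D has no H-edge to w,
        -- and in G it can be entered from v through w.
        boundedH : Bounded H v u (2 + m)
        boundedH [] c un = s≤s (s≤s z≤n)
        boundedH (b ∷ p) (e ∷ c) un@((_ ∷ v≢b ∷ vp) ∷ (u≢b ∷ up) ∷ b∉p ∷ uq) = by-side (Bool-dec (D b))
          where
          by-side : D b ≡ true ⊎ D b ≡ false → 2 + length (b ∷ p) ≤ 2 + m
          by-side (inj₂ db) = bd (b ∷ p) (trans (sym (same Dv db)) e ∷ no-v-chain (v≢b ∘ sym) (All≢⇒∉ vp) c) un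
          by-side (inj₁ db) with v-to-w
          ... | q , cq , uq′ , fq = s≤s (s≤s (≤-trans (≤-trans (n≤1+n _) (m≤n+m _ (length q)))
              (through cq uq′ fq (trans (sym (at-v db)) e) (no-v-chain (v≢b ∘ sym) (All≢⇒∉ vp) c)
                (db ∷ all-D c db (All≢⇒∉ up) (All≢⇒∉ vp)) (b∉p ∷ uq))))

        module Back {β} (good : Good H u v m β) where
          open Good good
          open GoodClasses good

          -- The class of d is a clique of H and w has no H-neighbour in D, so the whole class lies
          -- in D. In G it can be preceded by w and a path from v, which gives more than m interior
          -- vertices.
          D-label : ∀ {d} → D d ≡ true → label d < β → ⊥
          D-label {d} dd lt with v-to-w
          ... | q , cq , uq , fq = <-irrefl refl (≤-trans (m≤n+m _ (length q))
              (subst (λ l → length q + suc l ≤ m) A.length≡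
                (through cq uq fq (to-w id-d dd lt)
                  (clique-chain A.rest (to-u id-d dd lt) (λ m′ → no-v (proj₂ id-d) (proj₂ (A.inner m′)) (edge-d m′))
                    (λ m′ → to-u (A.inner m′) (in-D m′) (lt′ m′))
                    (λ m₁ m₂ ne → no-v (proj₂ (A.inner m₁)) (proj₂ (A.inner m₂))
                      (clique (A.inner m₁) (A.inner m₂) ne (trans (A.same m₁) (sym (A.same m₂))) (lt′ m₁))) A.simple)
                  (dd ∷ All.tabulate in-D) (∉⇒All≢ A.new ∷ A.simple))))
            where
            id-d : Inner u v d
            id-d = D≢ dd Du , D≢ dd Dv
            module A = ClassRest (class-rest id-d lt)
            lt′ : ∀ {a} → a ∈ A.rest → label a < β
            lt′ m′ = subst (_< β) (sym (A.same m′)) lt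
            edge-d : ∀ {a} → a ∈ A.rest → Adj (adj H) d a
            edge-d m′ = clique id-d (A.inner m′) (A.other m′ ∘ sym) (sym (A.same m′)) lt
            in-D : ∀ {a} → a ∈ A.rest → D a ≡ true
            in-D m′ = closed dd (no-v (proj₂ id-d) (proj₂ (A.inner m′)) (edge-d m′)) (proj₁ (A.inner m′))
              (λ { refl → true≢false (trans (sym (Adj-sym {G = H} (edge-d m′))) (at-w dd)) })
            to-w : ∀ {a} → Inner u v a → D a ≡ true → label a < β → Adj (adj G) w a
            to-w ia da l = trans (sym (at-v da)) (proj₂ (joined ia l))
            to-u : ∀ {a} → Inner u v a → D a ≡ true → label a < β → Adj (adj G) a u
            to-u ia da l = no-v (proj₂ ia) u≢v (Adj-sym {G = H} (proj₁ (joined ia l)))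

          iw : Inner u v w
          iw = (u≢w ∘ sym) , w≢v

          outside-D : ∀ {a} → label a < β → D a ≡ false
          outside-D lt = ≢true (λ d → D-label d lt)

          -- From v through the other m - 1 members of the class to w, then through at least one
          -- vertex of D to u: that is at least m + 1 interior vertices.
          w-label : label w < β → ⊥
          w-label lt with into
          ... | d , dd , wd with To-simple {P = λ a → D a ≡ true} (within dd (lk w d (D≢ dd Dw))) (D≢ dd Du)
            where
            within : ∀ {a} → D a ≡ true → Esc G u v w a → To G (λ a → D a ≡ true) u a
            within da (stop _ (inj₁ refl)) = stop
            within da (stop _ (inj₂ refl)) = ⊥-elim (D≢ da Dv refl)
            within da (go {a} {b} _ e r) with b ≟ u
            ... | yes refl = go da e stop
            ... | no bu = go da e (within (closed da e bu (Esc-≢ r)) r)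
          ...   | p , c , (_ ∷ d∉p) ∷ _ ∷ up , dp = <-irrefl refl (≤-trans
                (≤-trans (≤-reflexive (cong suc (sym A.length≡))) (≤-trans (≤-reflexive (+-comm 2 (length A.rest))) (+-monoʳ-≤ (length A.rest) (s≤s (s≤s z≤n)))))
                (through (clique-chain A.rest (v-to Dw iw lt) (λ m′ → v-to (outside-D (lt′ m′)) (A.inner m′) (lt′ m′))
                    (λ m′ → no-v (proj₂ (A.inner m′)) w≢v (clique (A.inner m′) iw (A.other m′) (A.same m′) (lt′ m′)))
                    (λ m₁ m₂ ne → no-v (proj₂ (A.inner m₁)) (proj₂ (A.inner m₂))
                      (clique (A.inner m₁) (A.inner m₂) ne (trans (A.same m₁) (sym (A.same m₂))) (lt′ m₁))) A.simple)
                  A.simple (All.tabulate (λ m′ → outside-D (lt′ m′) , proj₁ (A.inner m′) , proj₂ (A.inner m′) , A.other m′))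
                  wd c dp (d∉p ∷ up)))
            where
            module A = ClassRest (class-rest iw lt)
            lt′ : ∀ {a} → a ∈ A.rest → label a < β
            lt′ m′ = subst (_< β) (sym (A.same m′)) lt
            v-to : ∀ {a} → D a ≡ false → Inner u v a → label a < β → Adj (adj G) v a
            v-to da ia l = trans (sym (same Dv da)) (proj₂ (joined ia l))

          last-label : ∀ {x} → ¬ label x < β → label x ≡ β
          last-label {x} nl = ≤-antisym (label≤ x) (≮⇒≥ nl)

          w-edge : ∀ {y} → Inner u v y → Adj (adj G) w y → label w ≡ label y
          w-edge {y} iy e with Bool-dec (D y)
          ... | inj₁ dy = trans (last-label w-label) (sym (last-label (D-label dy)))
          ... | inj₂ dy = nocross iw iy (trans (same Dw dy) e)

          good-back : Good G u v m β
          good-back = record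
            { label = label ; label≤ = label≤ ; size = size
            ; nocross = nocross′
            ; clique = λ ix iy ne l lt → no-v (proj₂ ix) (proj₂ iy) (clique ix iy ne l lt)
            ; joined = λ ix lt → no-v u≢v (proj₂ ix) (proj₁ (joined ix lt))
                               , trans (sym (same Dv (outside-D lt))) (proj₂ (joined ix lt)) }
            where
            nocross′ : ∀ {x y} → Inner u v x → Inner u v y → Adj (adj G) x y → label x ≡ label y
            nocross′ {x} {y} ix iy e with x ≟ w | y ≟ w
            ... | yes refl | _ = w-edge iy e
            ... | no _ | yes refl = sym (w-edge ix (Adj-sym {G = G} e))
            ... | no xw | no yw = nocross ix iy (trans (far (proj₂ ix) xw (proj₂ iy) yw) e)

      -- Let Q be the part of N(w) in D together with u, and Z the part of N(w) outside D.
      -- Separating N(w) into Q and Z loses nothing by `K-submodular`, as D has no edge to Z other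
      -- than to u; uniting Q with N(v) is covered by `K-supermodular`. The overlaps of Q with Z and
      -- of N(v) with Q are both {u}, so they cancel.
      cliquesH : ∀ s → N (2 + s) G ≤ N (2 + s) H
      cliquesH s with enumerate₂ {x = v} {w} (w≢v ∘ sym)
      ... | l , τ , v∉l , w∉l = N-≤ {G = G} {H} (2 + s) τ (go′ (Bool-dec (aG v w)))
        where
        aG = adj G
        aH = adj H
        Q Z : Fin n → Bool
        Q y = (D y ∨ ⌊ y ≟ u ⌋) ∧ aG w y
        Z y = not (D y) ∧ aG w y
        k : ℕ → (Fin n → Bool) → ℕ
        k s R = K aG s (filterᵇ R l)
        nv : ∀ {y} → y ∈ l → y ≢ v
        nv m refl = v∉l m
        nw : ∀ {y} → y ∈ l → y ≢ w
        nw m refl = w∉l m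
        edges : ∀ s {xs ys} → xs ⊆ ys → (∀ {y} → y ∈ xs → y ∈ l) → K aG s xs ≤ K aH s ys
        edges s τ sub = K-mono s τ (λ m m′ e → trans (far (nv (sub m)) (nw (sub m)) (nv (sub m′)) (nw (sub m′))) e)
        filtered : ∀ s {R R′ : Fin n → Bool} → (∀ {y} → y ∈ l → R y ≡ true → R′ y ≡ true) → k s R ≤ K aH s (filterᵇ R′ l)
        filtered s {R} {R′} h = edges s (filterᵇ-⊆ {p = R} {q = R′} (⊆-refl {x = l}) h) (λ m → proj₁ (∈-filterᵇ⁻ R l m))
        Hv : ∀ {y} → Adj aG v y → Adj aH v y
        Hv {y} e = trans (same Dv (≢true (λ d → true≢false (trans (sym e) (v-D d))))) e
        Hw : ∀ {y} → Adj aG w y → D y ≡ false → Adj aH w y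
        Hw e dy = trans (same Dw dy) e
        PQ⇒u : ∀ {y} → aG v y ∧ Q y ≡ true → y ≡ u
        PQ⇒u {y} e with ∧-true (aG v y) _ e
        ... | vy , q with ∨-true (D y) _ (proj₁ (∧-true (D y ∨ ⌊ y ≟ u ⌋) _ q))
        ...   | inj₁ d = ⊥-elim (true≢false (trans (sym vy) (v-D d)))
        ...   | inj₂ e′ = ⌊⌋-true (y ≟ u) e′
        Qu : Q u ≡ true
        Qu = ∧-intro (∨-trueʳ (D u) (⌊⌋-intro (u ≟ u) refl)) (Adj-sym {G = G} uw)
        core : ∀ s → k s (aG v) + k s (aG w) ≤ K aH s (filterᵇ (aH v) l) + K aH s (filterᵇ (aH w) l)
        core s = ≤-trans (+-cancelʳ-≤ (k s (λ y → Q y ∧ Z y)) _ _ (begin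
          (k s (aG v) + k s (aG w)) + k s (λ y → Q y ∧ Z y)
            ≡⟨ +-assoc (k s (aG v)) _ _ ⟩
          k s (aG v) + (k s (aG w) + k s (λ y → Q y ∧ Z y))
            ≡⟨ cong (λ z → k s (aG v) + (K aG s z + k s (λ y → Q y ∧ Z y))) (filterᵇ-cong l (λ {y} _ → split y)) ⟩
          k s (aG v) + (k s (λ y → Q y ∨ Z y) + k s (λ y → Q y ∧ Z y))
            ≤⟨ +-monoʳ-≤ (k s (aG v)) (K-submodular aG s l Q Z no₁ no₂) ⟩
          k s (aG v) + (k s Q + k s Z)
            ≡⟨ sym (+-assoc (k s (aG v)) _ _) ⟩
          (k s (aG v) + k s Q) + k s Z
            ≤⟨ +-monoˡ-≤ (k s Z) (K-supermodular aG s l (aG v) Q) ⟩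
          (k s (λ y → aG v y ∨ Q y) + k s (λ y → aG v y ∧ Q y)) + k s Z
            ≡⟨ +-right-swap (k s (λ y → aG v y ∨ Q y)) _ _ ⟩
          (k s (λ y → aG v y ∨ Q y) + k s Z) + k s (λ y → aG v y ∧ Q y)
            ≡⟨ cong (λ z → (k s (λ y → aG v y ∨ Q y) + k s Z) + K aG s z) (filterᵇ-cong l (λ _ → bool-≡ PQ⇒QZ QZ⇒PQ)) ⟩
          (k s (λ y → aG v y ∨ Q y) + k s Z) + k s (λ y → Q y ∧ Z y) ∎))
          (+-mono-≤ (filtered s (λ _ → P∨Q⇒)) (filtered s (λ _ → Z⇒)))
          where
          open ≤-Reasoning
          split : ∀ y → aG w y ≡ Q y ∨ Z y
          split y with D y | aG w y
          ... | true  | true = refl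
          ... | true  | false = refl
          ... | false | false = sym (∨-trueʳ′ (⌊ y ≟ u ⌋ ∧ false) (∧-false ⌊ y ≟ u ⌋))
            where
            ∧-false : ∀ b → b ∧ false ≡ false
            ∧-false true = refl
            ∧-false false = refl
            ∨-trueʳ′ : ∀ b → b ≡ false → b ∨ false ≡ false
            ∨-trueʳ′ _ refl = refl
          ... | false | true = sym (∨-trueʳ (⌊ y ≟ u ⌋ ∧ true) refl)
          Q∖Z : ∀ {y} → Q y ≡ true → Z y ≡ false → D y ≡ true
          Q∖Z {y} q z with D y | aG w y
          ... | true  | _ = refl
          ... | false | true = ⊥-elim (true≢false z)
          ... | false | false = ⊥-elim (true≢false (trans (sym (proj₂ (∧-true ⌊ y ≟ u ⌋ false q))) refl))
          Z⇒¬D : ∀ {y} → Z y ≡ true → D y ≡ false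
          Z⇒¬D {y} z = not-true (proj₁ (∧-true (not (D y)) _ z))
          no₁ : NoCrossing aG l Q Z
          no₁ {x} {y} mx my e qx zx zy with ≡-or-≢ y u
          ... | inj₁ refl = Qu
          ... | inj₂ yu = ⊥-elim (D≢ (closed (Q∖Z {x} qx zx) e yu (nw my)) (Z⇒¬D {y} zy) refl)
          no₂ : NoCrossing aG l Z Q
          no₂ {x} {y} mx my e zx qx qy with Bool-dec (D y)
          ... | inj₂ dy = ∧-intro (cong not dy) (proj₂ (∧-true (D y ∨ ⌊ y ≟ u ⌋) _ qy))
          ... | inj₁ dy with ≡-or-≢ x u
          ...   | inj₁ refl = ⊥-elim (true≢false (trans (sym Qu) qx))
          ...   | inj₂ xu = ⊥-elim (D≢ (closed dy (Adj-sym {G = G} e) xu (nw mx)) (Z⇒¬D {x} zx) refl)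
          PQ⇒QZ : ∀ {y} → aG v y ∧ Q y ≡ true → Q y ∧ Z y ≡ true
          PQ⇒QZ {y} e with PQ⇒u {y} e
          ... | refl = ∧-intro Qu (∧-intro (cong not Du) (Adj-sym {G = G} uw))
          QZ⇒PQ : ∀ {y} → Q y ∧ Z y ≡ true → aG v y ∧ Q y ≡ true
          QZ⇒PQ {y} e with ∧-true (Q y) _ e
          ... | q , z with ∨-true (D y) _ (proj₁ (∧-true (D y ∨ ⌊ y ≟ u ⌋) _ q))
          ...   | inj₁ d = ⊥-elim (D≢ d (Z⇒¬D {y} z) refl)
          ...   | inj₂ e′ with ⌊⌋-true (y ≟ u) e′
          ...     | refl = ∧-intro (Adj-sym {G = G} uv) q
          P∨Q⇒ : ∀ {y} → aG v y ∨ Q y ≡ true → aH v y ≡ true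
          P∨Q⇒ {y} e with ∨-true (aG v y) _ e
          ... | inj₁ vy = Hv vy
          ... | inj₂ q with ∧-true (D y ∨ ⌊ y ≟ u ⌋) _ q
          ...   | r , wy with ∨-true (D y) _ r
          ...     | inj₁ d = trans (at-v d) wy
          ...     | inj₂ e′ with ⌊⌋-true (y ≟ u) e′
          ...       | refl = Hv (Adj-sym {G = G} uv)
          Z⇒ : ∀ {y} → Z y ≡ true → aH w y ≡ true
          Z⇒ {y} z = Hw (proj₂ (∧-true (not (D y)) _ z)) (Z⇒¬D {y} z)
        common : k s (λ y → aG v y ∧ aG w y) ≤ K aH s (filterᵇ (λ y → aH v y ∧ aH w y) l)
        common = filtered s {λ y → aG v y ∧ aG w y} {λ y → aH v y ∧ aH w y} (λ {y} _ e → let (vy , wy) = ∧-true (aG v y) _ e in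
          ∧-intro (Hv vy) (Hw wy (≢true (λ d → true≢false (trans (sym vy) (v-D d))))))
        base : K aG (2 + s) l ≤ K aH (2 + s) l
        base = edges (2 + s) (⊆-refl {x = l}) id
        apart : ∀ (a : Fin n → Fin n → Bool) → a v w ≡ false →
          K a (2 + s) (v ∷ w ∷ l) ≡ K a (2 + s) l + (K a (1 + s) (filterᵇ (a v) l) + K a (1 + s) (filterᵇ (a w) l))
        apart a e rewrite e = trans (+-right-swap (K a (2 + s) l) _ _) (+-assoc (K a (2 + s) l) _ _)
        go′ : aG v w ≡ true ⊎ aG v w ≡ false → K aG (2 + s) (v ∷ w ∷ l) ≤ K aH (2 + s) (v ∷ w ∷ l)
        go′ (inj₁ e) = subst₂ _≤_ (sym (K-first-two aG s v w l e)) (sym (K-first-two aH s v w l (trans (same Dv Dw) e)))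
          (+-mono-≤ (+-mono-≤ base common) (core (suc s)))
        go′ (inj₂ e) = subst₂ _≤_ (sym (apart aG e)) (sym (apart aH (trans (same Dv Dw) e)))
          (+-mono-≤ base (core (suc s)))

      flip-improves : ∀ {β} → Improves G u v m β
      flip-improves = record
        { graph = H ; base = H-uv ; linkage = linkageH ; bounded = Bounded-sym boundedH ; cliques = cliquesH
        ; degrees = +-mono-≤-< (count-≤ (adj G u) (adj H u) (allFin n) grow-u)
            (count-< (adj G v) (adj H v) (allFin n) grow-v (∈-allFin (proj₁ into)) (v-D (proj₁ (proj₂ into)))
              (trans (at-v (proj₁ (proj₂ into))) (proj₂ (proj₂ into))))
        ; good = Back.good-back }
        where
        grow-u : ∀ y → adj G u y ≡ true → adj H u y ≡ true
        grow-u y e = [ (λ d → Adj-sym {G = H} (H-u d (Adj-sym {G = G} e))) , (λ d → trans (same Du d) e) ]′ (Bool-dec (D y))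
        grow-v : ∀ y → adj G v y ≡ true → adj H v y ≡ true
        grow-v y e = trans (same Dv (≢true (λ d → true≢false (trans (sym e) (v-D d))))) e

-- Making both terminals dominating, then compressing

module _ {n} {G : Graph n} {u v : Fin n} {m β : ℕ} (1≤m : 1 ≤ m)
  (uv : Adj (adj G) u v) (lk : Linkage G u v) (bd : Bounded G u v (2 + m)) where

  -- The vertices separated from v by {u , w} are moved from w to v; if there are none, w is compressed into u.
  improve : ∀ {w z} → Adj (adj G) u w → w ≢ v → Adj (adj G) w z → z ≢ u → ¬ Adj (adj G) u z → Improves G u v m β
  improve {w} {z} uw w≢v wz z≢u ¬uz = by-cases (any? (λ y → D y Bool.≟ true))
    where
    u≢v = Adj-≢ {G = G} uv
    P : Fin n → Set
    P a = a ≢ u × a ≢ w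
    cl : Closure G P v
    cl = closure G (λ a → ¬? (a ≟ u) ×-dec ¬? (a ≟ w)) v
    open Closure cl
    D : Fin n → Bool
    D y = not (R y) ∧ (not ⌊ y ≟ u ⌋ ∧ not ⌊ y ≟ w ⌋)
    D-intro : ∀ {y} → R y ≡ false → y ≢ u → y ≢ w → D y ≡ true
    D-intro {y} r yu yw = ∧-intro (cong not r) (∧-intro (cong not (⌊⌋-false (y ≟ u) yu)) (cong not (⌊⌋-false (y ≟ w) yw)))
    D-elim : ∀ {y} → D y ≡ true → R y ≡ false × P y
    D-elim {y} d with ∧-true (not (R y)) _ d
    ... | r , i = not-true r , innerᵇ⁻ {u = u} {v = w} {x = y} i
    conn : ∀ y → D y ≡ false → y ≢ u → y ≢ w → To G P v y
    conn y d yu yw with Bool-dec (R y)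
    ... | inj₁ r = reach y r
    ... | inj₂ r = ⊥-elim (true≢false (trans (sym (D-intro r yu yw)) d))
    by-cases : Dec (∃ λ y → D y ≡ true) → Improves G u v m β
    by-cases (no none) = shift-improves 1≤m uv uw w≢v wz z≢u ¬uz (λ y → conn y (≢true (λ d → none (y , d)))) lk bd
    by-cases (yes (y , d)) = Flip.flip-improves G u v w uv uw w≢v D
      (≢true (λ d → proj₁ (proj₂ (D-elim d)) refl))
      (≢true (λ d → true≢false (trans (sym source) (proj₁ (D-elim d)))))
      (≢true (λ d → proj₂ (proj₂ (D-elim d)) refl))
      (λ {a} {b} da e bu bw → let (r , pa) = D-elim da in
        D-intro (≢true (λ rb → true≢false (trans (sym (closed rb e pa)) r))) bu bw)
      d conn lk bd

  -- If no neighbour w ≠ v of u has a neighbour outside N[u], then a walk avoiding v that ends at u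
  -- lies entirely in N[u]. By 2-connectedness such a walk starts at each vertex other than v.
  improve-or-dominates : Improves G u v m β ⊎ (∀ x → x ≢ u → Adj (adj G) u x)
  improve-or-dominates with any? (λ w → any? (λ z →
      (adj G u w Bool.≟ true) ×-dec ¬? (w ≟ v) ×-dec (adj G w z Bool.≟ true) ×-dec ¬? (z ≟ u) ×-dec ¬? (adj G u z Bool.≟ true)))
  ... | yes (w , z , uw , w≢v , wz , z≢u , ¬uz) = inj₁ (improve uw w≢v wz z≢u ¬uz)
  ... | no none = inj₂ dominates
    where
    close : ∀ {a} → Esc G u v v a → a ≡ u ⊎ Adj (adj G) u a
    close (stop _ (inj₁ t≡u)) = inj₁ t≡u
    close (stop t≢v (inj₂ t≡v)) = ⊥-elim (t≢v t≡v)
    close (go {a} {b} _ e r) with a ≟ u | close r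
    ... | yes a≡u | _ = inj₁ a≡u
    ... | no _ | inj₁ refl = inj₂ (Adj-sym {G = G} e)
    ... | no a≢u | inj₂ ub with adj G u a Bool.≟ true
    ...   | yes ua = inj₂ ua
    ...   | no ¬ua = ⊥-elim (none (b , a , ub , Esc-≢ r , Adj-sym {G = G} e , a≢u , ¬ua))
    dominates : ∀ x → x ≢ u → Adj (adj G) u x
    dominates x x≢u with x ≟ v
    ... | yes refl = uv
    ... | no x≢v with close (lk v x x≢v)
    ...   | inj₁ x≡u = ⊥-elim (x≢u x≡u)
    ...   | inj₂ ux = ux

Improves-sym : ∀ {n} {G : Graph n} {u v m β} → Improves G v u m β → Improves G u v m β
Improves-sym {G = G} {u} {v} i = record
  { graph = graph ; base = Adj-sym {G = graph} base ; linkage = Linkage-sym linkage ; bounded = Bounded-sym bounded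
  ; cliques = cliques ; degrees = subst₂ _<_ (+-comm (deg G v) _) (+-comm (deg graph v) _) degrees
  ; good = λ gd → Good-sym (good (Good-sym gd)) }
  where open Improves i

record Dominated {n} (G : Graph n) (u v : Fin n) (m : ℕ) : Set where
  field
    by-u    : ∀ x → x ≢ u → Adj (adj G) u x
    by-v    : ∀ x → x ≢ v → Adj (adj G) v x
    bounded : Bounded G u v (2 + m)

record Reduces {n} (G H : Graph n) (u v : Fin n) (m β : ℕ) : Set where
  field
    cliques : ∀ s → N (2 + s) G ≤ N (2 + s) H
    good    : Good H u v m β → Good G u v m β

Reduces-trans : ∀ {n} {G H J : Graph n} {u v m β} → Reduces G H u v m β → Reduces H J u v m β → Reduces G J u v m β
Reduces-trans r r′ = record
  { cliques = λ s → ≤-trans (Reduces.cliques r s) (Reduces.cliques r′ s)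
  ; good = Reduces.good r ∘ Reduces.good r′ }

dominate : ∀ {n m β} (G : Graph n) (u v : Fin n) → 1 ≤ m →
  Adj (adj G) u v → Linkage G u v → Bounded G u v (2 + m) → ∃ λ H → Dominated H u v m × Reduces G H u v m β
dominate {n} {m} {β} G u v 1≤m uv lk bd = loop (suc (n + n)) G uv lk bd (s≤s (m≤m+n (n + n) _))
  where
  deg≤n : ∀ G x → deg G x ≤ n
  deg≤n G x = ≤-trans (length-filterᵇ≤ (adj G x) (allFin n)) (≤-reflexive (length-tabulate {n = n} id))
  -- The sum deg u + deg v grows with every improvement and cannot exceed 2n.
  loop : ∀ fuel (G : Graph n) → Adj (adj G) u v → Linkage G u v → Bounded G u v (2 + m) →
    n + n < fuel + (deg G u + deg G v) → ∃ λ H → Dominated H u v m × Reduces G H u v m β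
  loop zero G uv lk bd lt = ⊥-elim (<⇒≱ lt (+-mono-≤ (deg≤n G u) (deg≤n G v)))
  loop (suc fuel) G uv lk bd lt = decide (improve-or-dominates 1≤m uv lk bd)
      (improve-or-dominates 1≤m (Adj-sym {G = G} uv) (Linkage-sym lk) (Bounded-sym bd))
    where
    continue : Improves G u v m β → ∃ λ H → Dominated H u v m × Reduces G H u v m β
    continue i with loop fuel graph base linkage bounded
        (≤-trans lt (subst (_≤ fuel + (deg graph u + deg graph v)) (+-suc fuel _) (+-monoʳ-≤ fuel degrees)))
      where open Improves i
    ... | H , dom , red = H , dom , Reduces-trans (record { cliques = Improves.cliques i ; good = Improves.good i }) red
    decide : Improves G u v m β ⊎ (∀ x → x ≢ u → Adj (adj G) u x) → Improves G v u m β ⊎ (∀ x → x ≢ v → Adj (adj G) v x) →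
      ∃ λ H → Dominated H u v m × Reduces G H u v m β
    decide (inj₁ i) _ = continue i
    decide (inj₂ _) (inj₁ i) = continue (Improves-sym i)
    decide (inj₂ du) (inj₂ dv) = G , record { by-u = du ; by-v = dv ; bounded = bd } , record { cliques = λ _ → ≤-refl ; good = id }

Compressed : ∀ {n} → Graph n → Fin n → Fin n → Set
Compressed G u v = ∀ {x w z} → Inner u v x → Inner u v w → toℕ w < toℕ x → Adj (adj G) x w →
  z ≢ x → Adj (adj G) w z → Adj (adj G) x z

bit : Bool → ℕ
bit b = if b then 1 else 0

count-∷ : ∀ (p : A → Bool) x l → count p (x ∷ l) ≡ bit (p x) + count p l
count-∷ p x l with p x
... | true  = refl
... | false = refl

count-∨∧ : ∀ (p q : A → Bool) l → count (λ x → p x ∨ q x) l + count (λ x → p x ∧ q x) l ≡ count p l + count q l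
count-∨∧ p q [] = refl
count-∨∧ p q (x ∷ l) with p x | q x
... | false | false = count-∨∧ p q l
... | true  | false = cong suc (count-∨∧ p q l)
... | false | true  = trans (cong suc (count-∨∧ p q l)) (sym (+-suc _ _))
... | true  | true  = cong suc (trans (+-suc _ _) (trans (cong suc (count-∨∧ p q l)) (sym (+-suc _ _))))

module CompressStep {n} {G : Graph n} {u v x w z : Fin n} {m : ℕ} (dom : Dominated G u v m)
  (ix : Inner u v x) (iw : Inner u v w) (w<x : toℕ w < toℕ x) (xw : Adj (adj G) x w)
  (z≢x : z ≢ x) (wz : Adj (adj G) w z) (¬xz : ¬ Adj (adj G) x z) where
  open Dominated dom

  abstract
    H : Graph n
    H = Kelmans.shifted G x w xw

    is : IsShift G H x w
    is = Kelmans.isShift G x w xw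
  open IsShift is

  private
    dominates-H : ∀ {d} → d ≢ x → d ≢ w → (∀ y → y ≢ d → Adj (adj G) d y) → ∀ y → y ≢ d → Adj (adj H) d y
    dominates-H dx dw by y y≢d with y ≟ x | y ≟ w
    ... | yes refl | _ = Adj-sym {G = H} (trans (at-x dx dw) (∨-trueˡ _ (Adj-sym {G = G} (by y y≢d))))
    ... | no _ | yes refl = Adj-sym {G = H} (trans (at-w dx dw) (∧-intro (Adj-sym {G = G} (by x (dx ∘ sym))) (Adj-sym {G = G} (by y y≢d))))
    ... | no yx | no yw = trans (far dx dw yx yw) (by y y≢d)

    x≢w : x ≢ w
    x≢w = Adj-≢ {G = G} xw

  dominated : Dominated H u v m
  dominated = record
    { by-u = dominates-H (proj₁ ix ∘ sym) (proj₁ iw ∘ sym) by-u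
    ; by-v = dominates-H (proj₂ ix ∘ sym) (proj₂ iw ∘ sym) by-v
    ; bounded = shift-Bounded is (proj₁ iw) (proj₂ iw) (proj₂ ix) bounded }

  reduces : ∀ {β} → Reduces G H u v m β
  reduces = record { cliques = shift-N is ; good = back }
    where
    -- Since x and w stay adjacent, they have one label. An inner G-neighbour of either is in H
    -- equal or adjacent to x, so it has this label too; and in a full class the other H-neighbours
    -- of w are G-neighbours of both x and w.
    back : ∀ {β} → Good H u v m β → Good G u v m β
    back {β} good = record
      { label = label ; label≤ = label≤ ; size = size
      ; nocross = nocross′ ; clique = clique′
      ; joined = λ (au , av) _ → by-u _ au , by-v _ av }
      where
      open Good good
      w-edge : ∀ {y} → Inner u v y → Adj (adj G) w y → label w ≡ label y
      w-edge {y} iy e with y ≟ x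
      ... | yes refl = nocross iw iy (Adj-sym {G = H} keep)
      ... | no yx = trans (nocross iw ix (Adj-sym {G = H} keep))
          (nocross ix iy (trans (at-x yx (Adj-≢ {G = G} e ∘ sym)) (∨-trueʳ (adj G x y) e)))
      x-edge : ∀ {y} → Inner u v y → Adj (adj G) x y → label x ≡ label y
      x-edge {y} iy e with y ≟ w
      ... | yes refl = nocross ix iy keep
      ... | no yw = nocross ix iy (trans (at-x (Adj-≢ {G = G} e ∘ sym) yw) (∨-trueˡ _ e))
      nocross′ : ∀ {a b} → Inner u v a → Inner u v b → Adj (adj G) a b → label a ≡ label b
      nocross′ {a} {b} ia ib e with a ≟ w | b ≟ w | a ≟ x | b ≟ x
      ... | yes refl | _ | _ | _ = w-edge ib e
      ... | no _ | yes refl | _ | _ = sym (w-edge ia (Adj-sym {G = G} e))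
      ... | no _ | no _ | yes refl | _ = x-edge ib e
      ... | no _ | no _ | no _ | yes refl = sym (x-edge ia (Adj-sym {G = G} e))
      ... | no aw | no bw | no ax | no bx = nocross ia ib (trans (far ax aw bx bw) e)
      w-clique : ∀ {b} → Inner u v b → b ≢ w → b ≢ x → label w ≡ label b → label w < β → Adj (adj G) x b × Adj (adj G) w b
      w-clique ib bw bx l lt = ∧-true _ _ (trans (sym (at-w bx bw)) (clique iw ib (bw ∘ sym) l lt))
      xw-label : label x ≡ label w
      xw-label = nocross ix iw keep
      pair : ∀ {a b} → a ≡ x ⊎ a ≡ w → Inner u v b → a ≢ b → label a ≡ label b → label a < β → Adj (adj G) a b
      pair {b = b} (inj₁ refl) ib ne l lt with b ≟ w
      ... | yes refl = xw
      ... | no bw = proj₁ (w-clique ib bw (ne ∘ sym) (trans (sym xw-label) l) (subst (_< β) xw-label lt))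
      pair {b = b} (inj₂ refl) ib ne l lt with b ≟ x
      ... | yes refl = Adj-sym {G = G} xw
      ... | no bx = proj₂ (w-clique ib (ne ∘ sym) bx l lt)
      clique′ : ∀ {a b} → Inner u v a → Inner u v b → a ≢ b → label a ≡ label b → label a < β → Adj (adj G) a b
      clique′ {a} {b} ia ib ne l lt with a ≟ w | b ≟ w | a ≟ x | b ≟ x
      ... | yes refl | _ | _ | _ = pair (inj₂ refl) ib ne l lt
      ... | no _ | _ | yes refl | _ = pair (inj₁ refl) ib ne l lt
      ... | no _ | yes refl | no _ | _ = Adj-sym {G = G} (pair (inj₂ refl) ia (ne ∘ sym) (sym l) (subst (_< β) l lt))
      ... | no _ | no _ | no _ | yes refl = Adj-sym {G = G} (pair (inj₁ refl) ia (ne ∘ sym) (sym l) (subst (_< β) l lt))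
      ... | no aw | no bw | no ax | no bx = trans (sym (far ax aw bx bw)) (clique ia ib ne l lt)

potential : ∀ {n} → Graph n → ℕ
potential {n} G = sum (map (λ i → (n ∸ toℕ i) * deg G i) (allFin n))

module _ {n} {G : Graph n} {u v x w z : Fin n} {m : ℕ} (dom : Dominated G u v m)
  (ix : Inner u v x) (iw : Inner u v w) (w<x : toℕ w < toℕ x) (xw : Adj (adj G) x w)
  (z≢x : z ≢ x) (wz : Adj (adj G) w z) (¬xz : ¬ Adj (adj G) x z) where
  private
    module CS = CompressStep dom ix iw w<x xw z≢x wz ¬xz
    H = CS.H
    open IsShift CS.is
    x≢w = Adj-≢ {G = G} xw

  -- The operation moves degree from w to the larger vertex x, whose weight n - x is smaller. A
  -- vertex that loses w gains x, so all other degrees are unchanged.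
  potential-decreases : potential H < potential G
  potential-decreases with enumerate₂ x≢w
  ... | l , τ , x∉l , w∉l = subst₂ _<_ (sym (expand H)) (sym (expand G)) main
    where
    φ : Fin n → ℕ
    φ i = n ∸ toℕ i
    φ< : φ x < φ w
    φ< = ∸-monoʳ-< w<x (<⇒≤ (toℕ<n x))
    term : Graph n → Fin n → ℕ
    term J i = φ i * deg J i
    expand : ∀ J → potential J ≡ term J x + (term J w + sum (map (term J) l))
    expand J = sum-↭ (↭P.map⁺ (term J) τ)
    deg-split : ∀ J i → deg J i ≡ bit (adj J i x) + (bit (adj J i w) + count (adj J i) l)
    deg-split J i = trans (↭P.↭-length (filterᵇ-↭ (adj J i) τ)) (trans (count-∷ (adj J i) x (w ∷ l)) (cong (bit (adj J i x) +_) (count-∷ (adj J i) w l)))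
    off : ∀ {y} → y ∈ l → y ≢ x × y ≢ w
    off m = (λ { refl → x∉l m }) , (λ { refl → w∉l m })
    bits : ∀ b c → bit (b ∨ c) + bit (b ∧ c) ≡ bit b + bit c
    bits true true = refl
    bits true false = refl
    bits false true = refl
    bits false false = refl
    others : ∀ {i} → i ∈ l → deg H i ≡ deg G i
    others {i} mi = trans (deg-split H i) (trans (cong₂ _+_
        (cong bit (trans (adj-sym H i x) (trans (at-x ix′ iw′) (cong₂ _∨_ (adj-sym G x i) (adj-sym G w i)))))
        (cong₂ _+_ (cong bit (trans (adj-sym H i w) (trans (at-w ix′ iw′) (cong₂ _∧_ (adj-sym G x i) (adj-sym G w i)))))
          (cong length (filterᵇ-cong l (λ m → far ix′ iw′ (proj₁ (off m)) (proj₂ (off m)))))))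
      (trans (sym (+-assoc (bit (adj G i x ∨ adj G i w)) _ _)) (trans (cong (_+ count (adj G i) l) (bits (adj G i x) (adj G i w)))
        (trans (+-assoc (bit (adj G i x)) _ _) (sym (deg-split G i))))))
      where
      ix′ = proj₁ (off mi)
      iw′ = proj₂ (off mi)
    rest≡ : sum (map (term H) l) ≡ sum (map (term G) l)
    rest≡ = cong sum (map-cong-local (All.tabulate (λ {i} m → cong (φ i *_) (others m))))
    deg-x : ∀ J → Adj (adj J) x w → deg J x ≡ suc (count (adj J x) l)
    deg-x J e = trans (deg-split J x) (cong₂ (λ b c → bit b + (bit c + count (adj J x) l)) (irref J x) e)
    deg-w : ∀ J → Adj (adj J) x w → deg J w ≡ suc (count (adj J w) l)
    deg-w J e = trans (deg-split J w) (cong₂ (λ b c → bit b + (bit c + count (adj J w) l)) (Adj-sym {G = J} e) (irref J w))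
    total : deg H x + deg H w ≡ deg G x + deg G w
    total = trans (cong₂ _+_ (deg-x H keep) (deg-w H keep)) (trans (cong suc (+-suc _ _))
      (trans (cong (suc ∘ suc) (trans (cong₂ _+_ (cong length (filterᵇ-cong l (λ m → at-x (proj₁ (off m)) (proj₂ (off m)))))
                                                 (cong length (filterᵇ-cong l (λ m → at-w (proj₁ (off m)) (proj₂ (off m))))))
        (count-∨∧ (adj G x) (adj G w) l)))
      (sym (trans (cong₂ _+_ (deg-x G xw) (deg-w G xw)) (cong suc (+-suc _ _))))))
    grow : deg G x < deg H x
    grow = count-< (adj G x) (adj H x) (allFin n) mono (∈-allFin z) (≢true ¬xz)
        (trans (at-x z≢x (Adj-≢ {G = G} wz ∘ sym)) (∨-trueʳ (adj G x z) wz))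
      where
      mono : ∀ y → adj G x y ≡ true → adj H x y ≡ true
      mono y e with y ≟ w
      ... | yes refl = keep
      ... | no yw = trans (at-x (Adj-≢ {G = G} e ∘ sym) yw) (∨-trueˡ _ e)
    transfer : ∀ {p q a b a′ b′} → p < q → a < a′ → a′ + b′ ≡ a + b → p * a′ + q * b′ < p * a + q * b
    transfer {p} {q} {a} {b} {a′} {b′} p<q a<a′ e = subst₂ (λ s t → p * s + q * b′ < p * a + q * t) a+c (sym b≡)
      (subst₂ _<_ (sym (l₁ p a c q b′)) (sym (l₂ p a c q b′)) (+-monoʳ-< (p * a + q * b′) (*-monoˡ-< c p<q)))
      where
      c = a′ ∸ a
      a+c : a + c ≡ a′
      a+c = m+[n∸m]≡n (<⇒≤ a<a′)
      instance
        c≢0 : NonZero c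
        c≢0 = >-nonZero (m<n⇒0<n∸m a<a′)
      b≡ : b ≡ b′ + c
      b≡ = +-cancelˡ-≡ a b (b′ + c) (trans (sym e) (trans (cong (_+ b′) (sym a+c)) (trans (+-assoc a c b′) (cong (a +_) (+-comm c b′)))))
      l₁ : ∀ p a c q b → p * (a + c) + q * b ≡ (p * a + q * b) + p * c
      l₁ = solve-∀
      l₂ : ∀ p a c q b → p * a + q * (b + c) ≡ (p * a + q * b) + q * c
      l₂ = solve-∀
    main : term H x + (term H w + sum (map (term H) l)) < term G x + (term G w + sum (map (term G) l))
    main = subst₂ _<_ (+-assoc (term H x) _ _) (trans (cong (term G x + term G w +_) rest≡) (+-assoc (term G x) _ _))
      (+-monoˡ-< (sum (map (term H) l)) (transfer {φ x} {φ w} φ< grow total))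

compress : ∀ {n m β} (G : Graph n) (u v : Fin n) → Dominated G u v m →
  ∃ λ H → Dominated H u v m × Compressed H u v × Reduces G H u v m β
compress {n} {m} {β} G u v dom = loop (suc (potential G)) G dom ≤-refl
  where
  inner? : ∀ x → Dec (Inner u v x)
  inner? x = ¬? (x ≟ u) ×-dec ¬? (x ≟ v)
  loop : ∀ fuel (G : Graph n) → Dominated G u v m → potential G < fuel →
    ∃ λ H → Dominated H u v m × Compressed H u v × Reduces G H u v m β
  loop zero G dom ()
  loop (suc fuel) G dom (s≤s lt) = decide violation?
    where
    Violation : Fin n → Fin n → Fin n → Set
    Violation x w z = Inner u v x × Inner u v w × toℕ w < toℕ x × Adj (adj G) x w × z ≢ x × Adj (adj G) w z × ¬ Adj (adj G) x z
    here? : ∀ x w z → Dec (Violation x w z)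
    here? x w z = inner? x ×-dec inner? w ×-dec (toℕ w <? toℕ x)
      ×-dec (adj G x w Bool.≟ true) ×-dec ¬? (z ≟ x) ×-dec (adj G w z Bool.≟ true) ×-dec ¬? (adj G x z Bool.≟ true)
    violation? : Dec (∃ λ x → ∃ λ w → ∃ λ z → Violation x w z)
    violation? = any? λ x → any? λ w → any? (here? x w)
    prepend : ∀ {J} → Reduces G J u v m β → (∃ λ H → Dominated H u v m × Compressed H u v × Reduces J H u v m β) →
      ∃ λ H → Dominated H u v m × Compressed H u v × Reduces G H u v m β
    prepend red (H , dH , cH , red′) = H , dH , cH , Reduces-trans red red′
    decide : Dec (∃ λ x → ∃ λ w → ∃ λ z → Violation x w z) → ∃ λ H → Dominated H u v m × Compressed H u v × Reduces G H u v m β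
    decide (yes (x , w , z , ix , iw , w<x , xw , zx , wz , ¬xz)) = prepend (CompressStep.reduces dom ix iw w<x xw zx wz ¬xz)
      (loop fuel (CompressStep.H dom ix iw w<x xw zx wz ¬xz) (CompressStep.dominated dom ix iw w<x xw zx wz ¬xz)
        (<-≤-trans (potential-decreases dom ix iw w<x xw zx wz ¬xz) lt))
    decide (no none) = G , dom , closed , record { cliques = λ _ → ≤-refl ; good = id }
      where
      closed : Compressed G u v
      closed {x} {w} {z} ix iw w<x xw zx wz with adj G x z Bool.≟ true
      ... | yes xz = xz
      ... | no ¬xz = ⊥-elim (none (x , w , z , ix , iw , w<x , xw , zx , wz , ¬xz))

-- Compressed graphs

unique-⊆-length : ∀ {xs ys : List A} → Unique xs → (∀ {x} → x ∈ xs → x ∈ ys) → length xs ≤ length ys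
unique-⊆-length {xs = []} u sub = z≤n
unique-⊆-length {xs = x ∷ xs} {ys} (x∉ ∷ u) sub with ∈-∃++ (sub (here refl))
... | α , γ , refl = subst (suc (length xs) ≤_) (sym (↭P.↭-length (middle α))) (s≤s (unique-⊆-length u sub′))
  where
  sub′ : ∀ {y} → y ∈ xs → y ∈ α ++ γ
  sub′ {y} m with ↭P.∈-resp-↭ (middle α) (sub (there m))
  ... | here y≡x = ⊥-elim (All≢⇒∉ x∉ (subst (_∈ xs) y≡x m))
  ... | there m′ = m′

no-cliques : ∀ (a : A → A → Bool) s l → length l < s → K a s l ≡ 0
no-cliques a s l lt = n≤0⇒n≡0 (≤-trans (K≤C a s l) (≤-reflexive (k>n⇒nCk≡0 lt)))

unique-⊇ : ∀ {n} {xs ys : List (Fin n)} → Unique xs → (∀ {x} → x ∈ xs → x ∈ ys) → length ys ≤ length xs →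
  ∀ {y} → y ∈ ys → y ∈ xs
unique-⊇ {xs = xs} {ys} u sub le {y} y∈ with mem? y xs
... | yes m = m
... | no y∉ = ⊥-elim (<⇒≱ (unique-⊆-length {xs = y ∷ xs} (∉⇒All≢ y∉ ∷ u) (λ { (here refl) → y∈ ; (there m) → sub m })) le)

count-split : ∀ (p : A → Bool) l → length l ≡ count p l + count (not ∘ p) l
count-split p [] = refl
count-split p (x ∷ l) with p x
... | true  = cong suc (count-split p l)
... | false = trans (cong suc (count-split p l)) (sym (+-suc _ _))

total : (A → ℕ) → List A → ℕ
total h l = sum (map h l)

total-split : ∀ (h : A → ℕ) (p : A → Bool) l → total h l ≡ total h (filterᵇ p l) + total h (filterᵇ (not ∘ p) l)
total-split h p [] = refl
total-split h p (x ∷ l) with p x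
... | true  = trans (cong (h x +_) (total-split h p l)) (sym (+-assoc (h x) _ _))
... | false = trans (cong (h x +_) (total-split h p l)) (lem (h x) (total h (filterᵇ p l)) _)
  where lem : ∀ a b c → a + (b + c) ≡ b + (a + c)
        lem = solve-∀

total-≤ : ∀ (h : A → ℕ) c l → (∀ {x} → x ∈ l → h x ≤ c) → total h l ≤ length l * c
total-≤ h c [] b = z≤n
total-≤ h c (x ∷ l) b = +-mono-≤ (b (here refl)) (total-≤ h c l (b ∘ there))

argmax : ∀ (h : A → ℕ) x l → ∃ λ y → y ∈ x ∷ l × (∀ {z} → z ∈ x ∷ l → h z ≤ h y)
argmax h x [] = x , here refl , λ { (here refl) → ≤-refl }
argmax h x (x′ ∷ l) with argmax h x′ l
... | y , m , b with ≤-total (h x) (h y)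
...   | inj₁ le = y , there m , λ { (here refl) → le ; (there m′) → b m′ }
...   | inj₂ le = x , here refl , λ { (here refl) → ≤-refl ; (there m′) → ≤-trans (b m′) le }

interleave : List A → List A → List A
interleave []       ys       = ys
interleave (s ∷ ss) []       = []
interleave (s ∷ ss) (y ∷ ys) = s ∷ y ∷ interleave ss ys

length-interleave : ∀ (ss ys : List A) → length (interleave ss ys) ≡ length ss ⊓ length ys + length ys
length-interleave [] ys = refl
length-interleave (s ∷ ss) [] = refl
length-interleave (s ∷ ss) (y ∷ ys) = cong suc (trans (cong suc (length-interleave ss ys)) (sym (+-suc _ _)))

∈-interleave : ∀ (ss ys : List A) {z} → z ∈ interleave ss ys → z ∈ ss ⊎ z ∈ ys
∈-interleave [] ys m = inj₂ m
∈-interleave (s ∷ ss) (y ∷ ys) (here e) = inj₁ (here e)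
∈-interleave (s ∷ ss) (y ∷ ys) (there (here e)) = inj₂ (here e)
∈-interleave (s ∷ ss) (y ∷ ys) (there (there m)) = Sum.map there there (∈-interleave ss ys m)

interleave-unique : ∀ (ss ys zs : List A) → Unique ss → Unique (ys ++ zs) → (∀ {a} → a ∈ ss → a ∈ ys ++ zs → ⊥) →
  Unique (interleave ss ys ++ zs)
interleave-unique [] ys zs us uy dis = uy
interleave-unique (s ∷ ss) [] zs us uy dis = uy
interleave-unique (s ∷ ss) (y ∷ ys) zs (s∉ ∷ us) (y∉ ∷ uy) dis =
  ((λ { refl → dis (here refl) (here refl) }) ∷ ∉⇒All≢ s∉′) ∷ ∉⇒All≢ y∉′
  ∷ interleave-unique ss ys zs us uy (λ m m′ → dis (there m) (there m′))
  where
  spread : ∀ {a} → a ∈ interleave ss ys ++ zs → a ∈ ss ⊎ a ∈ ys ++ zs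
  spread m with ∈-++⁻ (interleave ss ys) m
  ... | inj₁ m′ = Sum.map₂ ∈-++⁺ˡ (∈-interleave ss ys m′)
  ... | inj₂ m′ = inj₂ (∈-++⁺ʳ ys m′)
  s∉′ : s ∉ interleave ss ys ++ zs
  s∉′ m with spread m
  ... | inj₁ m′ = All≢⇒∉ s∉ m′
  ... | inj₂ m′ = dis (here refl) (there m′)
  y∉′ : y ∉ interleave ss ys ++ zs
  y∉′ m with spread m
  ... | inj₁ m′ = dis (there m′) (here refl)
  ... | inj₂ m′ = All≢⇒∉ y∉ m′

module _ {R : A → A → Set} where

  clique-linked : ∀ {p l} → All (R p) l → AllPairs R l → Linked R (p ∷ l)
  clique-linked [] [] = [-]
  clique-linked (r ∷ _) (rs ∷ ap) = r ∷ clique-linked rs ap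

  interleave-linked : ∀ p ss ys zs → All (R p) ss → All (R p) (ys ++ zs) → AllPairs R (ys ++ zs) →
    (∀ {s y} → s ∈ ss → y ∈ ys → R s y × R y s) → Linked R (p ∷ (interleave ss ys ++ zs))
  interleave-linked p [] ys zs rs ry ap h = clique-linked ry ap
  interleave-linked p (s ∷ ss) [] zs rs ry ap h = clique-linked ry ap
  interleave-linked p (s ∷ ss) (y ∷ ys) zs (r ∷ rs) (_ ∷ ry) (y~ ∷ ap) h =
    r ∷ proj₁ (h (here refl) (here refl)) ∷ interleave-linked y ss ys zs
      (All.tabulate (λ m → proj₂ (h (there m) (here refl)))) y~ ap (λ m m′ → h (there m) (there m′))

  prefix-linked : ∀ {e es y l} → AllPairs R (e ∷ es) → All (λ a → R a y) (e ∷ es) → Linked R (y ∷ l) →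
    Linked R ((e ∷ es) ++ y ∷ l)
  prefix-linked {es = []} _ (r ∷ []) ln = r ∷ ln
  prefix-linked {es = e′ ∷ es} ((r ∷ _) ∷ ap) (_ ∷ rs) ln = r ∷ prefix-linked ap rs ln

initial : {P : A → Set} → (∀ x → Dec (P x)) → ∀ l →
  ∃₂ λ l₁ l₂ → l ≡ l₁ ++ l₂ × All P l₁ × (l₂ ≡ [] ⊎ ∃₂ λ y l₃ → l₂ ≡ y ∷ l₃ × ¬ P y)
initial P? [] = [] , [] , refl , [] , inj₁ refl
initial P? (x ∷ l) with P? x
... | no ¬p = [] , x ∷ l , refl , [] , inj₂ (x , l , refl , ¬p)
... | yes p with initial P? l
...   | l₁ , l₂ , refl , ps , e = x ∷ l₁ , l₂ , refl , p ∷ ps , e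

pairwise : ∀ {R : A → A → Set} {l} → Unique l → (∀ {a b} → a ∈ l → b ∈ l → a ≢ b → R a b) → AllPairs R l
pairwise [] h = []
pairwise (x∉ ∷ u) h = All.tabulate (λ m → h (here refl) (there m) (All.lookup x∉ m)) ∷ pairwise u (λ m m′ → h (there m) (there m′))

AllPairs-++⁻ : ∀ {R : A → A → Set} xs {ys} → AllPairs R (xs ++ ys) → AllPairs R xs × AllPairs R ys
AllPairs-++⁻ [] ap = [] , ap
AllPairs-++⁻ (x ∷ xs) (px ∷ ap) with AllPairs-++⁻ xs ap
... | a , b = AllP.++⁻ˡ xs px ∷ a , b

AllPairs-reverse : ∀ {R : A → A → Set} {l} → AllPairs R l → AllPairs (λ x y → R y x) (reverse l)
AllPairs-reverse [] = []
AllPairs-reverse {R = R} {x ∷ l} (px ∷ ap) = subst (AllPairs _) (sym (unfold-reverse x l))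
  (AllPairsP.++⁺ (AllPairs-reverse ap) ([] ∷ []) (All.tabulate (λ m → All.lookup px (↭P.∈-resp-↭ (↭P.↭-reverse l) m) ∷ [])))

≤-+-⊓ : ∀ a {b c t} → t ≤ a + b → t ≤ a + c → t ≤ a + b ⊓ c
≤-+-⊓ a {b} {c} {t} p q = subst (t ≤_) (sym (+-distribˡ-⊓ a b c)) (⊓-glb p q)

-- The forest order on a compressed graph and long paths in its components

module Peel {n} (G : Graph n) (u v : Fin n) (m′ σ : ℕ) (σ≤m′ : σ ≤ m′) (u≢v : u ≢ v)
  (dom : Dominated G u v (suc m′)) (cmp : Compressed G u v) where

  open Dominated dom
  m = suc m′
  f = cliqueWeight σ
  open Periodic f m′ using (F-small; F-period)

  V : List (Fin n)
  V = filterᵇ (innerᵇ u v) (allFin n)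

  Below : Fin n → Fin n → Set
  Below x y = toℕ x < toℕ y

  Sorted : List (Fin n) → Set
  Sorted = AllPairs Below

  E : Fin n → Fin n → Set
  E x y = Adj (adj G) x y

  E-sym : ∀ {x y} → E x y → E y x
  E-sym = Adj-sym {G = G}

  Below-≢ : ∀ {x y} → Below x y → x ≢ y
  Below-≢ lt refl = <-irrefl refl lt

  sorted-unique : ∀ {l} → Sorted l → Unique l
  sorted-unique = AllPairs.map Below-≢

  filter-sorted : ∀ (p : Fin n → Bool) {l} → Sorted l → Sorted (filterᵇ p l)
  filter-sorted p = AllPairsP.filter⁺ (T? ∘ p)

  V-inner : ∀ {x} → x ∈ V → Inner u v x
  V-inner m = innerᵇ⁻ (proj₂ (∈-filterᵇ⁻ (innerᵇ u v) (allFin n) m))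

  inner-V : ∀ {x} → Inner u v x → x ∈ V
  inner-V i = ∈-filterᵇ⁺ (innerᵇ u v) (∈-allFin _) (innerᵇ⁺ i)

  V-sorted : Sorted V
  V-sorted = filter-sorted (innerᵇ u v) (AllPairsP.tabulate⁺-< id)

  above : Fin n → Fin n → Bool
  above x y = ⌊ toℕ x <? toℕ y ⌋ ∧ adj G x y

  anc : Fin n → List (Fin n)
  anc x = filterᵇ (above x) V

  dep : Fin n → ℕ
  dep x = length (anc x)

  record Anc (x y : Fin n) : Set where
    constructor mkAnc
    field
      inner : Inner u v y
      below : Below x y
      linked : E x y

  anc⁻ : ∀ {x y} → y ∈ anc x → Anc x y
  anc⁻ {x} {y} m with ∈-filterᵇ⁻ (above x) V m
  ... | mV , e with ∧-true ⌊ toℕ x <? toℕ y ⌋ _ e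
  ...   | lt , xy = mkAnc (V-inner mV) (⌊⌋-true (toℕ x <? toℕ y) lt) xy

  anc⁺ : ∀ {x y} → Anc x y → y ∈ anc x
  anc⁺ {x} {y} (mkAnc i lt e) = ∈-filterᵇ⁺ (above x) (inner-V i) (∧-intro (⌊⌋-intro (toℕ x <? toℕ y) lt) e)

  anc-sorted : ∀ x → Sorted (anc x)
  anc-sorted x = filter-sorted (above x) V-sorted

  -- As x is the smaller end of xy, N[x] lies in N[y], and z is in N[x]. Together with `anc-trans`
  -- this makes the ancestors of a vertex a chain of a forest order.
  anc-adj : ∀ {x y z} → Inner u v x → Anc x y → Anc x z → y ≢ z → E y z
  anc-adj ix (mkAnc iy lty xy) (mkAnc iz ltz xz) ne = cmp iy ix lty (E-sym xy) (ne ∘ sym) xz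

  anc-trans : ∀ {x y z} → Inner u v x → Anc x y → Anc y z → Anc x z
  anc-trans ix (mkAnc iy lty xy) (mkAnc iz ltz yz) =
    mkAnc iz (<-trans lty ltz) (E-sym (cmp iz iy ltz (E-sym yz) (Below-≢ (<-trans lty ltz)) (E-sym xy)))

  -- Both terminals are dominating, so u can be put before and v behind any path of inner vertices.
  free : ∀ {a p} → Linked E (a ∷ p) → Unique (a ∷ p) → All (Inner u v) (a ∷ p) → length (a ∷ p) ≤ m
  free {a} {p} ln un inn = s≤s⁻¹ (s≤s⁻¹ (bounded (a ∷ p) (by-u a (proj₁ (All.head inn)) ∷ run ln inn)
      ((u≢v ∷ All.map (λ i e → proj₁ i (sym e)) inn) ∷ All.map (λ i e → proj₂ i (sym e)) inn ∷ un)))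
    where
    run : ∀ {a p} → Linked E (a ∷ p) → All (Inner u v) (a ∷ p) → Chain G a p v
    run [-] (i ∷ []) = edge (E-sym (by-v _ (proj₂ i)))
    run (e ∷ ln) (i ∷ inn) = e ∷ run ln inn

  AncClosed : List (Fin n) → Set
  AncClosed l = ∀ {x y} → x ∈ l → Anc x y → y ∈ l

  -- The ancestors of an entry are larger and belong to the list, so they stand behind it; the depth
  -- is at most the number of entries behind.
  total≤S : ∀ l → Sorted l → AncClosed l → total (f ∘ dep) l ≤ S f (length l)
  total≤S [] so cl = z≤n
  total≤S (x ∷ l) (x< ∷ so) cl = ≤-trans (+-mono-≤ (mono-≤ {f} (weight-mono σ) dep≤) (total≤S l so tail-closed))
      (≤-reflexive (+-comm (f (length l)) _))
    where
    shrink : ∀ {a} → Below x a → a ∈ x ∷ l → a ∈ l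
    shrink lt (here refl) = ⊥-elim (<-irrefl refl lt)
    shrink lt (there m) = m
    dep≤ : dep x ≤ length l
    dep≤ = unique-⊆-length (sorted-unique (anc-sorted x)) (λ m → shrink (Anc.below (anc⁻ m)) (cl (here refl) (anc⁻ m)))
    tail-closed : AncClosed l
    tail-closed m a = shrink (<-trans (All.lookup x< m) (Anc.below a)) (cl (there m) a)

  -- Cliques are counted at their smallest vertex; the list r collects the two dominating vertices.
  K≤total : ∀ s r l → l ⊆ V → Sorted l →
    K (adj G) (suc s) (l ++ r) ≤ total (λ x → (length r + dep x) C s) l + K (adj G) (suc s) r
  K≤total s r [] τ so = ≤-refl
  K≤total s r (x ∷ l) τ (x< ∷ so) = ≤-trans
    (+-mono-≤ (K≤total s r l (tail τ) so) (≤-trans (K≤C (adj G) s (filterᵇ (adj G x) (l ++ r))) (C-mono s len)))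
    (≤-reflexive (lem (total (λ y → (length r + dep y) C s) l) _ _))
    where
    lem : ∀ a b c → a + b + c ≡ c + a + b
    lem = solve-∀
    tail : x ∷ l ⊆ V → l ⊆ V
    tail τ = ⊆-trans (x ∷ʳ ⊆-refl) τ
    len : length (filterᵇ (adj G x) (l ++ r)) ≤ length r + dep x
    len = ≤-trans (≤-reflexive (trans (cong length (filter-++ (T? ∘ adj G x) l r)) (length-++ (filterᵇ (adj G x) l))))
      (≤-trans (≤-reflexive (+-comm (count (adj G x) l) _)) (+-mono-≤ (length-filterᵇ≤ (adj G x) r) (length-mono-≤ (filterᵇ-⊆ {p = adj G x} {q = above x} (tail τ)
        (λ {y} m e → ∧-intro (⌊⌋-intro (toℕ x <? toℕ y) (All.lookup x< m)) e)))))

  allFin↭ : allFin n ↭ V ++ u ∷ v ∷ []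
  allFin↭ with enumerate₂ u≢v
  ... | l , τ , u∉l , v∉l = ↭-trans τ (↭-trans (↭-prep u (↭-prep v (↭-sym V↭l)))
      (↭P.++-comm (u ∷ v ∷ []) V))
    where
    skip : filterᵇ (innerᵇ u v) (u ∷ v ∷ l) ≡ l
    skip rewrite ⌊⌋-intro (u ≟ u) refl | ⌊⌋-intro (v ≟ v) refl | ∧-comm (not ⌊ v ≟ u ⌋) false =
      filter-all (T? ∘ innerᵇ u v) (All.tabulate (λ {x} m → subst T (sym (innerᵇ⁺ {u = u} {v} {x}
        ((λ { refl → u∉l m }) , (λ { refl → v∉l m })))) tt))
    V↭l : V ↭ l
    V↭l = ↭-trans (filterᵇ-↭ (innerᵇ u v) τ) (Perm.↭-reflexive skip)

  V-length : 2 + length V ≡ n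
  V-length = trans (+-comm 2 (length V)) (trans (sym (length-++ V)) (trans (sym (↭P.↭-length allFin↭)) (length-tabulate {n = n} id)))

  N≤total : N (3 + σ) G ≤ total (f ∘ dep) V
  N≤total = ≤-trans (≤-reflexive (trans (N≡K (3 + σ) G) (K-↭ (adj G) (adj-sym G) (3 + σ) allFin↭)))
    (subst (K (adj G) (3 + σ) (V ++ u ∷ v ∷ []) ≤_)
      (trans (cong (total (f ∘ dep) V +_) (no-cliques (adj G) (3 + σ) (u ∷ v ∷ []) (s≤s (s≤s (s≤s z≤n))))) (+-identityʳ _))
      (K≤total (2 + σ) (u ∷ v ∷ []) V ⊆-refl V-sorted))

  -- In a compressed graph the largest vertex ρ of a component is adjacent to all its other vertices.
  record Component (W : List (Fin n)) (ρ : Fin n) : Set where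
    field
      sorted : Sorted W
      inner  : ∀ {x} → x ∈ W → Inner u v x
      closed : ∀ {x y} → x ∈ W → Inner u v y → E x y → y ∈ W
      ρ∈W    : ρ ∈ W
      root   : ∀ {x} → x ∈ W → x ≢ ρ → Anc x ρ

  deepest : ∀ {W ρ} → Component W ρ → ∃ λ x → x ∈ W × (∀ {z} → z ∈ W → dep z ≤ dep x)
  deepest {[]} comp with Component.ρ∈W comp
  ... | ()
  deepest {c ∷ cs} _ = argmax dep c cs

  module Chained {W ρ} (comp : Component W ρ) {x* : Fin n} (x*∈W : x* ∈ W) (max-dep : ∀ {z} → z ∈ W → dep z ≤ dep x*) where
    open Component comp

    chain : List (Fin n)
    chain = x* ∷ anc x*

    private
      ix* : Inner u v x*
      ix* = inner x*∈W

    chain-sorted : Sorted chain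
    chain-sorted = All.tabulate (λ m → Anc.below (anc⁻ m)) ∷ anc-sorted x*

    chain-unique : Unique chain
    chain-unique = sorted-unique chain-sorted

    chain⊆W : ∀ {y} → y ∈ chain → y ∈ W
    chain⊆W (here refl) = x*∈W
    chain⊆W (there m) with anc⁻ m
    ... | mkAnc i _ e = closed x*∈W i e

    chain-anc : AncClosed chain
    chain-anc (here refl) a = there (anc⁺ a)
    chain-anc (there m) a = there (anc⁺ (anc-trans ix* (anc⁻ m) a))

    chain-adj : ∀ {y z} → y ∈ chain → z ∈ chain → y ≢ z → E y z
    chain-adj (here refl) (here refl) ne = ⊥-elim (ne refl)
    chain-adj (here refl) (there m) ne = Anc.linked (anc⁻ m)
    chain-adj (there m) (here refl) ne = E-sym (Anc.linked (anc⁻ m))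
    chain-adj (there m) (there m′) ne = anc-adj ix* (anc⁻ m) (anc⁻ m′) ne

    ρ∈chain : ρ ∈ chain
    ρ∈chain with ρ ≟ x*
    ... | yes e = here e
    ... | no ne = there (anc⁺ (root x*∈W (ne ∘ sym)))

    -- Otherwise the members of S could be woven into the chain to give a path with more than m vertices.
    weave : ∀ S τ → 1 ≤ τ → Unique S → (∀ {s} → s ∈ S → s ∈ W × s ∉ chain × τ ≤ dep s) → τ ≤ length S → length chain + τ ≤ m
    weave S τ 1≤τ uS hS τ≤S = by-split (initial fits? (reverse chain))
      where
      Fits : Fin n → Set
      Fits y = All (E y) S
      fits? : ∀ y → Dec (Fits y)
      fits? y = All.all? (λ s → adj G y s Bool.≟ true) S
      Y = reverse chain
      Y↭ : Y ↭ chain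
      Y↭ = ↭P.↭-reverse chain
      on-chain : ∀ {y} → y ∈ Y → y ∈ chain
      on-chain = ↭P.∈-resp-↭ Y↭
      uY : Unique Y
      uY = Unique-resp-↭ (↭-sym Y↭) chain-unique
      Y-clique : AllPairs E Y
      Y-clique = pairwise uY (λ m m′ → chain-adj (on-chain m) (on-chain m′))
      Y-sorted : AllPairs (λ a b → Below b a) Y
      Y-sorted = AllPairs-reverse chain-sorted
      below-chain : ∀ {s y} → s ∈ S → y ∈ chain → E y s → Anc s y
      below-chain {s} {y} ms my e with <-cmp s y
      ... | tri< lt _ _ = mkAnc (inner (chain⊆W my)) lt (E-sym e)
      ... | tri≈ _ refl _ = ⊥-elim (proj₁ (proj₂ (hS ms)) my)
      ... | tri> _ _ gt = ⊥-elim (proj₁ (proj₂ (hS ms)) (chain-anc my (mkAnc (inner (proj₁ (hS ms))) gt e)))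
      ρ-fits : Fits ρ
      ρ-fits = All.tabulate (λ m → E-sym (Anc.linked (root (proj₁ (hS m)) (λ { refl → proj₁ (proj₂ (hS m)) ρ∈chain }))))

      -- The path consists of the clique e, es, then y, then `ss` and `Y₁` in alternation, then the
      -- rest `Y₂` of the chain. It may alternate because y and all of `Y₁` are adjacent to all of
      -- S; the minimum is the number of members of `ss` that find a place.
      assemble : ∀ e es ss y Y₁ Y₂ → Y ≡ (y ∷ Y₁) ++ Y₂ → All Fits (y ∷ Y₁) → (∀ {s} → s ∈ ss → s ∈ S) → Unique ss →
        AllPairs E (e ∷ es) → Unique (e ∷ es) → (∀ {a} → a ∈ e ∷ es → Inner u v a × a ∉ chain × E a y × a ∉ ss) →
        length (e ∷ es) + (suc (length ss ⊓ length Y₁ + length Y₁) + length Y₂) ≤ m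
      assemble e es ss y Y₁ Y₂ eq fit ss⊆S uss ce ue he = subst (_≤ m) path-length (free {e} {es ++ y ∷ woven} path-linked path-unique path-inner)
        where
        woven : List (Fin n)
        woven = interleave ss Y₁ ++ Y₂
        cY : AllPairs E ((y ∷ Y₁) ++ Y₂)
        cY = subst (AllPairs E) eq Y-clique
        uY′ : Unique ((y ∷ Y₁) ++ Y₂)
        uY′ = subst Unique eq uY
        in-chain : ∀ {a} → a ∈ (y ∷ Y₁) ++ Y₂ → a ∈ chain
        in-chain m = on-chain (subst (_ ∈_) (sym eq) m)
        apart : ∀ {a} → a ∈ ss → a ∈ Y₁ ++ Y₂ → ⊥
        apart ms my = proj₁ (proj₂ (hS (ss⊆S ms))) (in-chain (there my))
        spread : ∀ {a} → a ∈ y ∷ (interleave ss Y₁ ++ Y₂) → a ∈ ss ⊎ a ∈ (y ∷ Y₁) ++ Y₂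
        spread (here e) = inj₂ (here e)
        spread (there m) with ∈-++⁻ (interleave ss Y₁) m
        ... | inj₂ m′ = inj₂ (there (∈-++⁺ʳ Y₁ m′))
        ... | inj₁ m′ = Sum.map₂ (there ∘ ∈-++⁺ˡ) (∈-interleave ss Y₁ m′)
        dis : ∀ {a} → a ∈ e ∷ es → a ∈ y ∷ (interleave ss Y₁ ++ Y₂) → ⊥
        dis m₁ m₂ with spread m₂
        ... | inj₁ m′ = proj₂ (proj₂ (proj₂ (he m₁))) m′
        ... | inj₂ m′ = proj₁ (proj₂ (he m₁)) (in-chain m′)
        y∉ : y ∉ interleave ss Y₁ ++ Y₂
        y∉ m with ∈-++⁻ (interleave ss Y₁) m
        ... | inj₂ m′ = All≢⇒∉ (AllPairs.head uY′) (∈-++⁺ʳ Y₁ m′)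
        ... | inj₁ m′ with ∈-interleave ss Y₁ m′
        ...   | inj₁ m″ = proj₁ (proj₂ (hS (ss⊆S m″))) (in-chain (here refl))
        ...   | inj₂ m″ = All≢⇒∉ (AllPairs.head uY′) (∈-++⁺ˡ m″)
        inn : ∀ {a} → a ∈ y ∷ (interleave ss Y₁ ++ Y₂) → Inner u v a
        inn m with spread m
        ... | inj₁ m′ = inner (proj₁ (hS (ss⊆S m′)))
        ... | inj₂ m′ = inner (chain⊆W (in-chain m′))
        woven-length : length woven ≡ length ss ⊓ length Y₁ + length Y₁ + length Y₂
        woven-length = trans (length-++ (interleave ss Y₁)) (cong (_+ length Y₂) (length-interleave ss Y₁))
        path-length : length ((e ∷ es) ++ y ∷ woven) ≡ length (e ∷ es) + (suc (length ss ⊓ length Y₁ + length Y₁) + length Y₂)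
        path-length = trans (length-++ (e ∷ es) {y ∷ woven}) (cong (λ z → length (e ∷ es) + suc z) woven-length)
        fit-both : ∀ {s a} → s ∈ ss → a ∈ Y₁ → E s a × E a s
        fit-both ms ma = E-sym r , r
          where r = All.lookup (All.lookup (All.tail fit) ma) (ss⊆S ms)
        woven-linked : Linked E (y ∷ woven)
        woven-linked = interleave-linked y ss Y₁ Y₂ (All.tabulate (λ m → All.lookup (All.head fit) (ss⊆S m)))
          (AllPairs.head cY) (AllPairs.tail cY) fit-both
        path-linked : Linked E ((e ∷ es) ++ y ∷ woven)
        path-linked = prefix-linked ce (All.tabulate (λ m → proj₁ (proj₂ (proj₂ (he m))))) woven-linked
        path-unique : Unique ((e ∷ es) ++ y ∷ woven)
        path-unique = UniqueP.++⁺ ue (∉⇒All≢ y∉ ∷ interleave-unique ss Y₁ Y₂ uss (AllPairs.tail uY′) apart) (λ (m₁ , m₂) → dis m₁ m₂)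
        path-inner : All (Inner u v) ((e ∷ es) ++ y ∷ woven)
        path-inner = AllP.++⁺ {xs = e ∷ es} (All.tabulate (λ m → proj₁ (he m))) (All.tabulate inn)

      rearrange : ∀ y Y₁ Y₂ → Y ≡ (y ∷ Y₁) ++ Y₂ → ∀ {a b} → τ ≤ a + b ⊓ length Y₁ →
        a + (suc (b ⊓ length Y₁ + length Y₁) + length Y₂) ≤ m → length chain + τ ≤ m
      rearrange y Y₁ Y₂ eq {a} {b} le h = ≤-trans (+-monoʳ-≤ (length chain) le)
        (subst (_≤ m) (trans (lem a (b ⊓ length Y₁) (length Y₁) (length Y₂)) (cong (_+ (a + b ⊓ length Y₁)) (sym len))) h)
        where
        lem : ∀ a b c d → a + (suc (b + c) + d) ≡ suc (c + d) + (a + b)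
        lem = solve-∀
        len : length chain ≡ suc (length Y₁ + length Y₂)
        len = trans (sym (length-reverse chain)) (trans (cong length eq) (cong suc (length-++ Y₁)))

      by-split : (∃₂ λ Y₁ Y₂ → Y ≡ Y₁ ++ Y₂ × All Fits Y₁ × (Y₂ ≡ [] ⊎ ∃₂ λ y Y₃ → Y₂ ≡ y ∷ Y₃ × ¬ Fits y)) → length chain + τ ≤ m
      by-split ([] , _ , eq , _ , inj₁ refl) = ⊥-elim (nil (↭P.∈-resp-↭ (↭-sym Y↭) (here refl)))
        where nil : x* ∉ Y
              nil m with subst (x* ∈_) eq m
              ... | ()
      -- The reversed chain begins with its largest vertex, the root, and the root is adjacent to
      -- all of S.
      by-split ([] , _ , eq , _ , inj₂ (y , Y₃ , refl , ¬fit)) with subst (ρ ∈_) eq (↭P.∈-resp-↭ (↭-sym Y↭) ρ∈chain)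
      ... | here refl = ⊥-elim (¬fit ρ-fits)
      ... | there m = ⊥-elim (top-root (AllPairs.head (subst (AllPairs (λ a b → Below b a)) eq Y-sorted)) m)
        where
        y∈ : y ∈ chain
        y∈ = on-chain (subst (y ∈_) (sym eq) (here refl))
        top-root : All (λ b → Below b y) Y₃ → ρ ∉ Y₃
        top-root bel m = <⇒≱ (All.lookup bel m) (<⇒≤ (Anc.below (root (chain⊆W y∈) (λ { refl → <-irrefl refl (All.lookup bel m) }))))
      by-split (y ∷ Y₁ , Y₂ , eq , fit , rest) with τ ≤? suc (length Y₁)
      -- At least τ chain vertices are adjacent to all of S: one member of S starts the path, and τ
      -- - 1 more fit between these vertices.
      by-split (y ∷ Y₁ , Y₂ , eq , fit , rest) | yes τ≤ = pick S refl
        where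
        pick : ∀ S′ → S′ ≡ S → length chain + τ ≤ m
        pick [] e = ⊥-elim (<⇒≱ 1≤τ (subst (λ l → τ ≤ length l) (sym e) τ≤S))
        pick (s ∷ ss) refl = rearrange y Y₁ Y₂ eq {1} {length ss}
          (≤-trans (⊓-glb τ≤S τ≤) ≤-refl)
          (assemble s [] ss y Y₁ Y₂ eq fit there (AllPairs.tail uS) ([] ∷ []) ([] ∷ [])
            (λ { (here refl) → inner (proj₁ (hS (here refl))) , proj₁ (proj₂ (hS (here refl)))
                             , E-sym (All.head (All.head fit)) , All≢⇒∉ (AllPairs.head uS) }))
      -- Now the whole chain has fewer than τ vertices, but a member of S has depth at least τ and
      -- the chain belongs to a vertex of maximal depth.
      by-split (y ∷ Y₁ , .[] , eq , fit , inj₁ refl) | no τ≰ = pick S refl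
        where
        pick : ∀ S′ → S′ ≡ S → length chain + τ ≤ m
        pick [] e = ⊥-elim (<⇒≱ 1≤τ (subst (λ l → τ ≤ length l) (sym e) τ≤S))
        pick (s ∷ ss) refl = ⊥-elim (τ≰ (≤-trans (proj₂ (proj₂ (hS (here refl))))
          (≤-trans (max-dep (proj₁ (hS (here refl)))) (≤-trans (n≤1+n _)
            (≤-reflexive (trans (sym (length-reverse chain)) (trans (cong length eq) (cong suc (cong length (++-identityʳ Y₁))))))))))
      -- Counted from the root, z is the first chain vertex that misses some s in S. By compression
      -- the chain ancestors of s all come before z, so enough of its τ ancestors lie off the chain.
      -- With s they form the clique `Es`, which starts the path and makes up for the short common
      -- part.
      by-split (y ∷ Y₁ , .(z ∷ Y₃) , eq , fit , inj₂ (z , Y₃ , refl , ¬fit)) | no τ≰ = diverge (AllP.¬All⇒Any¬ (λ s → adj G z s Bool.≟ true) S ¬fit)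
        where
        in-Y : ∀ {a} → a ∈ (y ∷ Y₁) ++ z ∷ Y₃ → a ∈ chain
        in-Y m = on-chain (subst (_ ∈_) (sym eq) m)
        z∈ : z ∈ chain
        z∈ = in-Y (∈-++⁺ʳ (y ∷ Y₁) (here refl))
        lower : ∀ {a} → a ∈ Y₃ → Below a z
        lower m = All.lookup (AllPairs.head (proj₂ (AllPairs-++⁻ (y ∷ Y₁) (subst (AllPairs (λ a b → Below b a)) eq Y-sorted)))) m
        diverge : Any.Any (λ s → ¬ E z s) S → length chain + τ ≤ m
        diverge any with find any
        ... | s , s∈S , ¬zs = rearrange y Y₁ (z ∷ Y₃) eq {length Es} {length ss} enough
            (assemble s (filterᵇ off (anc s)) ss y Y₁ (z ∷ Y₃) eq fit (λ m → proj₁ (∈-filterᵇ⁻ _ S m))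
              (UniqueP.filter⁺ (T? ∘ fresh) uS)
              (All.tabulate (λ m → Anc.linked (own m)) ∷ pairwise (AllPairs.tail uEs) (λ m m′ → anc-adj is (own m) (own m′)))
              uEs facts)
          where
          is = inner (proj₁ (hS s∈S))
          off : Fin n → Bool
          off a = not ⌊ mem? a chain ⌋
          own : ∀ {a} → a ∈ filterᵇ off (anc s) → Anc s a
          own m = anc⁻ (proj₁ (∈-filterᵇ⁻ off (anc s) m))
          Es = s ∷ filterᵇ off (anc s)
          uEs : Unique Es
          uEs = ∉⇒All≢ (λ m → <-irrefl refl (Anc.below (own m))) ∷ UniqueP.filter⁺ (T? ∘ off) (sorted-unique (anc-sorted s))
          fresh : Fin n → Bool
          fresh a = not ⌊ mem? a Es ⌋
          ss = filterᵇ fresh S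
          ys : Anc s y
          ys = below-chain s∈S (in-Y (here refl)) (All.lookup (All.head fit) s∈S)
          not-mem : ∀ {a l} → not ⌊ mem? a l ⌋ ≡ true → a ∉ l
          not-mem {a} {l} e m = true≢false (trans (sym (⌊⌋-intro (mem? a l) m)) (not-true e))
          facts : ∀ {a} → a ∈ Es → Inner u v a × a ∉ chain × E a y × a ∉ ss
          facts {a} m = i m , o m , ay m , λ m′ → not-mem (proj₂ (∈-filterᵇ⁻ fresh S m′)) m
            where
            i : ∀ {a} → a ∈ Es → Inner u v a
            i (here refl) = is
            i (there m) = Anc.inner (own m)
            o : ∀ {a} → a ∈ Es → a ∉ chain
            o (here refl) = proj₁ (proj₂ (hS s∈S))
            o (there m) = not-mem (proj₂ (∈-filterᵇ⁻ off (anc s) m))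
            ay : ∀ {a} → a ∈ Es → E a y
            ay (here refl) = Anc.linked ys
            ay (there m) = anc-adj is (own m) ys (λ { refl → o (there m) (in-Y (here refl)) })
          on : Fin n → Bool
          on a = not (off a)
          early : ∀ {a} → a ∈ filterᵇ on (anc s) → a ∈ y ∷ Y₁
          early {a} m with ∈-filterᵇ⁻ on (anc s) m
          ... | ma , e with ∈-++⁻ (y ∷ Y₁) (subst (a ∈_) eq (↭P.∈-resp-↭ (↭-sym Y↭) (⌊⌋-true (mem? a chain) (trans (sym (not-involutive _)) e))))
          ...   | inj₁ m′ = m′
          ...   | inj₂ (here refl) = ⊥-elim (¬zs (E-sym (Anc.linked (anc⁻ ma))))
          ...   | inj₂ (there m′) = ⊥-elim (¬zs (cmp (inner (chain⊆W z∈)) (Anc.inner (anc⁻ ma)) (lower m′)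
                   (chain-adj z∈ (in-Y (∈-++⁺ʳ (y ∷ Y₁) (there m′))) (Below-≢ (lower m′) ∘ sym))
                   (λ { refl → proj₁ (proj₂ (hS s∈S)) z∈ }) (E-sym (Anc.linked (anc⁻ ma)))))
          many : suc τ ≤ length Es + suc (length Y₁)
          many = s≤s (≤-trans (proj₂ (proj₂ (hS s∈S))) (≤-trans (≤-reflexive (count-split off (anc s)))
            (+-monoʳ-≤ (count off (anc s)) (unique-⊆-length (UniqueP.filter⁺ (T? ∘ on) (sorted-unique (anc-sorted s))) early))))
          cover : τ ≤ length Es + length ss
          cover = ≤-trans τ≤S (subst (length S ≤_) (length-++ Es) (unique-⊆-length uS place))
            where
            place : ∀ {a} → a ∈ S → a ∈ Es ++ ss
            place {a} m = by-mem (mem? a Es)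
              where
              by-mem : Dec (a ∈ Es) → a ∈ Es ++ ss
              by-mem (yes m′) = ∈-++⁺ˡ m′
              by-mem (no ∉′) = ∈-++⁺ʳ Es (∈-filterᵇ⁺ fresh m (cong not (⌊⌋-false (mem? a Es) ∉′)))
          enough : τ ≤ length Es + length ss ⊓ length Y₁
          enough = ≤-+-⊓ (length Es) cover (s≤s⁻¹ (subst (suc τ ≤_) (+-suc (length Es) _) many))

-- Peeling off components, with the case of equality

record GoodList {n} (G : Graph n) (m : ℕ) (W : List (Fin n)) (b : ℕ) : Set where
  field
    label   : Fin n → ℕ
    label≤  : ∀ x → label x ≤ b
    nocross : ∀ {x y} → x ∈ W → y ∈ W → Adj (adj G) x y → label x ≡ label y
    clique  : ∀ {x y} → x ∈ W → y ∈ W → x ≢ y → label x ≡ label y → label x < b → Adj (adj G) x y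
    size    : ∀ i → i < b → count (λ x → ⌊ label x ≟ℕ i ⌋) W ≡ m

sorted-max : ∀ {n} {w : Fin n} {W} → AllPairs (λ x y → toℕ x < toℕ y) (w ∷ W) →
  ∃ λ ρ → ρ ∈ w ∷ W × (∀ {x} → x ∈ w ∷ W → x ≢ ρ → toℕ x < toℕ ρ)
sorted-max {w = w} {[]} _ = w , here refl , λ { (here refl) ne → ⊥-elim (ne refl) }
sorted-max {w = w} {_ ∷ _} (w< ∷ so) with sorted-max so
... | ρ , m , h = ρ , there m , λ { (here refl) _ → All.lookup w< m ; (there m′) ne → h m′ ne }

count-cong : ∀ {p q : A → Bool} l → (∀ {x} → x ∈ l → p x ≡ q x) → count p l ≡ count q l
count-cong l e = cong length (filterᵇ-cong l e)

count-parts : ∀ (p c : A → Bool) l → count p l ≡ count p (filterᵇ c l) + count p (filterᵇ (not ∘ c) l)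
count-parts p c [] = refl
count-parts p c (x ∷ l) with c x
... | true with p x
...   | true  = cong suc (count-parts p c l)
...   | false = count-parts p c l
count-parts p c (x ∷ l) | false with p x
...   | true  = trans (cong suc (count-parts p c l)) (sym (+-suc _ _))
...   | false = count-parts p c l

count-full : ∀ {p : A → Bool} l → (∀ {x} → x ∈ l → p x ≡ true) → count p l ≡ length l
count-full [] h = refl
count-full {p = p} (x ∷ l) h rewrite h {x} (here refl) = cong suc (count-full l (h ∘ there))

count-empty : ∀ {p : A → Bool} l → (∀ {x} → x ∈ l → p x ≡ false) → count p l ≡ 0
count-empty [] h = refl
count-empty {p = p} (x ∷ l) h rewrite h {x} (here refl) = count-empty l (h ∘ there)

module Extremal {n} (G : Graph n) (u v : Fin n) (m′ σ : ℕ) (σ≤m′ : σ ≤ m′) (u≢v : u ≢ v)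
  (dom : Dominated G u v (suc m′)) (cmp : Compressed G u v) where

  open Peel G u v m′ σ σ≤m′ u≢v dom cmp

  private
    mf = weight-mono σ
    top = weight-top σ σ≤m′

    F-super : ∀ a b → F f m′ a + F f m′ b ≤ F f m′ (a + b)
    F-super = Periodic.F-super f m′ mf top

    off-chain : List (Fin n) → Fin n → Bool
    off-chain l a = not ⌊ mem? a l ⌋

    off-chain⁻ : ∀ {l a} → off-chain l a ≡ true → a ∉ l
    off-chain⁻ {l} {a} e m = true≢false (trans (sym (⌊⌋-intro (mem? a l) m)) (not-true e))

    on-chain⁺ : ∀ {l a} → a ∈ l → not (off-chain l a) ≡ true
    on-chain⁺ {l} {a} m = trans (not-involutive _) (⌊⌋-intro (mem? a l) m)

    on-chain⁻ : ∀ {l a} → not (off-chain l a) ≡ true → a ∈ l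
    on-chain⁻ {l} {a} e = ⌊⌋-true (mem? a l) (trans (sym (not-involutive _)) e)

  Complete : List (Fin n) → Set
  Complete W = ∀ {x y} → x ∈ W → y ∈ W → x ≢ y → E x y

  module _ {W ρ} (comp : Component W ρ) {x* : Fin n} (x*∈W : x* ∈ W) (max-dep : ∀ {z} → z ∈ W → dep z ≤ dep x*)
    (m≤W : m ≤ length W) where
    open Component comp
    open Chained comp x*∈W max-dep

    private
      r = dep x*
      off = off-chain chain
      On = filterᵇ (not ∘ off) W
      Off = filterᵇ off W

      W-unique : Unique W
      W-unique = sorted-unique sorted

      on-W : ∀ {x} → x ∈ On → x ∈ chain
      on-W m = on-chain⁻ {chain} (proj₂ (∈-filterᵇ⁻ (not ∘ off) W m))

      chain-On : ∀ {x} → x ∈ chain → x ∈ On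
      chain-On m = ∈-filterᵇ⁺ (not ∘ off) (chain⊆W m) (on-chain⁺ m)

      On-length : length On ≡ suc r
      On-length = ≤-antisym (unique-⊆-length (UniqueP.filter⁺ (T? ∘ not ∘ off) W-unique) on-W)
        (unique-⊆-length chain-unique chain-On)

      W-length : length W ≡ length Off + suc r
      W-length = trans (count-split off W) (cong (length Off +_) On-length)

      Off⁻ : ∀ {x} → x ∈ Off → x ∈ W × x ∉ chain
      Off⁻ m with ∈-filterᵇ⁻ off W m
      ... | mW , e = mW , off-chain⁻ e

      On-total : total (f ∘ dep) On ≤ S f (suc r)
      On-total = subst (λ z → total (f ∘ dep) On ≤ S f z) On-length
        (total≤S On (filter-sorted (not ∘ off) sorted) (λ m a → chain-On (chain-anc (on-W m) a)))

      r≤m′ : r ≤ m′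
      r≤m′ = s≤s⁻¹ (free (clique-linked (AllPairs.head cl) (AllPairs.tail cl)) chain-unique (All.tabulate (inner ∘ chain⊆W)))
        where
        cl : AllPairs E chain
        cl = pairwise chain-unique chain-adj

      -- The chain has m vertices already. A further vertex of the component would have the root as
      -- an ancestor, and `weave` with τ = 1 would exceed m.
      spanning : r ≡ m′ → length W ≡ m × Complete W
      spanning e = by-rest Off refl
        where
        by-rest : ∀ l → l ≡ Off → length W ≡ m × Complete W
        by-rest [] eq = len , λ m₁ m₂ → chain-adj (cover m₁) (cover m₂)
          where
          len : length W ≡ m
          len = trans W-length (cong₂ _+_ (cong length (sym eq)) (cong suc e))
          cover : ∀ {x} → x ∈ W → x ∈ chain
          cover = unique-⊇ chain-unique chain⊆W (≤-reflexive (trans len (cong suc (sym e))))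
        by-rest (z ∷ l) eq = ⊥-elim (<⇒≱ (n<1+n m) (subst (_≤ m) (trans (+-comm (suc r) 1) (cong (suc ∘ suc) e))
            (weave (z ∷ []) 1 ≤-refl ([] ∷ []) (λ { (here refl) → proj₁ z-off , proj₂ z-off , z-dep }) ≤-refl)))
          where
          z-off : z ∈ W × z ∉ chain
          z-off = Off⁻ (subst (z ∈_) eq (here refl))
          z-dep : 1 ≤ dep z
          z-dep = ∈-length (anc⁺ (root (proj₁ z-off) (λ { refl → proj₂ z-off ρ∈chain })))

      -- By `weave` with t + 1, at most t vertices off the chain are deeper than t = m′ - r. Exactly
      -- t of them are charged f(r), shallower ones filling up the places left over, which only
      -- raises the bound; the other q are charged f(min(t, r)).
      short : ∀ t₀ → r + suc t₀ ≡ m′ → total (f ∘ dep) W < F f m′ (length W)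
      short t₀ e = begin-strict
        total (f ∘ dep) W                                              ≡⟨ total-split (f ∘ dep) off W ⟩
        total (f ∘ dep) Off + total (f ∘ dep) On                       ≤⟨ +-mono-≤ Off-total On-total ⟩
        (t * f r + q * f a) + S f (suc r)                              ≡⟨ lem (t * f r) (q * f a) (S f (suc r)) ⟩
        S f (suc r) + t * f r + q * f a                                <⟨ Periodic.component-bound f m′ mf top (weight-convex σ) (weight-convex-top σ σ≤m′) r t₀ q e ⟩
        F f m′ (m + q)                                                 ≡⟨ cong (F f m′) (sym m+q) ⟩
        F f m′ (length W) ∎
        where
        open ≤-Reasoning
        t = suc t₀
        a = t ⊓ r
        lem : ∀ x y z → (x + y) + z ≡ z + x + y
        lem = solve-∀
        t+sr : t + suc r ≡ m
        t+sr = trans (+-comm t (suc r)) (cong suc e)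
        t≤Off : t ≤ length Off
        t≤Off = +-cancelʳ-≤ (suc r) t (length Off) (subst₂ _≤_ (sym t+sr) W-length m≤W)
        q = length Off ∸ t
        m+q : length W ≡ m + q
        m+q = trans W-length (trans (cong (_+ suc r) (sym (m+[n∸m]≡n t≤Off))) (trans (+-right-swap t q (suc r)) (cong (_+ q) t+sr)))
        deepᵇ : Fin n → Bool
        deepᵇ x = ⌊ t <? dep x ⌋
        High = filterᵇ deepᵇ Off
        Low = filterᵇ (not ∘ deepᵇ) Off
        f-mono : ∀ {i j} → i ≤ j → f i ≤ f j
        f-mono = mono-≤ {f} mf
        High≤t : length High ≤ t
        High≤t = ≮⇒≥ (λ lt → <⇒≱ (n<1+n m) (subst (_≤ m) too-long
            (weave High (suc t) (s≤s z≤n) (UniqueP.filter⁺ (T? ∘ deepᵇ) (UniqueP.filter⁺ (T? ∘ off) W-unique)) facts lt)))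
          where
          too-long : suc r + suc t ≡ suc m
          too-long = trans (+-comm (suc r) (suc t)) (cong suc t+sr)
          facts : ∀ {s} → s ∈ High → s ∈ W × s ∉ chain × suc t ≤ dep s
          facts {s} m with ∈-filterᵇ⁻ deepᵇ Off m
          ... | mO , d = proj₁ (Off⁻ mO) , proj₂ (Off⁻ mO) , ⌊⌋-true (t <? dep s) d
        e′ = t ∸ length High
        h+e′ : length High + e′ ≡ t
        h+e′ = m+[n∸m]≡n High≤t
        Low-length : length Low ≡ e′ + q
        Low-length = +-cancelˡ-≡ (length High) _ _ (trans (sym (count-split deepᵇ Off))
          (trans (sym (m+[n∸m]≡n t≤Off)) (trans (cong (_+ q) (sym h+e′)) (+-assoc (length High) e′ q))))
        High-total : total (f ∘ dep) High ≤ length High * f r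
        High-total = total-≤ (f ∘ dep) (f r) High (λ m → f-mono (max-dep (proj₁ (Off⁻ (proj₁ (∈-filterᵇ⁻ deepᵇ Off m))))))
        Low-total : total (f ∘ dep) Low ≤ (e′ + q) * f a
        Low-total = subst (λ z → total (f ∘ dep) Low ≤ z * f a) Low-length (total-≤ (f ∘ dep) (f a) Low low)
          where
          low : ∀ {x} → x ∈ Low → f (dep x) ≤ f a
          low {x} m with ∈-filterᵇ⁻ (not ∘ deepᵇ) Off m
          ... | mO , d = f-mono (⊓-glb (≮⇒≥ (λ lt → true≢false (trans (sym (⌊⌋-intro (t <? dep x) lt)) (not-true d)))) (max-dep (proj₁ (Off⁻ mO))))
        Off-total : total (f ∘ dep) Off ≤ t * f r + q * f a
        Off-total = begin
          total (f ∘ dep) Off                                ≡⟨ total-split (f ∘ dep) deepᵇ Off ⟩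
          total (f ∘ dep) High + total (f ∘ dep) Low         ≤⟨ +-mono-≤ High-total Low-total ⟩
          length High * f r + (e′ + q) * f a                 ≡⟨ l₁ (length High) (f r) e′ q (f a) ⟩
          length High * f r + e′ * f a + q * f a             ≤⟨ +-monoˡ-≤ (q * f a) (+-monoʳ-≤ (length High * f r) (*-monoʳ-≤ e′ (f-mono (m⊓n≤n t r)))) ⟩
          length High * f r + e′ * f r + q * f a             ≡⟨ cong (_+ q * f a) (trans (sym (*-distribʳ-+ (f r) (length High) e′)) (cong (_* f r) h+e′)) ⟩
          t * f r + q * f a ∎
          where
          l₁ : ∀ h x e q y → h * x + (e + q) * y ≡ h * x + e * y + q * y
          l₁ = solve-∀

    clique-or-fewer : (length W ≡ m × Complete W) ⊎ total (f ∘ dep) W < F f m′ (length W)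
    clique-or-fewer = by-depth (m′ ∸ r) (m+[n∸m]≡n r≤m′)
      where
      by-depth : ∀ t → r + t ≡ m′ → (length W ≡ m × Complete W) ⊎ total (f ∘ dep) W < F f m′ (length W)
      by-depth zero e = inj₁ (spanning (trans (sym (+-identityʳ r)) e))
      by-depth (suc t₀) e = inj₂ (short t₀ e)

  record Closed (W : List (Fin n)) : Set where
    field
      sorted : Sorted W
      inner  : ∀ {x} → x ∈ W → Inner u v x
      closed : ∀ {x y} → x ∈ W → Inner u v y → E x y → y ∈ W

  -- The structure in the case of equality travels with the inequality: equality for W forces
  -- equality for what is left after a component is removed.
  Bound : List (Fin n) → Set
  Bound W = total (f ∘ dep) W ≤ F f m′ (length W) × (total (f ∘ dep) W ≡ F f m′ (length W) → GoodList G m W (length W / m))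

  module Split (W : List (Fin n)) (cw : Closed W) (ρ : Fin n) (ρ∈W : ρ ∈ W) (ρ-max : ∀ {x} → x ∈ W → x ≢ ρ → Below x ρ) where
    open Closed cw

    c : Fin n → Bool
    c y = ⌊ y ≟ ρ ⌋ ∨ adj G ρ y

    Z = filterᵇ c W
    Z′ = filterᵇ (not ∘ c) W

    Z⁻ : ∀ {x} → x ∈ Z → x ∈ W × c x ≡ true
    Z⁻ = ∈-filterᵇ⁻ c W

    Z′⁻ : ∀ {x} → x ∈ Z′ → x ∈ W × c x ≡ false
    Z′⁻ m with ∈-filterᵇ⁻ (not ∘ c) W m
    ... | mW , e = mW , not-true e

    -- The closed neighbourhood of the largest vertex ρ is a whole component: a neighbour x of ρ is
    -- smaller, so by compression ρ sees everything that x sees.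
    c-closed : ∀ {x y} → x ∈ W → c x ≡ true → Inner u v y → E x y → c y ≡ true
    c-closed {x} {y} mx cx iy e with ∨-true ⌊ x ≟ ρ ⌋ _ cx
    ... | inj₁ x≡ρ = ∨-trueʳ ⌊ y ≟ ρ ⌋ (subst (λ z → E z y) (⌊⌋-true (x ≟ ρ) x≡ρ) e)
    ... | inj₂ ρx with ≡-or-≢ y ρ
    ...   | inj₁ y≡ρ = ∨-trueˡ _ (⌊⌋-intro (y ≟ ρ) y≡ρ)
    ...   | inj₂ y≢ρ = ∨-trueʳ ⌊ y ≟ ρ ⌋ (cmp (inner ρ∈W) (inner mx) (ρ-max mx (Adj-≢ {G = G} ρx ∘ sym)) ρx y≢ρ e)

    comp : Component Z ρ
    comp = record
      { sorted = filter-sorted c sorted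
      ; inner = inner ∘ proj₁ ∘ Z⁻
      ; closed = λ m iy e → ∈-filterᵇ⁺ c (closed (proj₁ (Z⁻ m)) iy e) (c-closed (proj₁ (Z⁻ m)) (proj₂ (Z⁻ m)) iy e)
      ; ρ∈W = ∈-filterᵇ⁺ c ρ∈W (∨-trueˡ _ (⌊⌋-intro (ρ ≟ ρ) refl))
      ; root = to-root }
      where
      to-root : ∀ {x} → x ∈ Z → x ≢ ρ → Anc x ρ
      to-root {x} m ne with ∨-true ⌊ x ≟ ρ ⌋ _ (proj₂ (Z⁻ m))
      ... | inj₁ x≡ρ = ⊥-elim (ne (⌊⌋-true (x ≟ ρ) x≡ρ))
      ... | inj₂ ρx = mkAnc (inner ρ∈W) (ρ-max (proj₁ (Z⁻ m)) ne) (E-sym ρx)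

    closed′ : Closed Z′
    closed′ = record
      { sorted = filter-sorted (not ∘ c) sorted
      ; inner = inner ∘ proj₁ ∘ Z′⁻
      ; closed = λ m iy e → ∈-filterᵇ⁺ (not ∘ c) (closed (proj₁ (Z′⁻ m)) iy e)
          (cong not (≢true (λ cy → true≢false (trans (sym (c-closed (closed (proj₁ (Z′⁻ m)) iy e) cy (inner (proj₁ (Z′⁻ m))) (E-sym e))) (proj₂ (Z′⁻ m)))))) }

    W-length : length W ≡ length Z + length Z′
    W-length = count-split c W

    W-total : total (f ∘ dep) W ≡ total (f ∘ dep) Z + total (f ∘ dep) Z′
    W-total = total-split (f ∘ dep) c W

    in-Z : ∀ {x} → x ∈ W → c x ≡ true → x ∈ Z
    in-Z = ∈-filterᵇ⁺ c

    in-Z′ : ∀ {x} → x ∈ W → c x ≡ false → x ∈ Z′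
    in-Z′ m e = ∈-filterᵇ⁺ (not ∘ c) m (cong not e)

    same-side : ∀ {x y} → x ∈ W → y ∈ W → E x y → c x ≡ c y
    same-side mx my e = bool-≡ (λ cx → c-closed mx cx (inner my) e) (λ cy → c-closed my cy (inner mx) (E-sym e))

    relabel : (ℕ → ℕ) → ℕ → (Fin n → ℕ) → Fin n → ℕ
    relabel h i l x = if c x then i else h (l x)

    relabel-Z : ∀ {h i l x} → c x ≡ true → relabel h i l x ≡ i
    relabel-Z e rewrite e = refl

    relabel-Z′ : ∀ {h i l x} → c x ≡ false → relabel h i l x ≡ h (l x)
    relabel-Z′ e rewrite e = refl

    -- Z joins the last label b. As that label carries no clique or size condition, any number of
    -- small components can share it.
    small-block : ∀ {b} → GoodList G m Z′ b → GoodList G m W b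
    small-block {b} gl = record
      { label = lab ; label≤ = lab≤ ; nocross = nocross′ ; clique = clique′
      ; size = λ i lt → trans (count-parts _ c W) (trans (cong₂ _+_
          (count-empty Z (λ {x} m → trans (cong (λ z → ⌊ z ≟ℕ i ⌋) (on-Z (proj₂ (Z⁻ m)))) (⌊⌋-false (b ≟ℕ i) (λ e → <-irrefl (sym e) lt))))
          (count-cong Z′ (λ m → cong (λ z → ⌊ z ≟ℕ i ⌋) (on-Z′ (proj₂ (Z′⁻ m)))))) (size i lt)) }
      where
      open GoodList gl
      lab = relabel id b label
      on-Z : ∀ {x} → c x ≡ true → lab x ≡ b
      on-Z = relabel-Z {id} {b} {label}
      on-Z′ : ∀ {x} → c x ≡ false → lab x ≡ label x
      on-Z′ = relabel-Z′ {id} {b} {label}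
      lab≤ : ∀ x → lab x ≤ b
      lab≤ x with c x
      ... | true = ≤-refl
      ... | false = label≤ x
      nocross′ : ∀ {x y} → x ∈ W → y ∈ W → E x y → lab x ≡ lab y
      nocross′ {x} {y} mx my e = by-side (Bool-dec (c x)) (same-side mx my e)
        where
        by-side : c x ≡ true ⊎ c x ≡ false → c x ≡ c y → lab x ≡ lab y
        by-side (inj₁ cx) s = trans (on-Z cx) (sym (on-Z (trans (sym s) cx)))
        by-side (inj₂ cx) s = trans (on-Z′ cx) (trans (nocross (in-Z′ mx cx) (in-Z′ my (trans (sym s) cx)) e) (sym (on-Z′ (trans (sym s) cx))))
      clique′ : ∀ {x y} → x ∈ W → y ∈ W → x ≢ y → lab x ≡ lab y → lab x < b → E x y
      clique′ {x} {y} mx my ne l lt = by-side (Bool-dec (c x)) (Bool-dec (c y))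
        where
        by-side : c x ≡ true ⊎ c x ≡ false → c y ≡ true ⊎ c y ≡ false → E x y
        by-side (inj₁ cx) _ = ⊥-elim (<-irrefl (on-Z cx) lt)
        by-side (inj₂ _) (inj₁ cy) = ⊥-elim (<-irrefl (trans l (on-Z cy)) lt)
        by-side (inj₂ cx) (inj₂ cy) = clique (in-Z′ mx cx) (in-Z′ my cy) ne
          (trans (sym (on-Z′ cx)) (trans l (on-Z′ cy))) (subst (_< b) (on-Z′ cx) lt)

    -- Z takes the label 0 and all other labels move up by one, so the remainder still has the last
    -- label.
    full-block : ∀ {b} → length Z ≡ m → Complete Z → GoodList G m Z′ b → GoodList G m W (suc b)
    full-block {b} len complete gl = record
      { label = lab ; label≤ = lab≤ ; nocross = nocross′ ; clique = clique′ ; size = size′ }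
      where
      open GoodList gl
      lab = relabel suc 0 label
      on-Z : ∀ {x} → c x ≡ true → lab x ≡ 0
      on-Z = relabel-Z {suc} {0} {label}
      on-Z′ : ∀ {x} → c x ≡ false → lab x ≡ suc (label x)
      on-Z′ = relabel-Z′ {suc} {0} {label}
      lab≤ : ∀ x → lab x ≤ suc b
      lab≤ x with c x
      ... | true = z≤n
      ... | false = s≤s (label≤ x)
      nocross′ : ∀ {x y} → x ∈ W → y ∈ W → E x y → lab x ≡ lab y
      nocross′ {x} {y} mx my e = by-side (Bool-dec (c x)) (same-side mx my e)
        where
        by-side : c x ≡ true ⊎ c x ≡ false → c x ≡ c y → lab x ≡ lab y
        by-side (inj₁ cx) s = trans (on-Z cx) (sym (on-Z (trans (sym s) cx)))
        by-side (inj₂ cx) s = trans (on-Z′ cx) (trans (cong suc (nocross (in-Z′ mx cx) (in-Z′ my (trans (sym s) cx)) e)) (sym (on-Z′ (trans (sym s) cx))))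
      clique′ : ∀ {x y} → x ∈ W → y ∈ W → x ≢ y → lab x ≡ lab y → lab x < suc b → E x y
      clique′ {x} {y} mx my ne l lt = by-side (Bool-dec (c x)) (Bool-dec (c y))
        where
        by-side : c x ≡ true ⊎ c x ≡ false → c y ≡ true ⊎ c y ≡ false → E x y
        by-side (inj₁ cx) (inj₁ cy) = complete (in-Z mx cx) (in-Z my cy) ne
        by-side (inj₁ cx) (inj₂ cy) = ⊥-elim (0≢1+n (trans (sym (on-Z cx)) (trans l (on-Z′ cy))))
        by-side (inj₂ cx) (inj₁ cy) = ⊥-elim (0≢1+n (trans (sym (on-Z cy)) (trans (sym l) (on-Z′ cx))))
        by-side (inj₂ cx) (inj₂ cy) = clique (in-Z′ mx cx) (in-Z′ my cy) ne
          (suc-injective (trans (sym (on-Z′ cx)) (trans l (on-Z′ cy)))) (s≤s⁻¹ (subst (_< suc b) (on-Z′ cx) lt))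
      size′ : ∀ i → i < suc b → count (λ x → ⌊ lab x ≟ℕ i ⌋) W ≡ m
      size′ zero lt = trans (count-parts _ c W) (trans (cong₂ _+_
        (trans (count-full Z (λ m → ⌊⌋-intro (_ ≟ℕ 0) (on-Z (proj₂ (Z⁻ m))))) len)
        (count-empty Z′ (λ m → ⌊⌋-false (_ ≟ℕ 0) (λ e → 0≢1+n (trans (sym e) (on-Z′ (proj₂ (Z′⁻ m)))))))) (+-identityʳ _))
      size′ (suc i) (s≤s lt) = trans (count-parts _ c W) (trans (cong₂ _+_
        (count-empty Z (λ m → ⌊⌋-false (_ ≟ℕ suc i) (λ e → 0≢1+n (trans (sym (on-Z (proj₂ (Z⁻ m)))) e))))
        (count-cong Z′ (λ {x} m → bool-≡
          (λ e → ⌊⌋-intro (label x ≟ℕ i) (suc-injective (trans (sym (on-Z′ (proj₂ (Z′⁻ m)))) (⌊⌋-true (lab x ≟ℕ suc i) e))))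
          (λ e → ⌊⌋-intro (lab x ≟ℕ suc i) (trans (on-Z′ (proj₂ (Z′⁻ m))) (cong suc (⌊⌋-true (label x ≟ℕ i) e)))))))
        (size i lt))

    combine : Bound Z′ → Bound W
    combine (le′ , eq′) with length Z <? m
    ... | yes lt = subst₂ _≤_ (sym W-total) (cong (F f m′) (sym W-length)) (≤-trans sum≤ (F-super (length Z) (length Z′)))
                 , λ e → subst (GoodList G m W) (sym (same-quotient′ e)) (small-block (eq′ (tight e)))
      where
      Z≤ : total (f ∘ dep) Z ≤ F f m′ (length Z)
      Z≤ = ≤-trans (total≤S Z (Component.sorted comp) (λ m a → Component.closed comp m (Anc.inner a) (Anc.linked a)))
        (≤-reflexive (sym (Periodic.F-small f m′ (<⇒≤ lt))))
      sum≤ : total (f ∘ dep) Z + total (f ∘ dep) Z′ ≤ F f m′ (length Z) + F f m′ (length Z′)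
      sum≤ = +-mono-≤ Z≤ le′
      module _ (e : total (f ∘ dep) W ≡ F f m′ (length W)) where
        e′ : F f m′ (length Z + length Z′) ≡ total (f ∘ dep) Z + total (f ∘ dep) Z′
        e′ = trans (cong (F f m′) (sym W-length)) (trans (sym e) W-total)
        tight : total (f ∘ dep) Z′ ≡ F f m′ (length Z′)
        tight = ≤-antisym le′ (+-cancelˡ-≤ (total (f ∘ dep) Z) _ _ (≤-trans (+-monoˡ-≤ _ Z≤)
          (≤-trans (F-super (length Z) (length Z′)) (≤-reflexive e′))))
        -- Otherwise the two remainders could fill another block, and `F-super-strict` would
        -- contradict equality. Hence removing Z leaves the quotient by m, the number of full
        -- classes, as it was.
        no-overflow : length Z % m + length Z′ % m < m
        no-overflow = ≰⇒> (λ ge → <⇒≱ (Periodic.F-super-strict f m′ mf top (length Z) (length Z′) ge) (≤-trans (≤-reflexive e′) sum≤))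
        same-quotient′ : length W / m ≡ length Z′ / m
        same-quotient′ = trans (cong (_/ m) W-length) (trans (+-distrib-/ (length Z) (length Z′) no-overflow) (cong (_+ length Z′ / m) (m<n⇒m/n≡0 lt)))
    ... | no ¬lt with deepest comp
    ...   | x* , x*∈Z , max-dep with clique-or-fewer comp x*∈Z max-dep (≮⇒≥ ¬lt)
    ...     | inj₂ fewer = <⇒≤ strict , λ e → ⊥-elim (<-irrefl e strict)
      where
      strict : total (f ∘ dep) W < F f m′ (length W)
      strict = subst₂ _<_ (sym W-total) (cong (F f m′) (sym W-length)) (<-≤-trans (+-mono-<-≤ fewer le′) (F-super (length Z) (length Z′)))
    ...     | inj₁ (len , complete) = ≤-trans (≤-reflexive W-total) (≤-trans (+-mono-≤ Z≤ le′) (≤-reflexive (sym period)))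
                 , (λ e → subst (GoodList G m W) (sym quotient) (full-block len complete (eq′ (tight e))))
      where
      Z≤ : total (f ∘ dep) Z ≤ S f m
      Z≤ = subst (λ z → total (f ∘ dep) Z ≤ S f z) len
        (total≤S Z (Component.sorted comp) (λ m a → Component.closed comp m (Anc.inner a) (Anc.linked a)))
      W-length′ : length W ≡ m + length Z′
      W-length′ = trans W-length (cong (_+ length Z′) len)
      period : F f m′ (length W) ≡ S f m + F f m′ (length Z′)
      period = trans (cong (F f m′) W-length′) (Periodic.F-period f m′ (length Z′))
      tight : total (f ∘ dep) W ≡ F f m′ (length W) → total (f ∘ dep) Z′ ≡ F f m′ (length Z′)
      tight e = ≤-antisym le′ (+-cancelˡ-≤ (S f m) _ _
        (≤-trans (≤-reflexive (trans (sym period) (trans (sym e) W-total))) (+-monoˡ-≤ _ Z≤)))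
      quotient : length W / m ≡ suc (length Z′ / m)
      quotient = trans (cong (_/ m) W-length′) (trans (+-distrib-/-∣ˡ {m} (length Z′) ∣-refl) (cong (_+ length Z′ / m) (n/n≡1 m)))

    smaller : length Z′ < length W
    smaller = subst (length Z′ <_) (sym W-length) (m<n+m (length Z′) (∈-length (Component.ρ∈W comp)))

  peel : ∀ fuel W → length W < fuel → Closed W → Bound W
  peel zero W () cw
  peel (suc fuel) [] lt cw = z≤n , λ _ → record
    { label = λ _ → 0 ; label≤ = λ _ → z≤n ; nocross = λ () ; clique = λ () ; size = λ i lt → ⊥-elim (none lt) }
    where
    none : ∀ {i} → ¬ i < 0 / m
    none ()
  peel (suc fuel) (w ∷ W) (s≤s lt) cw with sorted-max (Closed.sorted cw)
  ... | ρ , ρ∈W , ρ-max = combine (peel fuel Z′ (<-≤-trans smaller lt) closed′)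
    where open Split (w ∷ W) cw ρ ρ∈W ρ-max

  V-closed : Closed V
  V-closed = record { sorted = V-sorted ; inner = V-inner ; closed = λ _ iy _ → inner-V iy }

  extremal-good : F f m′ (n ∸ 2) ≤ N (3 + σ) G → Good G u v m ((n ∸ 2) / m)
  extremal-good le = subst (λ z → Good G u v m (z / m)) V≡ (record
    { label = label ; label≤ = label≤
    ; nocross = λ ix iy → nocross (inner-V ix) (inner-V iy)
    ; clique = λ ix iy → clique (inner-V ix) (inner-V iy)
    ; joined = λ {x} (xu , xv) _ → by-u x xu , by-v x xv
    ; size = λ i lt → trans (cong length (sym (filterᵇ-∘ (λ x → ⌊ label x ≟ℕ i ⌋) (innerᵇ u v) (allFin n)))) (size i lt) })
    where
    open Dominated dom
    V≡ : length V ≡ n ∸ 2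
    V≡ = cong (_∸ 2) V-length
    bound : Bound V
    bound = peel (suc (length V)) V ≤-refl V-closed
    open GoodList (proj₂ bound (≤-antisym (proj₁ bound) (≤-trans (≤-reflexive (cong (F f m′) V≡)) (≤-trans le N≤total))))

-- Comparison with X_{n,k}

xadj : ℕ → ℕ → ℕ → Bool
xadj m′ i j = not ⌊ i ≟ℕ j ⌋ ∧ (⌊ i <? 2 ⌋ ∨ ⌊ j <? 2 ⌋ ∨ ⌊ (i ∸ 2) / suc m′ ≟ℕ (j ∸ 2) / suc m′ ⌋)

xadj⁺ : ∀ {m′ i j} → i ≢ j → i < 2 ⊎ j < 2 ⊎ (i ∸ 2) / suc m′ ≡ (j ∸ 2) / suc m′ → xadj m′ i j ≡ true
xadj⁺ {m′} {i} {j} ne h = ∧-intro (cong not (⌊⌋-false (i ≟ℕ j) ne)) (by h)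
  where
  by : i < 2 ⊎ j < 2 ⊎ (i ∸ 2) / suc m′ ≡ (j ∸ 2) / suc m′ → ⌊ i <? 2 ⌋ ∨ ⌊ j <? 2 ⌋ ∨ ⌊ (i ∸ 2) / suc m′ ≟ℕ (j ∸ 2) / suc m′ ⌋ ≡ true
  by (inj₁ p) = ∨-trueˡ _ (⌊⌋-intro (i <? 2) p)
  by (inj₂ (inj₁ p)) = ∨-trueʳ ⌊ i <? 2 ⌋ (∨-trueˡ _ (⌊⌋-intro (j <? 2) p))
  by (inj₂ (inj₂ p)) = ∨-trueʳ ⌊ i <? 2 ⌋ (∨-trueʳ ⌊ j <? 2 ⌋ (⌊⌋-intro (_ ≟ℕ _) p))

xadj⁻ : ∀ {m′ i j} → xadj m′ i j ≡ true → i ≢ j × (i < 2 ⊎ j < 2 ⊎ (i ∸ 2) / suc m′ ≡ (j ∸ 2) / suc m′)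
xadj⁻ {m′} {i} {j} e with ∧-true (not ⌊ i ≟ℕ j ⌋) _ e
... | ne , h = (λ i≡j → true≢false (trans (sym (⌊⌋-intro (i ≟ℕ j) i≡j)) (not-true ne)))
             , Sum.map (⌊⌋-true (i <? 2)) (Sum.map (⌊⌋-true (j <? 2)) (⌊⌋-true (_ ≟ℕ _)) ∘ ∨-true ⌊ j <? 2 ⌋ _) (∨-true ⌊ i <? 2 ⌋ _ h)

Xadj-ℕ : ∀ n m′ (i j : Fin n) → Xadj n (3 + m′) i j ≡ xadj m′ (toℕ i) (toℕ j)
Xadj-ℕ n m′ i j = cong (λ b → not b ∧ (⌊ toℕ i <? 2 ⌋ ∨ ⌊ toℕ j <? 2 ⌋ ∨ ⌊ block (3 + m′) i ≟ℕ block (3 + m′) j ⌋))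
  (bool-≡ (λ e → ⌊⌋-intro (toℕ i ≟ℕ toℕ j) (cong toℕ (⌊⌋-true (i ≟ j) e)))
          (λ e → ⌊⌋-intro (i ≟ j) (toℕ-injective (⌊⌋-true (toℕ i ≟ℕ toℕ j) e))))

xadj-sym : ∀ m′ i j → xadj m′ i j ≡ xadj m′ j i
xadj-sym m′ i j = bool-≡ (turn {i} {j}) (turn {j} {i})
  where
  turn : ∀ {i j} → xadj m′ i j ≡ true → xadj m′ j i ≡ true
  turn {i} {j} e with xadj⁻ {m′} {i} {j} e
  ... | ne , inj₁ p = xadj⁺ {m′} {j} {i} (ne ∘ sym) (inj₂ (inj₁ p))
  ... | ne , inj₂ (inj₁ p) = xadj⁺ {m′} {j} {i} (ne ∘ sym) (inj₁ p)
  ... | ne , inj₂ (inj₂ p) = xadj⁺ {m′} {j} {i} (ne ∘ sym) (inj₂ (inj₂ (sym p)))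

map-toℕ-allFin : ∀ n → map toℕ (allFin n) ≡ upTo n
map-toℕ-allFin zero = refl
map-toℕ-allFin (suc n) = trans (cong (map toℕ) (allFin-suc n)) (cong (0 ∷_)
  (trans (sym (map-∘ (allFin n))) (trans (map-∘ (allFin n)) (trans (cong (map suc) (map-toℕ-allFin n)) (map-upTo suc n)))))

block-quotient : ∀ m′ q r → r < suc m′ → (q * suc m′ + r) / suc m′ ≡ q
block-quotient m′ q r lt = trans (+-distrib-/-∣ˡ {q * suc m′} r (n∣m*n q))
  (trans (cong₂ _+_ (m*n/n≡m q (suc m′)) (m<n⇒m/n≡0 lt)) (+-identityʳ q))

-- Listed downwards, each vertex is counted with its smaller neighbours. For vertex 2 + j these form
-- a clique: 0, 1 and the j % m vertices before it in its block, which are the list `witness`.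
X-cliques : ∀ σ m′ j → F (cliqueWeight σ) m′ j ≤ K (xadj m′) (3 + σ) (downFrom (2 + j))
X-cliques σ m′ zero = z≤n
X-cliques σ m′ (suc j) = +-mono-≤ (X-cliques σ m′ j)
  (≤-trans (C-mono (2 + σ) long) (≤-reflexive (sym (K-clique (xadj m′) (2 + σ) nbrs (pairwise nbrs-unique nbrs-adj)))))
  where
  m = suc m′
  nbrs = filterᵇ (xadj m′ (2 + j)) (downFrom (2 + j))
  nbrs-unique : Unique nbrs
  nbrs-unique = UniqueP.filter⁺ (T? ∘ xadj m′ (2 + j)) (UniqueP.downFrom⁺ (2 + j))
  near : ∀ {a} → a ∈ nbrs → a < 2 ⊎ j / m ≡ (a ∸ 2) / m
  near {a} ma with xadj⁻ {m′} {2 + j} {a} (proj₂ (∈-filterᵇ⁻ (xadj m′ (2 + j)) (downFrom (2 + j)) ma))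
  ... | _ , inj₁ (s≤s (s≤s ()))
  ... | _ , inj₂ p = p
  nbrs-adj : ∀ {a b} → a ∈ nbrs → b ∈ nbrs → a ≢ b → xadj m′ a b ≡ true
  nbrs-adj {a} {b} ma mb ne with near ma | near mb
  ... | inj₁ p | _ = xadj⁺ {m′} {a} {b} ne (inj₁ p)
  ... | inj₂ _ | inj₁ p = xadj⁺ {m′} {a} {b} ne (inj₂ (inj₁ p))
  ... | inj₂ p | inj₂ q = xadj⁺ {m′} {a} {b} ne (inj₂ (inj₂ (trans (sym p) q)))
  pos : ℕ → ℕ
  pos t = 2 + (j / m * m + t)
  witness : List ℕ
  witness = 0 ∷ 1 ∷ map pos (upTo (j % m))
  witness-unique : Unique witness
  witness-unique = ((λ ()) ∷ AllP.map⁺ (All.universal (λ _ ()) _)) ∷ AllP.map⁺ (All.universal (λ _ ()) _)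
    ∷ UniqueP.map⁺ (λ {a} {b} e → +-cancelˡ-≡ (2 + j / m * m) a b e) (UniqueP.upTo⁺ (j % m))
  j≡ : j / m * m + j % m ≡ j
  j≡ = Periodic.divMod-≡ (cliqueWeight σ) m′ j
  put : ∀ {a} → a < 2 + j → a < 2 ⊎ j / m ≡ (a ∸ 2) / m → a ∈ nbrs
  put {a} lt h = ∈-filterᵇ⁺ (xadj m′ (2 + j)) (∈-downFrom⁺ lt) (xadj⁺ {m′} {2 + j} {a} (λ e → <-irrefl (sym e) lt) (inj₂ h))
  witness⊆ : ∀ {a} → a ∈ witness → a ∈ nbrs
  witness⊆ (here refl) = put (s≤s z≤n) (inj₁ (s≤s z≤n))
  witness⊆ (there (here refl)) = put (s≤s (s≤s z≤n)) (inj₁ (s≤s (s≤s z≤n)))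
  witness⊆ (there (there ma)) with ∈-map⁻ pos ma
  ... | t , mt , refl = put (+-monoʳ-< 2 (subst (j / m * m + t <_) j≡ (+-monoʳ-< (j / m * m) t<)))
      (inj₂ (sym (block-quotient m′ (j / m) t (<-trans t< (m%n<n j m)))))
    where
    t< : t < j % m
    t< = ∈-upTo⁻ mt
  long : 2 + j % m ≤ length nbrs
  long = subst (_≤ length nbrs) (cong (2 +_) (trans (length-map pos (upTo (j % m))) (length-upTo (j % m))))
    (unique-⊆-length witness-unique witness⊆)

F≤g : ∀ σ m′ n → 2 ≤ n → F (cliqueWeight σ) m′ (n ∸ 2) ≤ g (3 + σ) n (3 + m′)
F≤g σ m′ n 2≤n = begin
  F (cliqueWeight σ) m′ (n ∸ 2)                                 ≤⟨ X-cliques σ m′ (n ∸ 2) ⟩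
  K (xadj m′) (3 + σ) (downFrom (2 + (n ∸ 2)))                  ≡⟨ cong (λ z → K (xadj m′) (3 + σ) (downFrom z)) (m+[n∸m]≡n 2≤n) ⟩
  K (xadj m′) (3 + σ) (downFrom n)                              ≡⟨ K-↭ (xadj m′) (xadj-sym m′) (3 + σ) down↭ ⟩
  K (xadj m′) (3 + σ) (map toℕ (allFin n))                      ≡⟨ K-map (xadj m′) toℕ (3 + σ) (allFin n) ⟩
  K (λ i j → xadj m′ (toℕ i) (toℕ j)) (3 + σ) (allFin n)        ≤⟨ K-mono (3 + σ) (⊆-refl {x = allFin n}) (λ {i} {j} _ _ e → trans (Xadj-ℕ n m′ i j) e) ⟩
  K (Xadj n (3 + m′)) (3 + σ) (allFin n)                        ≡⟨ sym (N≡K (3 + σ) (X n (3 + m′))) ⟩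
  g (3 + σ) n (3 + m′) ∎
  where
  open ≤-Reasoning
  down↭ : downFrom n ↭ map toℕ (allFin n)
  down↭ = ↭-trans (Perm.↭-reflexive (sym (reverse-upTo n))) (↭-trans (↭P.↭-reverse (upTo n)) (Perm.↭-reflexive (sym (map-toℕ-allFin n))))

injective⇒↔ : ∀ {n} (h : Fin n → Fin n) → (∀ {x y} → h x ≡ h y → x ≡ y) → Σ (Fin n ↔ Fin n) λ τ → ∀ x → Inverse.to τ x ≡ h x
injective⇒↔ {n} h inj = mk↔ₛ′ h back (proj₂ ∘ hit) (λ x → inj (proj₂ (hit (h x)))) , λ _ → refl
  where
  hit : ∀ y → ∃ λ x → h x ≡ y
  hit y with any? (λ x → h x ≟ y)
  ... | yes p = p
  ... | no none = ⊥-elim (missed n h inj y (λ x e → none (x , e)))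
    where
    missed : ∀ n (h : Fin n → Fin n) → (∀ {x y} → h x ≡ h y → x ≡ y) → ∀ y → (∀ x → h x ≢ y) → ⊥
    missed (suc n) h inj y miss = 1+n≰n (injective⇒≤ {f = λ x → punchOut (miss x ∘ sym)}
      (λ {x} {x′} e → inj (punchOut-injective (miss x ∘ sym) (miss x′ ∘ sym) e)))
  back : Fin n → Fin n
  back = proj₁ ∘ hit

-- Edge-maximality and the isomorphism with X_{n,k}

module Rigid {n} {M : Graph n} {u v : Fin n} {m′ : ℕ} (uv : Adj (adj M) u v)
  (le : CircLe (adj M) u v (3 + m′))
  (max : ∀ x y → x ≢ y → adj M x y ≡ false → CircGt (addEdge (adj M) x y) u v (3 + m′))
  (good : Good M u v (suc m′) ((n ∸ 2) / suc m′)) where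
  open Good good

  private
    m = suc m′
    β = (n ∸ 2) / m
    u≢v = Adj-≢ {G = M} uv

    inClass : ℕ → Fin n → Bool
    inClass i x = innerᵇ u v x ∧ ⌊ label x ≟ℕ i ⌋

    -- These sets allow the classes to be removed one at a time. After b classes of m vertices each,
    -- n - 2 - bm inner vertices are left, so at b = β the last class is bounded by the remainder.
    from : ℕ → Fin n → Bool
    from b x = innerᵇ u v x ∧ ⌊ b ≤? label x ⌋

    inner-count : count (innerᵇ u v) (allFin n) ≡ n ∸ 2
    inner-count with enumerate₂ u≢v
    ... | l , τ , u∉l , v∉l = trans (↭P.↭-length (filterᵇ-↭ (innerᵇ u v) τ)) (trans skip
        (cong (_∸ 2) (trans (sym (↭P.↭-length τ)) (length-tabulate {n = n} id))))
      where
      skip : count (innerᵇ u v) (u ∷ v ∷ l) ≡ length l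
      skip = trans (count-∷ (innerᵇ u v) u (v ∷ l)) (trans (cong₂ _+_ (cong bit (≢true (λ e → proj₁ (innerᵇ⁻ {u = u} {v} {u} e) refl)))
        (trans (count-∷ (innerᵇ u v) v l) (cong (_+ count (innerᵇ u v) l) (cong bit (≢true (λ e → proj₂ (innerᵇ⁻ {u = u} {v} {v} e) refl))))))
        (count-full l (λ {x} mx → innerᵇ⁺ {u = u} {v} {x} ((λ { refl → u∉l mx }) , (λ { refl → v∉l mx })))))

    from-step : ∀ b l → count (from b) l ≡ count (inClass b) l + count (from (suc b)) l
    from-step b [] = refl
    from-step b (x ∷ l) = trans (count-∷ (from b) x l) (trans (cong₂ _+_ here-bit (from-step b l))
      (trans (+-exchange (bit (inClass b x)) _ _ _) (sym (cong₂ _+_ (count-∷ (inClass b) x l) (count-∷ (from (suc b)) x l)))))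
      where
      here-bit : bit (from b x) ≡ bit (inClass b x) + bit (from (suc b) x)
      here-bit with innerᵇ u v x
      ... | false = refl
      ... | true with <-cmpℕ b (label x)
      ...   | tri< lt ne _ rewrite ⌊⌋-intro (b ≤? label x) (<⇒≤ lt) | ⌊⌋-false (label x ≟ℕ b) (ne ∘ sym) | ⌊⌋-intro (suc b ≤? label x) lt = refl
      ...   | tri≈ ¬lt eq _ rewrite ⌊⌋-intro (b ≤? label x) (≤-reflexive eq) | ⌊⌋-intro (label x ≟ℕ b) (sym eq) | ⌊⌋-false (suc b ≤? label x) ¬lt = refl
      ...   | tri> ¬lt ne gt rewrite ⌊⌋-false (b ≤? label x) (<⇒≱ gt) | ⌊⌋-false (label x ≟ℕ b) (ne ∘ sym) | ⌊⌋-false (suc b ≤? label x) ¬lt = refl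

    from-count : ∀ b → b ≤ β → b * m + count (from b) (allFin n) ≡ n ∸ 2
    from-count zero _ = trans (count-cong (allFin n) (λ {x} _ → bool-≡ (λ e → proj₁ (∧-true (innerᵇ u v x) _ e))
      (λ e → ∧-intro e (⌊⌋-intro (0 ≤? label x) z≤n)))) inner-count
    from-count (suc b) lt = trans (lem m (b * m) _)
      (trans (cong (b * m +_) (trans (cong (_+ count (from (suc b)) (allFin n)) (sym (size b lt))) (sym (from-step b (allFin n))))) (from-count b (<⇒≤ lt)))
      where lem : ∀ x y z → x + y + z ≡ y + (x + z)
            lem = solve-∀

    class-β : count (inClass β) (allFin n) ≤ (n ∸ 2) % m
    class-β = ≤-trans (m≤m+n _ _) (≤-reflexive (trans (sym (from-step β (allFin n)))
      (+-cancelˡ-≡ (β * m) _ _ (trans (from-count β ≤-refl) (sym (Periodic.divMod-≡ id m′ (n ∸ 2)))))))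

    class≤m : ∀ {i} → i ≤ β → count (inClass i) (allFin n) ≤ m
    class≤m i≤β with m≤n⇒m<n∨m≡n i≤β
    ... | inj₁ lt = ≤-reflexive (size _ lt)
    ... | inj₂ refl = ≤-trans class-β (<⇒≤ (m%n<n (n ∸ 2) m))

    Terminal : Fin n → Set
    Terminal x = x ≡ u ⊎ x ≡ v

    terminal? : ∀ x → Terminal x ⊎ Inner u v x
    terminal? x with x ≟ u | x ≟ v
    ... | yes p | _ = inj₁ (inj₁ p)
    ... | no _ | yes q = inj₁ (inj₂ q)
    ... | no p | no q = inj₂ (p , q)

    inner-terminal : ∀ {x} → Inner u v x → ¬ Terminal x
    inner-terminal (p , _) (inj₁ e) = p e
    inner-terminal (_ , q) (inj₂ e) = q e

    drop-last : ∀ {R : Fin n → Fin n → Set} l {y} → Linked R (l ++ y ∷ []) → Linked R l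
    drop-last [] _ = []
    drop-last (x ∷ []) _ = [-]
    drop-last (x ∷ x′ ∷ l) (r ∷ ln) = r ∷ drop-last (x′ ∷ l) ln

    linked-tail : ∀ {R : Fin n → Fin n → Set} {x l} → Linked R (x ∷ l) → Linked R l
    linked-tail [-] = []
    linked-tail (_ ∷ ln) = ln

  -- Even with xy added, edges between inner vertices preserve labels, so apart from u and v a cycle
  -- through uv stays in one class. It thus has at most 2 + m = k vertices, against edge-maximality
  -- if xy were missing.
  complete : ∀ {x y} → x ≢ y → Terminal x ⊎ Terminal y ⊎ label x ≡ label y → Adj (adj M) x y
  complete {x} {y} x≢y h with Bool-dec (adj M x y)
  ... | inj₁ e = e
  ... | inj₂ e with max x y x≢y e
  ...   | [] , (_ , _ , ()) , _
  ...   | w ∷ ws , ((_ ∷ pu) ∷ pv ∷ uw , ln , _) , long = ⊥-elim (<⇒≱ long (s≤s (s≤s (≤-trans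
        (unique-⊆-length uw (λ {a} ma → ∈-filterᵇ⁺ (inClass (label w)) (∈-allFin a)
          (∧-intro (innerᵇ⁺ (All.lookup inn ma)) (⌊⌋-intro (label a ≟ℕ label w) (All.lookup labels ma)))))
        (class≤m (label≤ w))))))
    where
    inn : All (Inner u v) (w ∷ ws)
    inn = All.zipWith (λ (p , q) → (p ∘ sym) , (q ∘ sym)) (pu , pv)
    same-label : ∀ {a b} → Inner u v a → Inner u v b → addEdge (adj M) x y a b ≡ true → label a ≡ label b
    same-label {a} {b} ia ib e with (a ≟ x) ×-dec (b ≟ y) | (a ≟ y) ×-dec (b ≟ x)
    ... | yes (refl , refl) | _ = [ ⊥-elim ∘ inner-terminal ia , [ ⊥-elim ∘ inner-terminal ib , id ]′ ]′ h
    ... | no _ | yes (refl , refl) = [ ⊥-elim ∘ inner-terminal ib , [ ⊥-elim ∘ inner-terminal ia , sym ]′ ]′ h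
    ... | no p | no q = nocross ia ib (trans (sym (addEdge-off (adj M) p q)) e)
    propagate : ∀ {a l} → Linked (Adj (addEdge (adj M) x y)) (a ∷ l) → All (Inner u v) (a ∷ l) → All (λ b → label b ≡ label a) (a ∷ l)
    propagate [-] _ = refl ∷ []
    propagate (r ∷ ln) (ia ∷ ib ∷ is) = refl ∷ All.map (λ q → trans q (sym (same-label ia ib r))) (propagate ln (ib ∷ is))
    labels : All (λ b → label b ≡ label w) (w ∷ ws)
    labels = propagate (drop-last (w ∷ ws) (linked-tail (linked-tail ln))) inn

  private
    before : Fin n → Fin n → Bool
    before x y = ⌊ toℕ y <? toℕ x ⌋ ∧ inClass (label x) y

    rank : Fin n → ℕ
    rank x = count (before x) (allFin n)

    in-own : ∀ {x} → Inner u v x → inClass (label x) x ≡ true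
    in-own {x} ix = ∧-intro (innerᵇ⁺ ix) (⌊⌋-intro (label x ≟ℕ label x) refl)

    not-before : ∀ x → before x x ≡ false
    not-before x = cong (_∧ inClass (label x) x) (⌊⌋-false (toℕ x <? toℕ x) (<-irrefl refl))

    rank< : ∀ {x} → Inner u v x → rank x < count (inClass (label x)) (allFin n)
    rank< {x} ix = count-< (before x) (inClass (label x)) (allFin n) (λ y e → proj₂ (∧-true ⌊ toℕ y <? toℕ x ⌋ _ e))
      (∈-allFin x) (not-before x) (in-own ix)

    rank<m : ∀ {x} → Inner u v x → rank x < m
    rank<m {x} ix = <-≤-trans (rank< ix) (class≤m (label≤ x))

    rank-mono : ∀ {x y} → Inner u v x → label x ≡ label y → toℕ x < toℕ y → rank x < rank y
    rank-mono {x} {y} ix l lt = count-< (before x) (before y) (allFin n) grow (∈-allFin x) (not-before x)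
      (∧-intro (⌊⌋-intro (toℕ x <? toℕ y) lt) (subst (λ i → inClass i x ≡ true) l (in-own ix)))
      where
      grow : ∀ z → before x z ≡ true → before y z ≡ true
      grow z e with ∧-true ⌊ toℕ z <? toℕ x ⌋ _ e
      ... | zx , c = ∧-intro (⌊⌋-intro (toℕ z <? toℕ y) (<-trans (⌊⌋-true (toℕ z <? toℕ x) zx) lt)) (subst (λ i → inClass i z ≡ true) l c)

    -- The position of an inner vertex of M behind the two dominating vertices of X: classes stand
    -- in the order of their labels and each class is ordered by index. The rank is below m, so
    -- dividing by m recovers the label as the block number.
    offset : Fin n → ℕ
    offset x = label x * m + rank x

    offset< : ∀ {x} → Inner u v x → offset x < n ∸ 2
    offset< {x} ix with m≤n⇒m<n∨m≡n (label≤ x)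
    ... | inj₁ lt = <-≤-trans (subst (offset x <_) (+-comm (label x * m) m) (+-monoʳ-< (label x * m) (rank<m ix)))
          (≤-trans (*-monoˡ-≤ m lt) (m/n*n≤m (n ∸ 2) m))
    ... | inj₂ eq = subst (offset x <_) (Periodic.divMod-≡ id m′ (n ∸ 2))
          (subst (λ i → i * m + rank x < β * m + (n ∸ 2) % m) (sym eq)
            (+-monoʳ-< (β * m) (<-≤-trans (subst (λ i → rank x < count (inClass i) (allFin n)) eq (rank< ix)) class-β)))

    offset-label : ∀ {x} → Inner u v x → offset x / m ≡ label x
    offset-label {x} ix = block-quotient m′ (label x) (rank x) (rank<m ix)

    offset-injective : ∀ {x y} → Inner u v x → Inner u v y → offset x ≡ offset y → x ≡ y
    offset-injective {x} {y} ix iy e with trans (sym (offset-label ix)) (trans (cong (_/ m) e) (offset-label iy))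
    ... | l with +-cancelˡ-≡ (label x * m) (rank x) (rank y) (trans e (cong (λ i → i * m + rank y) (sym l))) | <-cmp x y
    ...   | r | tri< lt _ _ = ⊥-elim (<-irrefl r (rank-mono ix l lt))
    ...   | r | tri≈ _ x≡y _ = x≡y
    ...   | r | tri> _ _ gt = ⊥-elim (<-irrefl (sym r) (rank-mono iy (sym l) gt))

    data Kind (x : Fin n) : Set where
      isU : x ≡ u → Kind x
      isV : x ≡ v → Kind x
      isI : Inner u v x → Kind x

    kind : ∀ x → Kind x
    kind x with x ≟ u | x ≟ v
    ... | yes p | _ = isU p
    ... | no _ | yes q = isV q
    ... | no p | no q = isI (p , q)

    place : ∀ {x} → Kind x → ℕ
    place (isU _) = 0
    place (isV _) = 1
    place {x} (isI _) = 2 + offset x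

    2≤n : 2 ≤ n
    2≤n = unique-count u≢v
      where
      unique-count : ∀ {a b : Fin n} → a ≢ b → 2 ≤ n
      unique-count {a} {b} ne = subst (2 ≤_) (length-tabulate {n = n} id) (unique-⊆-length {xs = a ∷ b ∷ []} ((ne ∷ []) ∷ [] ∷ []) (λ {z} _ → ∈-allFin z))

    place< : ∀ {x} (k : Kind x) → place k < n
    place< (isU _) = ≤-trans (s≤s z≤n) 2≤n
    place< (isV _) = 2≤n
    place< {x} (isI ix) = subst (2 + offset x <_) (m+[n∸m]≡n 2≤n) (+-monoʳ-< 2 (offset< ix))

    place-injective : ∀ {x y} (k : Kind x) (l : Kind y) → place k ≡ place l → x ≡ y
    place-injective (isU p) (isU q) e = trans p (sym q)
    place-injective (isV p) (isV q) e = trans p (sym q)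
    place-injective (isI p) (isI q) e = offset-injective p q (suc-injective (suc-injective e))

    small-terminal : ∀ {x} (k : Kind x) → place k < 2 → Terminal x
    small-terminal (isU p) _ = inj₁ p
    small-terminal (isV p) _ = inj₂ p
    small-terminal (isI _) (s≤s (s≤s ()))

    terminal-small : ∀ {x} (k : Kind x) → Terminal x → place k < 2
    terminal-small (isU _) _ = s≤s z≤n
    terminal-small (isV _) _ = s≤s (s≤s z≤n)
    terminal-small (isI i) t = ⊥-elim (inner-terminal i t)

    block-label : ∀ {x} (k : Kind x) → Inner u v x → (place k ∸ 2) / m ≡ label x
    block-label (isU p) i = ⊥-elim (proj₁ i p)
    block-label (isV p) i = ⊥-elim (proj₂ i p)
    block-label (isI _) i = offset-label i

    position : Fin n → Fin n
    position x = fromℕ< (place< (kind x))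

    toℕ-position : ∀ x → toℕ (position x) ≡ place (kind x)
    toℕ-position x = toℕ-fromℕ< (place< (kind x))

    position-injective : ∀ {x y} → position x ≡ position y → x ≡ y
    position-injective {x} {y} e = place-injective (kind x) (kind y)
      (trans (sym (toℕ-position x)) (trans (cong toℕ e) (toℕ-position y)))

    preserves : ∀ x y → xadj m′ (place (kind x)) (place (kind y)) ≡ adj M x y
    preserves x y = bool-≡ to-M to-X
      where
      to-M : xadj m′ (place (kind x)) (place (kind y)) ≡ true → adj M x y ≡ true
      to-M e with xadj⁻ {m′} {place (kind x)} {place (kind y)} e
      ... | ne , near = complete (λ { refl → ne refl }) (relate near)
        where
        relate : place (kind x) < 2 ⊎ place (kind y) < 2 ⊎ (place (kind x) ∸ 2) / m ≡ (place (kind y) ∸ 2) / m →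
          Terminal x ⊎ Terminal y ⊎ label x ≡ label y
        relate (inj₁ p) = inj₁ (small-terminal (kind x) p)
        relate (inj₂ (inj₁ p)) = inj₂ (inj₁ (small-terminal (kind y) p))
        relate (inj₂ (inj₂ p)) = by-kind (terminal? x) (terminal? y)
          where
          by-kind : Terminal x ⊎ Inner u v x → Terminal y ⊎ Inner u v y → Terminal x ⊎ Terminal y ⊎ label x ≡ label y
          by-kind (inj₁ t) _ = inj₁ t
          by-kind (inj₂ _) (inj₁ t) = inj₂ (inj₁ t)
          by-kind (inj₂ ix) (inj₂ iy) = inj₂ (inj₂ (trans (sym (block-label (kind x) ix)) (trans p (block-label (kind y) iy))))
      to-X : adj M x y ≡ true → xadj m′ (place (kind x)) (place (kind y)) ≡ true
      to-X e = xadj⁺ {m′} {place (kind x)} {place (kind y)} (λ p → Adj-≢ {G = M} e (place-injective (kind x) (kind y) p))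
          (by-kind (terminal? x) (terminal? y))
        where
        by-kind : Terminal x ⊎ Inner u v x → Terminal y ⊎ Inner u v y →
          place (kind x) < 2 ⊎ place (kind y) < 2 ⊎ (place (kind x) ∸ 2) / m ≡ (place (kind y) ∸ 2) / m
        by-kind (inj₁ t) _ = inj₁ (terminal-small (kind x) t)
        by-kind (inj₂ _) (inj₁ t) = inj₂ (inj₁ (terminal-small (kind y) t))
        by-kind (inj₂ ix) (inj₂ iy) = inj₂ (inj₂ (trans (block-label (kind x) ix) (trans (nocross ix iy e) (sym (block-label (kind y) iy)))))

  isomorphic : M ≅ X n (3 + m′)
  isomorphic = proj₁ bij , λ x y → trans (cong₂ (Xadj n (3 + m′)) (proj₂ bij x) (proj₂ bij y))
      (trans (Xadj-ℕ n m′ (position x) (position y)) (trans (cong₂ (xadj m′) (toℕ-position x) (toℕ-position y)) (preserves x y)))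
    where
    bij = injective⇒↔ position position-injective

Linkage-⊆ : ∀ {n} {G M : Graph n} {u v} → G ⊆G M → Linkage G u v → Linkage M u v
Linkage-⊆ {G = G} {M} {u} {v} sub lk x a a≢x = lift (lk x a a≢x)
  where
  lift : ∀ {a} → Esc G u v x a → Esc M u v x a
  lift (stop p t) = stop p t
  lift (go p e r) = go p (sub _ _ e) (lift r)

theorem6 : ∀ (n k s : ℕ) → 3 ≤ n → 3 ≤ s → s ≤ k →
  (G : Graph n) → TwoConnected G →
  (u v : Fin n) → adj G u v ≡ true → CircLe (adj G) u v k →
  N s G ≡ g s n k →
  (M : Graph n) → EdgeMaximal G u v k M →
  M ≅ X n k
theorem6 n (suc (suc (suc m′))) (suc (suc (suc σ))) 3≤n (s≤s (s≤s (s≤s _))) (s≤s (s≤s (s≤s σ≤m′))) G conn u v uv _ eq M (G⊆M , le , max) =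
  by-reduction (dominate {β = (n ∸ 2) / suc m′} M u v (s≤s z≤n) uvM linkage (Bounded⁺ (s≤s (s≤s z≤n)) uvM le))
  where
  uvM : Adj (adj M) u v
  uvM = G⊆M u v uv
  u≢v : u ≢ v
  u≢v = Adj-≢ {G = G} uv
  linkage : Linkage M u v
  linkage = Linkage-⊆ G⊆M (Linkage⁺ u≢v conn)
  many : F (cliqueWeight σ) m′ (n ∸ 2) ≤ N (3 + σ) M
  many = ≤-trans (F≤g σ m′ n (<⇒≤ 3≤n)) (≤-trans (≤-reflexive (sym eq)) (N-mono {G = G} {M} (3 + σ) G⊆M))
  by-reduction : (∃ λ H → Dominated H u v (suc m′) × Reduces M H u v (suc m′) ((n ∸ 2) / suc m′)) → M ≅ X n (3 + m′)
  by-reduction (H , dom , red) with compress {β = (n ∸ 2) / suc m′} H u v dom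
  ... | J , domJ , cmp , red′ = Rigid.isomorphic {M = M} uvM le max (Reduces.good red (Reduces.good red′
        (Extremal.extremal-good J u v m′ σ σ≤m′ u≢v domJ cmp
          -- `Reduces.cliques` compares cliques of order 2 plus its argument, so 1 + σ stands for s
          -- = 3 + σ.
          (≤-trans many (≤-trans (Reduces.cliques red (1 + σ)) (Reduces.cliques red′ (1 + σ)))))))
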